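{- Let $x,y$ be distinct variables. The problem $\mathrm{MC}(\mathrm{dep}(x,y)\lor\mathrm{dep}(y,x))$ is in $\mathrm{L}$ (deterministic logarithmic space).
   Context: A team $T$ with domain $X$ (a finite set of variables) and range $A$ is a set of assignments $s\colon X\to A$. $T\models\mathrm{dep}(v,w)$ iff for all $s_1,s_2\in T$ with $s_1(v)=s_2(v)$ we have $s_1(w)=s_2(w)$. $T\models\varphi_1\lor\varphi_2$ iff there are teams $T_1,T_2$ with $T=T_1\cup T_2$, $T_1\models\varphi_1$ and $T_2\models\varphi_2$. For a fixed $\varphi$, the problem $\mathrm{MC}(\varphi)$ is: given a finite team $T$ with finite range and finite domain containing the variables of $\varphi$, decide whether $T\models\varphi$. -}

module Defs where

open import Data.Bool.Base using (Bool; true; false)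
open import Data.Fin.Base using (Fin; toℕ)
open import Data.Fin.Patterns using (0F; 1F; 2F; 3F)
open import Data.List.Base using (List; []; _∷_; [_]; _++_; length; concatMap)
open import Data.List.Membership.Propositional using (_∈_)
open import Data.List.Relation.Unary.Any using (index)
open import Data.List.Relation.Unary.Unique.Propositional using (Unique)
open import Data.Maybe.Base using (Maybe; just; nothing; maybe′)
open import Data.Nat.Base using (ℕ; zero; suc; pred; _+_; _*_; _⊓_; _≤_)
open import Data.Nat.Binary.Base using (ℕᵇ; zero; 2[1+_]; 1+[2_]; fromℕ)
open import Data.Nat.GeneralisedArithmetic using (fold)
open import Data.Nat.Logarithm using (⌈log₂_⌉)
open import Data.Product.Base using (∃; Σ-syntax; ∃-syntax; _×_; _,_)
open import Data.Vec.Base as Vec using (Vec; lookup; toList)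
open import Function.Bundles using (_↔_; _⇔_)
open import Level using (0ℓ; Lift)
open import Relation.Binary.PropositionalEquality.Core using (_≡_)
open import Relation.Unary using (Pred; _≐_; _∪_)

------------------------------------------------------------------------
-- Team semantics

private
  1ℓ = Level.suc 0ℓ

Var : Set
Var = ℕ

infixr 6 _∨_

data Formula : Set where
  dep : Var → Var → Formula
  _∨_ : Formula → Formula → Formula

-- A finite set X of variables is a list (duplicate-free, see `Instance`),
-- and an assignment s : X → A is its table of values along that list.

Assignment : List Var → Set → Set
Assignment X A = Vec A (length X)

_⟨_⟩ : ∀ {X A v} → Assignment X A → v ∈ X → A
s ⟨ v∈X ⟩ = lookup s (index v∈X)

-- Arbitrary sets of assignments, not only finite ones.

Team : List Var → Set → Set₁
Team X A = Pred (Assignment X A) 0ℓ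

-- X contains the variables of φ.

_Over_ : Formula → List Var → Set
dep v w Over X = v ∈ X × w ∈ X
(φ ∨ ψ) Over X = φ Over X × ψ Over X

Sat : ∀ {X A} → Team X A → (φ : Formula) → φ Over X → Set₁
Sat {X} {A} T (dep v w) (v∈X , w∈X) = Lift (1ℓ)
  (∀ (s₁ s₂ : Assignment X A) → T s₁ → T s₂ →
     s₁ ⟨ v∈X ⟩ ≡ s₂ ⟨ v∈X ⟩ → s₁ ⟨ w∈X ⟩ ≡ s₂ ⟨ w∈X ⟩)
Sat {X} {A} T (φ ∨ ψ) (p , q) =
  Σ[ T₁ ∈ Team X A ] Σ[ T₂ ∈ Team X A ]
    (T ≐ T₁ ∪ T₂) × Sat T₁ φ p × Sat T₂ ψ q

------------------------------------------------------------------------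
-- Deterministic logarithmic space

Finite : Set → Set
Finite A = ∃[ n ] (A ↔ Fin n)

Language : ℕ → Set₂
Language k = Pred (List (Fin k)) (1ℓ)

data Move : Set where
  left stay right : Move

-- What the input head reads: the input is placed between end markers.

data InputCell (k : ℕ) : Set where
  ⊢ ⊣ : InputCell k
  sym : Fin k → InputCell k

-- Deterministic Turing machine with a read-only two-way input tape over
-- Fin k and finitely many two-way infinite read/write work tapes.

record Machine (k : ℕ) : Set₁ where
  field
    State       : Set
    Symbol      : Set
    stateFinite : Finite State
    symFinite   : Finite Symbol
    tapes       : ℕ
    start       : State
    blank       : Symbol
    -- `just true` accepts, `just false` rejects, `nothing` continues.
    verdict     : State → Maybe Bool
    δ           : State → InputCell k → Vec Symbol tapes →
                  State × Move × Vec (Symbol × Move) tapes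

-- `before` lists the cells to the left of the head, nearest first, and
-- `after` those to its right; only visited cells are stored.

record Tape (S : Set) : Set where
  constructor tape
  field
    before : List S
    head   : S
    after  : List S

cells : ∀ {S} → Tape S → ℕ
cells (tape ls _ rs) = length ls + 1 + length rs

act : ∀ {S} → S → Tape S → S × Move → Tape S
act blank (tape []       _ rs)       (b , left)  = tape [] blank (b ∷ rs)
act blank (tape (l ∷ ls) _ rs)       (b , left)  = tape ls l (b ∷ rs)
act blank (tape ls       _ rs)       (b , stay)  = tape ls b rs
act blank (tape ls       _ [])       (b , right) = tape (b ∷ ls) blank []
act blank (tape ls       _ (r ∷ rs)) (b , right) = tape (b ∷ ls) r rs

-- Position 0 is the left end marker; positions 1 to length w hold w.

scan : ∀ {k} → List (Fin k) → ℕ → InputCell k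
scan w       zero                = ⊢
scan []      (suc _)           = ⊣
scan (a ∷ w) (suc zero)        = sym a
scan (a ∷ w) (suc i@(suc _)) = scan w i

-- The input head cannot leave the end markers.

moveInput : ∀ {k} → List (Fin k) → Move → ℕ → ℕ
moveInput w left  i = pred i
moveInput w stay  i = i
moveInput w right i = suc i ⊓ suc (length w)

module Run {k : ℕ} (M : Machine k) (w : List (Fin k)) where
  open Machine M

  record Config : Set where
    constructor config
    field
      state    : State
      inputPos : ℕ
      work     : Vec (Tape Symbol) tapes

  open Config public

  initial : Config
  initial = config start 0 (Vec.replicate tapes (tape [] blank []))

  advance : Config → Config
  advance (config q i ts) with δ q (scan w i) (Vec.map Tape.head ts)
  ... | q′ , m , as = config q′ (moveInput w m i) (Vec.zipWith (act blank) ts as)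

  step : Config → Config
  step c = maybe′ (λ _ → c) (advance c) (verdict (state c))

  configAt : ℕ → Config
  configAt = fold initial step

  HaltsWith : Bool → Set
  HaltsWith b = ∃[ t ] (verdict (state (configAt t)) ≡ just b)

  space : Config → ℕ
  space c = Vec.sum (Vec.map cells (work c))

record _DecidesIn_ {k : ℕ} (M : Machine k) (P : Language k) (f : ℕ → ℕ) : Set₁ where
  field
    halts   : ∀ w → ∃[ b ] Run.HaltsWith M w b
    correct : ∀ w → P w ⇔ Run.HaltsWith M w true
    bounded : ∀ w t → Run.space M w (Run.configAt M w t) ≤ f (length w)

-- The successor keeps the bound positive on inputs of length at most 1.

InLogspace : ∀ {k} → Language k → Set₁
InLogspace {k} P =
  Σ[ M ∈ Machine k ] ∃[ c ] (M DecidesIn P) (λ n → c * suc ⌈log₂ n ⌉)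

------------------------------------------------------------------------
-- The model checking problem

-- A finite team whose finite range A is Fin size.  The list `rows`
-- presents a set of assignments: order and repetitions are immaterial.

record Instance (φ : Formula) : Set where
  field
    dom       : List Var
    domUnique : Unique dom
    scope     : φ Over dom
    size      : ℕ
    rows      : List (Assignment dom (Fin size))

  team : Team dom (Fin size)
  team s = s ∈ rows

Word : Set
Word = List (Fin 4)

-- Letters 0F and 1F are the digits 1 and 2 of bijective base 2,
-- in which every number has exactly one numeral (least significant digit
-- first; the numeral of 0 is empty).  2F ends a number, 3F ends a list.

digits : ℕᵇ → Word
digits zero     = []
digits 2[1+ b ] = 1F ∷ digits b
digits 1+[2 b ] = 0F ∷ digits b

encodeℕ : ℕ → Word
encodeℕ n = digits (fromℕ n) ++ [ 2F ]

encodeList : List ℕ → Word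
encodeList ns = concatMap encodeℕ ns ++ [ 3F ]

encode : ∀ {φ} → Instance φ → Word
encode I = encodeℕ size ++ encodeList dom
        ++ concatMap (λ s → encodeList (toList (Vec.map toℕ s))) rows
  where open Instance I

MC : Formula → Language 4
MC φ w = Σ[ I ∈ Instance φ ]
  (encode I ≡ w) × Sat (Instance.team I) φ (Instance.scope I)

-- The rows of a team are edges between x-values and y-values, and a split of
-- the team is an orientation in which every value owns at most one of its
-- distinct edges.  For an edge e and one of its ends, walk through the graph:
-- on arriving at a value leave along its cyclically next edge, but treat e as
-- pendant at its other end.  Let each edge that is met be owned by the end at
-- which the walk first arrives along it.  If some orientation gives e to the
-- chosen end, then the walk goes around a tree, first traverses every edge
-- towards its owner and meets all edges at the owners it visits, so the edges
-- that are met form a partial orientation in conflict with no other edge, an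
-- autarky.  Conversely, autarkies that together cover all edges combine into
-- an orientation.  Hence it suffices to test that every edge has an end whose walk
-- yields an autarky, which takes a bounded number of input positions and no
-- algorithm for undirected connectivity.  Positions are kept in
-- binary counters on the work tapes, and the input cell at a position is read
-- by counting down while the input head moves right.

module Submission where

open import Defs
open import Data.Bool.Base using (Bool; true; false; if_then_else_; not; T)
open import Data.Bool.Properties using (not-involutive; not-¬; ¬-not) renaming (_≟_ to _≟ᵇ_)
open import Data.Empty using (⊥; ⊥-elim)
open import Data.Fin.Base as Fin using (Fin; toℕ; fromℕ<)
open import Data.Fin.Patterns using (0F; 1F; 2F; 3F; 4F; 5F)
open import Data.Fin.Properties as Finₚ
  using (toℕ-fromℕ<; toℕ-injective; toℕ<n; toℕ≤n; pigeonhole; +↔⊎; *↔×; 1↔⊤)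
open import Data.List.Base as List
  using (List; []; _∷_; _++_; [_]; length; map; replicate; drop; concatMap; _ʳ++_)
open import Data.List.Membership.Propositional using (_∈_)
open import Data.List.Membership.Propositional.Properties using (∈-map⁺; ∈-map⁻; ∈-lookup)
open import Data.List.Properties
  using (length-map; length-replicate; length-++; ++-assoc; tabulate-lookup; concatMap-map; drop-all)
open import Data.List.Relation.Unary.All as All using (All; []; _∷_)
open import Data.List.Relation.Unary.All.Properties as Allₚ using ()
open import Data.List.Relation.Unary.AllPairs using ([]; _∷_)
open import Data.List.Relation.Unary.Any using (here; there; index)
open import Data.List.Relation.Unary.Any.Properties using (lookup-index)
open import Data.List.Relation.Unary.Unique.Propositional using (Unique)
open import Data.List.Relation.Unary.Unique.Propositional.Properties using () renaming (tabulate⁺ to unique-tabulate)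
open import Data.Maybe.Base using (Maybe; just; nothing; maybe′)
open import Data.Maybe.Properties as Maybeₚ using (just-injective)
open import Data.Nat.Base
open import Data.Nat.Binary.Base as ℕᵇ using (ℕᵇ; 2[1+_]; 1+[2_])
open import Data.Nat.Binary.Properties as ℕᵇₚ using ()
open import Data.Nat.GeneralisedArithmetic using (iterate; iterate-is-fold)
open import Data.Nat.Induction using (<-rec)
open import Data.Nat.Logarithm
open import Data.Nat.Properties
open import Data.Product.Base using (Σ-syntax; ∃; ∃-syntax; _×_; _,_; proj₁; proj₂)
open import Data.Product.Function.NonDependent.Propositional using (_×-↔_)
open import Data.Product.Properties using (,-injective)
open import Data.Sum.Base as Sum using (_⊎_; inj₁; inj₂)
open import Data.Sum.Function.Propositional using (_⊎-↔_)
open import Data.Unit.Base using (⊤; tt)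
open import Data.Vec.Base as Vec using (Vec; []; _∷_; lookup; tabulate; toList; _[_]≔_; zipWith)
open import Data.Vec.Properties
  using (lookup∘updateAt; lookup∘updateAt′; lookup-map; lookup-replicate; []≔-lookup; tabulate∘lookup; length-toList)
open import Function.Base using (_∘_; id)
open import Function.Bundles using (_⇔_; mk⇔; Equivalence)
open import Function.Properties.Inverse using (↔-refl; ↔-sym; ↔-trans)
open import Level using (lift)
open import Relation.Binary.Definitions using (tri<; tri≈; tri>)
open import Relation.Binary.PropositionalEquality
  using (_≡_; _≢_; refl; cong; cong₂; trans; subst; subst₂; module ≡-Reasoning) renaming (sym to ≡-sym)
open import Relation.Nullary using (yes; no; ¬_; Dec)
open import Relation.Nullary.Decidable using (¬?; map′; decidable-stable)

open Equivalence using (to; from)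

-- A table of owners would take linear space, so nothing about the walk is stored: whenever the
-- owner of an edge is asked for, the walk is run again and only its current edge is kept. This is
-- affordable because the walk permutes the pairs of an edge and a direction; it therefore returns
-- to its start, and a counter bounds its length where otherwise a set of visited values would be
-- needed. The walk towards the owner of e meets no cycle but one through e: an edge not owned by
-- the value being left is owned by the value it leads to, and no value owns two edges. Making e
-- pendant cuts this cycle. Autarkies for different edges may contradict each other, which is
-- harmless: one that owns an edge at a value also settles all other edges there, so the first in a
-- fixed order that settles an edge may decide. Input numbers can be exponential in the length of
-- the input and are never held in a counter. Counters hold positions, loop indices and small codes,
-- all at most `3 + length w`; this single bound gives logarithmic space.

finite-⊎ : ∀ {A B} → Finite A → Finite B → Finite (A ⊎ B)
finite-⊎ (m , f) (n , g) = m + n , ↔-trans (f ⊎-↔ g) (↔-sym +↔⊎)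

finite-× : ∀ {A B} → Finite A → Finite B → Finite (A × B)
finite-× (m , f) (n , g) = m * n , ↔-trans (f ×-↔ g) (↔-sym *↔×)

finite-⊤ : Finite ⊤
finite-⊤ = 1 , ↔-sym 1↔⊤

finite-Fin : ∀ n → Finite (Fin n)
finite-Fin n = n , ↔-refl

-- Counter programs

data Prog (k : ℕ) : Set where
  inc   : ℕ → Prog k
  move  : Move → Prog k
  _⨾_   : Prog k → Prog k → Prog k
  while : ℕ → Prog k → Prog k
  until : (InputCell k → Bool) → Prog k → Prog k
  ifz   : ℕ → Prog k → Prog k → Prog k
  cond  : (InputCell k → Bool) → Prog k → Prog k → Prog k

infixr 5 _⨾_

update : (ℕ → ℕ) → ℕ → ℕ → ℕ → ℕ
update ρ r v j with j ≟ r
... | yes _ = v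
... | no _  = ρ j

update-same : ∀ ρ r v → update ρ r v r ≡ v
update-same ρ r v with r ≟ r
... | yes _ = refl
... | no ¬p = ⊥-elim (¬p refl)

update-other : ∀ ρ r v {j} → j ≢ r → update ρ r v j ≡ ρ j
update-other ρ r v {j} j≢r with j ≟ r
... | yes p = ⊥-elim (j≢r p)
... | no _ = refl

update-self : ∀ {ρ r v} → ρ r ≡ v → ∀ j → update ρ r v j ≡ ρ j
update-self {ρ} {r} e j with j ≟ r
... | yes refl = ≡-sym e
... | no _     = refl

Store : Set
Store = ℕ × (ℕ → ℕ)

-- Big-step semantics of counter programs; `while r` and `ifz r` decrement a
-- positive counter r before entering their last branch, and no counter may
-- exceed M.

data Exec {k : ℕ} (w : List (Fin k)) (M : ℕ) : Prog k → Store → Store → Set where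
  exec-inc   : ∀ {r i ρ} → ρ r < M →
               Exec w M (inc r) (i , ρ) (i , update ρ r (suc (ρ r)))
  exec-move  : ∀ {m i ρ} → Exec w M (move m) (i , ρ) (moveInput w m i , ρ)
  exec-⨾     : ∀ {p q s s′ s″} → Exec w M p s s′ → Exec w M q s′ s″ → Exec w M (p ⨾ q) s s″
  while-zero : ∀ {r p i ρ} → ρ r ≡ 0 → Exec w M (while r p) (i , ρ) (i , ρ)
  while-suc  : ∀ {r p i ρ v s s′} → ρ r ≡ suc v → Exec w M p (i , update ρ r v) s →
               Exec w M (while r p) s s′ → Exec w M (while r p) (i , ρ) s′
  until-stop : ∀ {P p i ρ} → P (scan w i) ≡ true → Exec w M (until P p) (i , ρ) (i , ρ)
  until-go   : ∀ {P p i ρ s s′} → P (scan w i) ≡ false → Exec w M p (i , ρ) s →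
               Exec w M (until P p) s s′ → Exec w M (until P p) (i , ρ) s′
  ifz-zero   : ∀ {r p q i ρ s} → ρ r ≡ 0 → Exec w M p (i , ρ) s → Exec w M (ifz r p q) (i , ρ) s
  ifz-suc    : ∀ {r p q i ρ v s} → ρ r ≡ suc v → Exec w M q (i , update ρ r v) s →
               Exec w M (ifz r p q) (i , ρ) s
  cond-true  : ∀ {P p q i ρ s} → P (scan w i) ≡ true → Exec w M p (i , ρ) s →
               Exec w M (cond P p q) (i , ρ) s
  cond-false : ∀ {P p q i ρ s} → P (scan w i) ≡ false → Exec w M q (i , ρ) s →
               Exec w M (cond P p q) (i , ρ) s

maxReg : ∀ {k} → Prog k → ℕ
maxReg (inc r)      = r
maxReg (move m)     = 0
maxReg (p ⨾ q)      = maxReg p ⊔ maxReg q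
maxReg (while r p)  = r ⊔ maxReg p
maxReg (until P p)  = maxReg p
maxReg (ifz r p q)  = r ⊔ (maxReg p ⊔ maxReg q)
maxReg (cond P p q) = maxReg p ⊔ maxReg q

-- Flowcharts

data Instr (k : ℕ) (Q : Set) : Set where
  inc  : ℕ → Q → Instr k Q
  dec  : ℕ → Q → Q → Instr k Q
  move : Move → Q → Instr k Q
  test : (InputCell k → Bool) → Q → Q → Instr k Q
  halt : Bool → Instr k Q

-- Control points are paths into the syntax tree, so the state set is finite by construction and a
-- loop returns to its own test without labels.
Pos : ∀ {k} → Prog k → Set
Pos (inc r)      = ⊤
Pos (move m)     = ⊤
Pos (p ⨾ q)      = Pos p ⊎ Pos q
Pos (while r p)  = ⊤ ⊎ Pos p
Pos (until P p)  = ⊤ ⊎ Pos p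
Pos (ifz r p q)  = ⊤ ⊎ (Pos p ⊎ Pos q)
Pos (cond P p q) = ⊤ ⊎ (Pos p ⊎ Pos q)

finite-Pos : ∀ {k} (p : Prog k) → Finite (Pos p)
finite-Pos (inc r)      = finite-⊤
finite-Pos (move m)     = finite-⊤
finite-Pos (p ⨾ q)      = finite-⊎ (finite-Pos p) (finite-Pos q)
finite-Pos (while r p)  = finite-⊎ finite-⊤ (finite-Pos p)
finite-Pos (until P p)  = finite-⊎ finite-⊤ (finite-Pos p)
finite-Pos (ifz r p q)  = finite-⊎ finite-⊤ (finite-⊎ (finite-Pos p) (finite-Pos q))
finite-Pos (cond P p q) = finite-⊎ finite-⊤ (finite-⊎ (finite-Pos p) (finite-Pos q))

entry : ∀ {k} (p : Prog k) → Pos p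
entry (inc r)      = tt
entry (move m)     = tt
entry (p ⨾ q)      = inj₁ (entry p)
entry (while r p)  = inj₁ tt
entry (until P p)  = inj₁ tt
entry (ifz r p q)  = inj₁ tt
entry (cond P p q) = inj₁ tt

-- The instruction at a position of p, for p placed at emb inside a larger
-- flowchart with continuation ex.

instrAt : ∀ {k Q} (p : Prog k) → (Pos p → Q) → Q → Pos p → Instr k Q
instrAt (inc r)      emb ex _               = inc r ex
instrAt (move m)     emb ex _               = move m ex
instrAt (p ⨾ q)      emb ex (inj₁ x)        = instrAt p (emb ∘ inj₁) (emb (inj₂ (entry q))) x
instrAt (p ⨾ q)      emb ex (inj₂ y)        = instrAt q (emb ∘ inj₂) ex y
instrAt (while r p)  emb ex (inj₁ _)        = dec r ex (emb (inj₂ (entry p)))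
instrAt (while r p)  emb ex (inj₂ x)        = instrAt p (emb ∘ inj₂) (emb (inj₁ tt)) x
instrAt (until P p)  emb ex (inj₁ _)        = test P ex (emb (inj₂ (entry p)))
instrAt (until P p)  emb ex (inj₂ x)        = instrAt p (emb ∘ inj₂) (emb (inj₁ tt)) x
instrAt (ifz r p q)  emb ex (inj₁ _)        = dec r (emb (inj₂ (inj₁ (entry p)))) (emb (inj₂ (inj₂ (entry q))))
instrAt (ifz r p q)  emb ex (inj₂ (inj₁ x)) = instrAt p (emb ∘ inj₂ ∘ inj₁) ex x
instrAt (ifz r p q)  emb ex (inj₂ (inj₂ y)) = instrAt q (emb ∘ inj₂ ∘ inj₂) ex y
instrAt (cond P p q) emb ex (inj₁ _)        = test P (emb (inj₂ (inj₁ (entry p)))) (emb (inj₂ (inj₂ (entry q))))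
instrAt (cond P p q) emb ex (inj₂ (inj₁ x)) = instrAt p (emb ∘ inj₂ ∘ inj₁) ex x
instrAt (cond P p q) emb ex (inj₂ (inj₂ y)) = instrAt q (emb ∘ inj₂ ∘ inj₂) ex y

-- Halted configurations

module RunProperties {k : ℕ} (machine : Machine k) (w : List (Fin k)) where
  open Run machine w
  open Machine machine using (verdict)

  -- `configAt` peels off the last step, `iterate` the first one, as the inductive runs `_⇝_` below
  -- do.
  configAt≡iterate : ∀ t → configAt t ≡ iterate step initial t
  configAt≡iterate = iterate-is-fold initial step

  step-halted : ∀ {c b} → verdict (state c) ≡ just b → step c ≡ c
  step-halted e rewrite e = refl

  step-running : ∀ {c} → verdict (state c) ≡ nothing → step c ≡ advance c
  step-running e rewrite e = refl

  iterate-halted : ∀ t {c b} → verdict (state c) ≡ just b → iterate step c t ≡ c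
  iterate-halted zero    e = refl
  iterate-halted (suc t) {c} e = trans (cong (λ c → iterate step c t) (step-halted {c} e)) (iterate-halted t e)

  -- A halted configuration is a fixed point of `step`, so both verdicts can be compared at time
  -- `t + t′`.
  halts-unique : ∀ {b b′} → HaltsWith b → HaltsWith b′ → b ≡ b′
  halts-unique {b} {b′} (t , e) (t′ , e′) = Maybe-injective
    (trans (≡-sym (later t′ t e)) (trans (cong (λ s → verdict (state (configAt s))) (+-comm t′ t)) (later t t′ e′)))
    where
    Maybe-injective : ∀ {x y : Bool} → just x ≡ just y → x ≡ y
    Maybe-injective refl = refl
    halted : ∀ s t {b} → verdict (state (configAt t)) ≡ just b → configAt (s + t) ≡ configAt t
    halted zero    t e = refl
    halted (suc s) t e = trans (cong step (halted s t e)) (step-halted {configAt t} e)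
    later : ∀ s t {b} → verdict (state (configAt t)) ≡ just b → verdict (state (configAt (s + t))) ≡ just b
    later s t e = trans (cong (verdict ∘ state) (halted s t e)) e

-- Binary counters on tapes.  The head rests on a blank home cell, to the
-- right of which the value is written in bijective base 2, least significant
-- digit first, followed by blanks.

pattern runₚ    = 0F
pattern carryₚ  = 1F
pattern backₚ   = 2F
pattern lookₚ   = 3F
pattern borrowₚ = 4F
pattern eraseₚ  = 5F

Phase : Set
Phase = Fin 6

digit : Bool → Fin 3
digit false = 1F
digit true  = 2F

value : List Bool → ℕ
value []           = 0
value (false ∷ bs) = 1 + 2 * value bs
value (true ∷ bs)  = 2 + 2 * value bs

-- Among the numerals with `n` digits the one made of ones is the smallest; its value is
-- `2 ^ n - 1`.
2^length≤value : ∀ bs → 2 ^ length bs ≤ suc (value bs)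
2^length≤value []           = ≤-refl
2^length≤value (false ∷ bs) = ≤-trans (*-monoʳ-≤ 2 (2^length≤value bs)) (≤-reflexive (*-suc 2 (value bs)))
2^length≤value (true ∷ bs)  = ≤-trans (*-monoʳ-≤ 2 (2^length≤value bs))
  (≤-trans (≤-reflexive (*-suc 2 (value bs))) (n≤1+n _))

bsuc : List Bool → List Bool
bsuc []           = false ∷ []
bsuc (false ∷ bs) = true ∷ bs
bsuc (true ∷ bs)  = false ∷ bsuc bs

value-bsuc : ∀ bs → value (bsuc bs) ≡ suc (value bs)
value-bsuc []           = refl
value-bsuc (false ∷ bs) = refl
value-bsuc (true ∷ bs)  = cong suc (trans (cong (2 *_) (value-bsuc bs)) (*-suc 2 (value bs)))

bpred : List Bool → List Bool
bpred []                = []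
bpred (false ∷ [])      = []
bpred (false ∷ b ∷ bs)  = true ∷ bpred (b ∷ bs)
bpred (true ∷ bs)       = false ∷ bs

value-bpred : ∀ b bs → suc (value (bpred (b ∷ bs))) ≡ value (b ∷ bs)
value-bpred false []       = refl
value-bpred false (b ∷ bs) = cong suc (trans (≡-sym (*-suc 2 _)) (cong (2 *_) (value-bpred b bs)))
value-bpred true bs        = refl

-- The Turing machine of a flowchart

module Counters {k : ℕ} {Q : Set} (finite-Q : Finite Q) (instr : Q → Instr k Q) (start : Q) (K : ℕ) where

  -- Instructions carry unrestricted counter numbers, so the tape index is total with `0F` as junk
  -- value; the bound on `maxReg` in `simulate` excludes the junk case.
  reg : ℕ → Fin (suc K)
  reg r with r <? suc K
  ... | yes r<K = fromℕ< r<K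
  ... | no _    = 0F

  toℕ-reg : ∀ {r} → r ≤ K → toℕ (reg r) ≡ r
  toℕ-reg {r} r≤K with r <? suc K
  ... | yes r<K = toℕ-fromℕ< r<K
  ... | no r≮K  = ⊥-elim (r≮K (s≤s r≤K))

  State : Set
  State = Q × Phase

  -- Digits are never blank, so a blank read in phase `backₚ` is the home cell.
  incδ : Q → Q → Phase → Fin 3 → State × (Fin 3 × Move)
  incδ q q′ runₚ    _  = (q , carryₚ) , 0F , right
  incδ q q′ carryₚ  0F = (q , backₚ) , 1F , left
  incδ q q′ carryₚ  1F = (q , backₚ) , 2F , left
  incδ q q′ carryₚ  2F = (q , carryₚ) , 1F , right
  incδ q q′ backₚ   0F = (q′ , runₚ) , 0F , stay
  incδ q q′ _      h  = (q , backₚ) , h , left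

  -- `lookₚ` and `borrowₚ` differ only on a blank: for `lookₚ` it means that the value is zero, for
  -- `borrowₚ` that all digits were ones, in which case the numeral gets shorter and the digit
  -- written last is erased.
  decδ : Q → Q → Q → Phase → Fin 3 → State × (Fin 3 × Move)
  decδ q q₀ q₁ runₚ    _  = (q , lookₚ) , 0F , right
  decδ q q₀ q₁ lookₚ   0F = (q₀ , runₚ) , 0F , left
  decδ q q₀ q₁ borrowₚ 0F = (q , eraseₚ) , 0F , left
  decδ q q₀ q₁ lookₚ   1F = (q , borrowₚ) , 2F , right
  decδ q q₀ q₁ borrowₚ 1F = (q , borrowₚ) , 2F , right
  decδ q q₀ q₁ lookₚ   2F = (q , backₚ) , 1F , left
  decδ q q₀ q₁ borrowₚ 2F = (q , backₚ) , 1F , left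
  decδ q q₀ q₁ eraseₚ  _  = (q , backₚ) , 0F , left
  decδ q q₀ q₁ backₚ   0F = (q₁ , runₚ) , 0F , stay
  decδ q q₀ q₁ _      h  = (q , backₚ) , h , left

  idle : Vec (Fin 3) (suc K) → Vec (Fin 3 × Move) (suc K)
  idle = Vec.map (λ h → h , stay)

  onTape : Fin (suc K) → State × (Fin 3 × Move) → Vec (Fin 3) (suc K) →
           State × Move × Vec (Fin 3 × Move) (suc K)
  onTape r (s , a) hs = s , stay , idle hs [ r ]≔ a

  perform : Instr k Q → State → InputCell k → Vec (Fin 3) (suc K) →
            State × Move × Vec (Fin 3 × Move) (suc K)
  perform (inc r q′)    (q , ph) c hs = onTape (reg r) (incδ q q′ ph (lookup hs (reg r))) hs
  perform (dec r q₀ q₁) (q , ph) c hs = onTape (reg r) (decδ q q₀ q₁ ph (lookup hs (reg r))) hs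
  perform (move m q′)   (q , ph) c hs = (q′ , runₚ) , m , idle hs
  perform (test P a b)  (q , ph) c hs = ((if P c then a else b) , runₚ) , stay , idle hs
  perform (halt _)      (q , ph) c hs = (q , ph) , stay , idle hs

  verdictOf : Instr k Q → Maybe Bool
  verdictOf (halt b) = just b
  verdictOf _        = nothing

  machine : Machine k
  machine = record
    { State = State ; Symbol = Fin 3
    ; stateFinite = finite-× finite-Q (finite-Fin 6) ; symFinite = finite-Fin 3
    ; tapes = suc K ; start = start , runₚ ; blank = 0F
    ; verdict = λ s → verdictOf (instr (proj₁ s))
    ; δ = λ s → perform (instr (proj₁ s)) s
    }

  act-idle : ∀ (t : Tape (Fin 3)) → act 0F t (Tape.head t , stay) ≡ t
  act-idle (tape [] h rs)       = refl
  act-idle (tape (_ ∷ _) h rs)  = refl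

  act-right : ∀ ls (h b : Fin 3) → act 0F (tape ls h []) (b , right) ≡ tape (b ∷ ls) 0F []
  act-right []      h b = refl
  act-right (_ ∷ _) h b = refl

  act-right-∷ : ∀ ls (h b r : Fin 3) rs → act 0F (tape ls h (r ∷ rs)) (b , right) ≡ tape (b ∷ ls) r rs
  act-right-∷ []      h b r rs = refl
  act-right-∷ (_ ∷ _) h b r rs = refl

  zip-idle : ∀ {n} (ts : Vec (Tape (Fin 3)) n) →
             zipWith (act 0F) ts (Vec.map (λ h → h , stay) (Vec.map Tape.head ts)) ≡ ts
  zip-idle []       = refl
  zip-idle (t ∷ ts) = cong₂ _∷_ (act-idle t) (zip-idle ts)

  zip-onTape : ∀ {n} (ts : Vec (Tape (Fin 3)) n) r τ a →
    zipWith (act 0F) (ts [ r ]≔ τ) (Vec.map (λ h → h , stay) (Vec.map Tape.head (ts [ r ]≔ τ)) [ r ]≔ a)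
      ≡ ts [ r ]≔ act 0F τ a
  zip-onTape (t ∷ ts) 0F τ a          = cong (act 0F τ a ∷_) (zip-idle ts)
  zip-onTape (t ∷ ts) (Fin.suc r) τ a = cong₂ _∷_ (act-idle t) (zip-onTape ts r τ a)

  lookup-head : ∀ {n} (ts : Vec (Tape (Fin 3)) n) r τ → lookup (Vec.map Tape.head (ts [ r ]≔ τ)) r ≡ Tape.head τ
  lookup-head (t ∷ ts) 0F τ          = refl
  lookup-head (t ∷ ts) (Fin.suc r) τ = lookup-head ts r τ

  module Simulation (w : List (Fin k)) (M L : ℕ) (short : ∀ bs → value bs ≤ M → length bs ≤ L) where
    open Run machine w

    Tapes : Set
    Tapes = Vec (Tape (Fin 3)) (suc K)

    -- The cells are the home cell, at most `L` digits, and one blank beyond them that the head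
    -- visits to detect the end of a numeral.
    Fits : Tape (Fin 3) → Set
    Fits t = cells t ≤ suc (suc L)

    record AllFit (ts : Tapes) : Set where
      constructor allFit
      field fitAt : ∀ j → Fits (lookup ts j)
    open AllFit

    infix 4 _⇝_
    -- The space bound is part of the run, since it has to hold at every machine step and not only
    -- between instructions.
    data _⇝_ : Config → Config → Set where
      done : ∀ {c} → AllFit (work c) → c ⇝ c
      next : ∀ {c c′} → AllFit (work c) → Machine.verdict machine (state c) ≡ nothing →
             advance c ⇝ c′ → c ⇝ c′

    ⇝-trans : ∀ {a b c} → a ⇝ b → b ⇝ c → a ⇝ c
    ⇝-trans (done _)     q = q
    ⇝-trans (next f v p) q = next f v (⇝-trans p q)

    fit-update : ∀ {ts} r {τ} → AllFit ts → Fits τ → AllFit (ts [ r ]≔ τ)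
    fit-update {ts} r {τ} fits fit = allFit go
      where
      go : ∀ j → Fits (lookup (ts [ r ]≔ τ) j)
      go j with j Finₚ.≟ r
      ... | yes refl = subst Fits (≡-sym (lookup∘updateAt r ts)) fit
      ... | no j≢r   = subst Fits (≡-sym (lookup∘updateAt′ j r j≢r ts)) (fitAt fits j)

    micro : ∀ {q ph i ts τ c} r (f : Fin 3 → State × (Fin 3 × Move)) →
            verdictOf (instr q) ≡ nothing →
            (∀ x hs → perform (instr q) (q , ph) x hs ≡ onTape r (f (lookup hs r)) hs) →
            AllFit ts → Fits τ →
            config (proj₁ (f (Tape.head τ))) i (ts [ r ]≔ act 0F τ (proj₂ (f (Tape.head τ)))) ⇝ c →
            config (q , ph) i (ts [ r ]≔ τ) ⇝ c
    micro {q} {ph} {i} {ts} {τ} {c} r f v eq fits fit rest =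
      next (fit-update {ts} r {τ} fits fit) v (subst (_⇝ c) (≡-sym adv) rest)
      where
      hs = Vec.map Tape.head (ts [ r ]≔ τ)
      adv : advance (config (q , ph) i (ts [ r ]≔ τ))
            ≡ config (proj₁ (f (Tape.head τ))) i (ts [ r ]≔ act 0F τ (proj₂ (f (Tape.head τ))))
      adv rewrite eq (scan w i) hs | lookup-head ts r τ =
        cong (config _ _) (zip-onTape ts r τ _)

    blanks : ℕ → List (Fin 3)
    blanks m = replicate m 0F

    counter : List Bool → ℕ → Tape (Fin 3)
    counter bs m = tape [] 0F (map digit bs ++ blanks m)

    -- A visited cell stays stored and counts as space even after the numeral has shrunk; `pad`
    -- counts these blanks.
    record Represents (v : ℕ) (t : Tape (Fin 3)) : Set where
      constructor represents
      field
        bits    : List Bool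
        pad     : ℕ
        t≡      : t ≡ counter bits pad
        value≡  : value bits ≡ v
        fits    : length bits + pad ≤ suc L

    -- Tapes with digits ds, stored in reverse, between the home cell and the
    -- head (`ahead`), respectively up to and including the head (`behind`).

    ahead : List Bool → List (Fin 3) → Tape (Fin 3)
    ahead ds []       = tape (map digit ds ++ [ 0F ]) 0F []
    ahead ds (x ∷ xs) = tape (map digit ds ++ [ 0F ]) x xs

    behind : List Bool → List (Fin 3) → Tape (Fin 3)
    behind []       xs = tape [] 0F xs
    behind (d ∷ ds) xs = tape (map digit ds ++ [ 0F ]) (digit d) xs

    act-home : ∀ xs → act 0F (tape [] 0F xs) (0F , right) ≡ ahead [] xs
    act-home []      = refl
    act-home (_ ∷ _) = refl

    act-ahead : ∀ ds b x xs → act 0F (tape (map digit ds ++ [ 0F ]) x xs) (digit b , right) ≡ ahead (b ∷ ds) xs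
    act-ahead ds b x []       = act-right (map digit ds ++ [ 0F ]) x (digit b)
    act-ahead ds b x (y ∷ xs) = act-right-∷ (map digit ds ++ [ 0F ]) x (digit b) y xs

    act-behind : ∀ ds b x xs → act 0F (tape (map digit ds ++ [ 0F ]) x xs) (b , left) ≡ behind ds (b ∷ xs)
    act-behind []       b x xs = refl
    act-behind (d ∷ ds) b x xs = refl

    cells-at : ∀ ds x xs → cells (tape (map digit ds ++ [ 0F ]) x xs) ≡ suc (suc (length ds + length xs))
    cells-at ds x xs rewrite length-++ (map digit ds) {[ 0F ]} | length-map digit ds =
      begin
        length ds + 1 + 1 + length xs     ≡⟨ cong (_+ length xs) (+-comm (length ds + 1) 1) ⟩
        suc (length ds + 1 + length xs)   ≡⟨ cong (λ z → suc (z + length xs)) (+-comm (length ds) 1) ⟩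
        suc (suc (length ds + length xs)) ∎
      where open ≡-Reasoning

    fits-at : ∀ ds x xs → length ds + length xs ≤ L → Fits (tape (map digit ds ++ [ 0F ]) x xs)
    fits-at ds x xs le = subst (_≤ suc (suc L)) (≡-sym (cells-at ds x xs)) (s≤s (s≤s le))

    fits-behind : ∀ ds xs → length ds + length xs ≤ suc L → Fits (behind ds xs)
    fits-behind []       xs le       = s≤s le
    fits-behind (d ∷ ds) xs (s≤s le) = fits-at ds (digit d) xs le

    length-digits : ∀ bs m → length (map digit bs ++ blanks m) ≡ length bs + m
    length-digits bs m = trans (length-++ (map digit bs)) (cong₂ _+_ (length-map digit bs) (length-replicate m))

    fits-ahead : ∀ ds bs m → length ds ≤ L → length ds + (length bs + m) ≤ suc L →
                 Fits (ahead ds (map digit bs ++ blanks m))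
    fits-ahead ds []       zero    le _  = fits-at ds 0F [] (subst (_≤ L) (≡-sym (+-identityʳ _)) le)
    fits-ahead ds []       (suc m) _ le  = fits-at ds 0F (blanks m)
      (subst (λ z → length ds + z ≤ L) (≡-sym (length-replicate m)) (s≤s⁻¹ (subst (_≤ suc L) (+-suc (length ds) m) le)))
    fits-ahead ds (b ∷ bs) m       _ le  = fits-at ds (digit b) (map digit bs ++ blanks m)
      (subst (λ z → length ds + z ≤ L) (≡-sym (length-digits bs m))
        (s≤s⁻¹ (subst (_≤ suc L) (+-suc (length ds) (length bs + m)) le)))

    shift : ∀ {x} (ds : List Bool) (n : ℕ) → length ds + suc n ≤ x → suc (length ds) + n ≤ x
    shift {x} ds n = subst (_≤ x) (+-suc (length ds) n)

    module Routine {q : Q} {r : Fin (suc K)} {i : ℕ} {ts : Tapes}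
      (g : Phase → Fin 3 → State × (Fin 3 × Move))
      (running : verdictOf (instr q) ≡ nothing)
      (performs : ∀ ph x hs → perform (instr q) (q , ph) x hs ≡ onTape r (g ph (lookup hs r)) hs)
      (fitting : AllFit ts) where

      infix 4 _↝_
      _↝_ : State × Tape (Fin 3) → State × Tape (Fin 3) → Set
      (s , τ) ↝ (s′ , τ′) = config s i (ts [ r ]≔ τ) ⇝ config s′ i (ts [ r ]≔ τ′)

      tick : ∀ ph τ {s a τ′ c} → g ph (Tape.head τ) ≡ (s , a) → act 0F τ a ≡ τ′ →
             Fits τ → (s , τ′) ↝ c → ((q , ph) , τ) ↝ c
      tick ph τ {s} {a} {τ′} {c} e₁ e₂ fit p =
        micro {q} {ph} {i} {ts} {τ} {config (proj₁ c) i (ts [ r ]≔ proj₂ c)} r (g ph) running (performs ph) fitting fit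
          (subst₂ (λ sa t → (proj₁ sa , t) ↝ c) (≡-sym e₁) (≡-sym (trans (cong (act 0F τ ∘ proj₂) e₁) e₂)) p)

      finish : ∀ s τ → Fits τ → (s , τ) ↝ (s , τ)
      finish s τ fit = done (fit-update {ts} r {τ} fitting fit)

      rewind : ∀ {q₁} → g backₚ 0F ≡ ((q₁ , runₚ) , 0F , stay) →
               (∀ b → g backₚ (digit b) ≡ ((q , backₚ) , digit b , left)) →
               ∀ ds bs m → length ds + (length bs + m) ≤ suc L →
               ((q , backₚ) , behind ds (map digit bs ++ blanks m)) ↝ ((q₁ , runₚ) , counter (ds ʳ++ bs) m)
      rewind {q₁} e₀ e₁ [] bs m le = tick backₚ (counter bs m) e₀ refl fit (finish (q₁ , runₚ) (counter bs m) fit)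
        where
        fit : Fits (counter bs m)
        fit = fits-behind [] (map digit bs ++ blanks m) (subst (_≤ suc L) (≡-sym (length-digits bs m)) le)
      rewind e₀ e₁ (d ∷ ds) bs m le =
        tick backₚ (behind (d ∷ ds) (map digit bs ++ blanks m)) (e₁ d)
          (act-behind ds (digit d) (digit d) (map digit bs ++ blanks m))
          (fits-behind (d ∷ ds) (map digit bs ++ blanks m)
            (subst (λ z → suc (length ds) + z ≤ suc L) (≡-sym (length-digits bs m)) le))
          (rewind e₀ e₁ ds (d ∷ bs) m (subst (_≤ suc L) (≡-sym (+-suc (length ds) _)) le))

    module Increment {q q′ : Q} {r : ℕ} {i : ℕ} {ts : Tapes} (eq : instr q ≡ inc r q′) (fitting : AllFit ts) where
      open Routine {q} {reg r} {i} {ts} (incδ q q′) (cong verdictOf eq)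
        (λ ph x hs → cong (λ I → perform I (q , ph) x hs) eq) fitting

      rewind′ : ∀ ds bs m → length ds + (length bs + m) ≤ suc L →
                ((q , backₚ) , behind ds (map digit bs ++ blanks m)) ↝ ((q′ , runₚ) , counter (ds ʳ++ bs) m)
      rewind′ = rewind refl λ { false → refl ; true → refl }

      -- The digits already passed are in `ds`, reversed, so the induction is on those still ahead.
      -- The first bound concerns the successor, whose numeral may be longer.
      carrying : ∀ ds bs m → length ds + length (bsuc bs) ≤ L → length ds + (length bs + m) ≤ suc L →
        Σ[ m′ ∈ ℕ ] (length ds + (length (bsuc bs) + m′) ≤ suc L) ×
          ((q , carryₚ) , ahead ds (map digit bs ++ blanks m)) ↝ ((q′ , runₚ) , counter (ds ʳ++ bsuc bs) m′)
      carrying ds [] zero le₁ le₂ = 0 , ≤-trans le₁ (n≤1+n L) ,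
        tick carryₚ (ahead ds []) refl (act-behind ds 1F 0F [])
          (fits-ahead ds [] zero (≤-trans (m≤m+n _ _) le₁) le₂)
          (rewind′ ds (false ∷ []) 0 (≤-trans le₁ (n≤1+n L)))
      carrying ds [] (suc m) le₁ le₂ = m , le₂ ,
        tick carryₚ (ahead ds (blanks (suc m))) refl (act-behind ds 1F 0F (blanks m))
          (fits-ahead ds [] (suc m) (≤-trans (m≤m+n _ _) le₁) le₂)
          (rewind′ ds (false ∷ []) m le₂)
      carrying ds (false ∷ bs) m le₁ le₂ = m , le₂ ,
        tick carryₚ (ahead ds (map digit (false ∷ bs) ++ blanks m)) refl
          (act-behind ds 2F 1F (map digit bs ++ blanks m))
          (fits-ahead ds (false ∷ bs) m (≤-trans (m≤m+n _ _) le₁) le₂)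
          (rewind′ ds (true ∷ bs) m le₂)
      carrying ds (true ∷ bs) m le₁ le₂ with carrying (false ∷ ds) bs m (shift ds _ le₁) (shift ds _ le₂)
      ... | m′ , le , p = m′ , subst (_≤ suc L) (≡-sym (+-suc (length ds) _)) le ,
        tick carryₚ (ahead ds (map digit (true ∷ bs) ++ blanks m)) refl
          (act-ahead ds false 2F (map digit bs ++ blanks m))
          (fits-ahead ds (true ∷ bs) m (≤-trans (m≤m+n _ _) le₁) le₂) p

      increment : ∀ {v τ} → Represents v τ → suc v ≤ M →
        Σ[ τ′ ∈ Tape (Fin 3) ] Represents (suc v) τ′ × ((q , runₚ) , τ) ↝ ((q′ , runₚ) , τ′)
      increment (represents bs m refl refl fits) le
        with carrying [] bs m (short (bsuc bs) (≤-trans (≤-reflexive (value-bsuc bs)) le)) fits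
      ... | m′ , fits′ , p = counter (bsuc bs) m′ , represents (bsuc bs) m′ refl (value-bsuc bs) fits′ ,
        tick runₚ (counter bs m) refl (act-home (map digit bs ++ blanks m))
          (fits-behind [] (map digit bs ++ blanks m) (subst (_≤ suc L) (≡-sym (length-digits bs m)) fits)) p

    module Decrement {q q₀ q₁ : Q} {r : ℕ} {i : ℕ} {ts : Tapes} (eq : instr q ≡ dec r q₀ q₁) (fitting : AllFit ts) where
      open Routine {q} {reg r} {i} {ts} (decδ q q₀ q₁) (cong verdictOf eq)
        (λ ph x hs → cong (λ I → perform I (q , ph) x hs) eq) fitting

      rewind′ : ∀ ds bs m → length ds + (length bs + m) ≤ suc L →
                ((q , backₚ) , behind ds (map digit bs ++ blanks m)) ↝ ((q₁ , runₚ) , counter (ds ʳ++ bs) m)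
      rewind′ = rewind refl λ { false → refl ; true → refl }

      -- The behaviour on digits that both phases share: `borrowing` starts in `lookₚ` and recurses
      -- in `borrowₚ`.
      Looking : Phase → Set
      Looking ph = (decδ q q₀ q₁ ph 1F ≡ ((q , borrowₚ) , 2F , right)) ×
                   (decδ q q₀ q₁ ph 2F ≡ ((q , backₚ) , 1F , left))

      borrowing : ∀ ph → Looking ph → ∀ ds b bs m →
        length ds + length (b ∷ bs) ≤ L → length ds + (length (b ∷ bs) + m) ≤ suc L →
        Σ[ m′ ∈ ℕ ] (length ds + (length (bpred (b ∷ bs)) + m′) ≤ suc L) ×
          ((q , ph) , ahead ds (map digit (b ∷ bs) ++ blanks m)) ↝ ((q₁ , runₚ) , counter (ds ʳ++ bpred (b ∷ bs)) m′)
      borrowing ph (e₁ , e₂) ds true bs m le₁ le₂ = m , le₂ ,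
        tick ph (ahead ds (map digit (true ∷ bs) ++ blanks m)) e₂
          (act-behind ds 1F 2F (map digit bs ++ blanks m))
          (fits-ahead ds (true ∷ bs) m (≤-trans (m≤m+n _ _) le₁) le₂)
          (rewind′ ds (false ∷ bs) m le₂)
      -- The two blanks are the erased top digit and the fresh cell that the head visited to its
      -- right.
      borrowing ph (e₁ , e₂) ds false [] zero le₁ le₂ = 2 , le₃ ,
        tick ph (ahead ds (1F ∷ [])) e₁ (act-ahead ds true 1F [])
          (fits-ahead ds (false ∷ []) 0 (≤-trans (m≤m+n _ _) le₁) le₂)
          (tick borrowₚ (ahead (true ∷ ds) []) refl (act-behind (true ∷ ds) 0F 0F [])
            (fits-at (true ∷ ds) 0F [] (shift ds 0 le₁))
            (tick eraseₚ (behind (true ∷ ds) (0F ∷ [])) refl (act-behind ds 0F 2F (0F ∷ []))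
              (fits-behind (true ∷ ds) (0F ∷ []) (shift ds 1 le₃))
              (rewind′ ds [] 2 le₃)))
        where
        le₃ : length ds + 2 ≤ suc L
        le₃ = ≤-trans (≤-reflexive (+-suc (length ds) 1)) (s≤s le₁)
      borrowing ph (e₁ , e₂) ds false [] (suc m) le₁ le₂ = suc (suc m) , le₂ ,
        tick ph (ahead ds (1F ∷ blanks (suc m))) e₁ (act-ahead ds true 1F (blanks (suc m)))
          (fits-ahead ds (false ∷ []) (suc m) (≤-trans (m≤m+n _ _) le₁) le₂)
          (tick borrowₚ (ahead (true ∷ ds) (blanks (suc m))) refl (act-behind (true ∷ ds) 0F 0F (blanks m))
            (fits-ahead (true ∷ ds) [] (suc m) (≤-trans (m≤m+n _ _) (shift ds 0 le₁)) (shift ds _ le₂))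
            (tick eraseₚ (behind (true ∷ ds) (blanks (suc m))) refl (act-behind ds 0F 2F (blanks (suc m)))
              (fits-behind (true ∷ ds) (blanks (suc m))
                (subst (λ z → suc (length ds) + z ≤ suc L) (≡-sym (length-replicate (suc m))) (shift ds _ le₂)))
              (rewind′ ds [] (suc (suc m)) le₂)))
      borrowing ph (e₁ , e₂) ds false (b ∷ bs) m le₁ le₂
        with borrowing borrowₚ (refl , refl) (true ∷ ds) b bs m (shift ds _ le₁) (shift ds _ le₂)
      ... | m′ , le , p = m′ , subst (_≤ suc L) (≡-sym (+-suc (length ds) _)) le ,
        tick ph (ahead ds (map digit (false ∷ b ∷ bs) ++ blanks m)) e₁
          (act-ahead ds true 1F (map digit (b ∷ bs) ++ blanks m))
          (fits-ahead ds (false ∷ b ∷ bs) m (≤-trans (m≤m+n _ _) le₁) le₂) p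

      zeroTest : ∀ {τ} → Represents 0 τ →
        Σ[ τ′ ∈ Tape (Fin 3) ] Represents 0 τ′ × ((q , runₚ) , τ) ↝ ((q₀ , runₚ) , τ′)
      zeroTest (represents [] zero refl refl fits) = counter [] 1 , represents [] 1 refl refl (s≤s z≤n) ,
        tick runₚ (counter [] 0) refl refl (s≤s z≤n)
          (tick lookₚ (ahead [] []) refl refl (fits-at [] 0F [] z≤n)
            (finish (q₀ , runₚ) (counter [] 1) (s≤s (s≤s z≤n))))
      zeroTest (represents [] (suc m) refl refl fits) = counter [] (suc m) , represents [] (suc m) refl refl fits ,
        tick runₚ (counter [] (suc m)) refl refl fit
          (tick lookₚ (ahead [] (blanks (suc m))) refl refl (fits-ahead [] [] (suc m) z≤n fits)
            (finish (q₀ , runₚ) (counter [] (suc m)) fit))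
        where
        fit : Fits (counter [] (suc m))
        fit = fits-behind [] (blanks (suc m)) (subst (_≤ suc L) (≡-sym (length-replicate (suc m))) fits)
      zeroTest (represents (false ∷ bs) m refl () fits)
      zeroTest (represents (true ∷ bs) m refl () fits)

      decrement : ∀ {v τ} → Represents (suc v) τ → suc v ≤ M →
        Σ[ τ′ ∈ Tape (Fin 3) ] Represents v τ′ × ((q , runₚ) , τ) ↝ ((q₁ , runₚ) , τ′)
      decrement (represents [] m refl () fits) le
      decrement {v} (represents (b ∷ bs) m refl e fits) le
        with borrowing lookₚ (refl , refl) [] b bs m (short (b ∷ bs) (≤-trans (≤-reflexive e) le)) fits
      ... | m′ , fits′ , p = counter (bpred (b ∷ bs)) m′ ,
        represents (bpred (b ∷ bs)) m′ refl (suc-injective (trans (value-bpred b bs) e)) fits′ ,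
        tick runₚ (counter (b ∷ bs) m) refl (act-home (map digit (b ∷ bs) ++ blanks m))
          (fits-behind [] (map digit (b ∷ bs) ++ blanks m) (subst (_≤ suc L) (≡-sym (length-digits (b ∷ bs) m)) fits)) p

    record Rep (ρ : ℕ → ℕ) (ts : Tapes) : Set where
      constructor rep-at
      field repAt : ∀ j → Represents (ρ (toℕ j)) (lookup ts j) × ρ (toℕ j) ≤ M
    open Rep

    fit : ∀ {ρ ts} → Rep ρ ts → AllFit ts
    fit rep = allFit λ j → let represents bs m t≡ _ le = proj₁ (repAt rep j) in
      subst Fits (≡-sym t≡) (fits-behind [] (map digit bs ++ blanks m) (subst (_≤ suc L) (≡-sym (length-digits bs m)) le))

    rep-reg : ∀ {ρ ts v r} → r ≤ K → Rep ρ ts → ρ r ≡ v → Represents v (lookup ts (reg r)) × v ≤ M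
    rep-reg {ρ} {ts} {_} {r} r≤K rep refl =
      subst (λ x → Represents (ρ x) (lookup ts (reg r)) × ρ x ≤ M) (toℕ-reg r≤K) (repAt rep (reg r))

    rep-update : ∀ {ρ ts v r τ} → r ≤ K → Rep ρ ts → Represents v τ → v ≤ M → Rep (update ρ r v) (ts [ reg r ]≔ τ)
    rep-update {ρ} {ts} {v} {r} {τ} r≤K rep new le = rep-at go
      where
      go : ∀ j → Represents (update ρ r v (toℕ j)) (lookup (ts [ reg r ]≔ τ) j) × update ρ r v (toℕ j) ≤ M
      go j with j Finₚ.≟ reg r | toℕ j ≟ r
      ... | yes refl | yes _ = subst (Represents v) (≡-sym (lookup∘updateAt (reg r) ts)) new , le
      ... | yes refl | no ≢r = ⊥-elim (≢r (toℕ-reg r≤K))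
      ... | no j≢    | yes e = ⊥-elim (j≢ (Finₚ.toℕ-injective (trans e (≡-sym (toℕ-reg r≤K)))))
      ... | no j≢    | no _  =
        subst (Represents (ρ (toℕ j))) (≡-sym (lookup∘updateAt′ j (reg r) j≢ ts)) (proj₁ (repAt rep j)) ,
        proj₂ (repAt rep j)

    infix 4 _⟶_
    record _⟶_ (a b : Q × Store) : Set where
      constructor reaching
      field reach : ∀ {ts} → Rep (proj₂ (proj₂ a)) ts →
                    Σ[ ts′ ∈ Tapes ] Rep (proj₂ (proj₂ b)) ts′ ×
                      config (proj₁ a , runₚ) (proj₁ (proj₂ a)) ts ⇝ config (proj₁ b , runₚ) (proj₁ (proj₂ b)) ts′
    open _⟶_

    ⟶-trans : ∀ {a b c} → a ⟶ b → b ⟶ c → a ⟶ c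
    ⟶-trans f g = reaching λ rep →
      let ts₁ , rep₁ , p₁ = reach f rep
          ts₂ , rep₂ , p₂ = reach g rep₁
      in ts₂ , rep₂ , ⇝-trans p₁ p₂

    step-inc : ∀ {q r q′ i ρ} → instr q ≡ inc r q′ → r ≤ K → ρ r < M → (q , i , ρ) ⟶ (q′ , i , update ρ r (suc (ρ r)))
    step-inc {q} {r} {q′} {i} {ρ} eq r≤K lt = reaching λ {ts} rep →
      let τ , new , p = Increment.increment {i = i} {ts = ts} eq (fit rep) (proj₁ (rep-reg r≤K rep refl)) lt
      in ts [ reg r ]≔ τ , rep-update r≤K rep new lt ,
         subst (λ t → config (q , runₚ) i t ⇝ config (q′ , runₚ) i (ts [ reg r ]≔ τ)) ([]≔-lookup ts (reg r)) p

    step-zero : ∀ {q r q₀ q₁ i ρ} → instr q ≡ dec r q₀ q₁ → r ≤ K → ρ r ≡ 0 → (q , i , ρ) ⟶ (q₀ , i , ρ)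
    step-zero {q} {r} {q₀} {q₁} {i} {ρ} eq r≤K e = reaching λ {ts} rep →
      let τ , new , p = Decrement.zeroTest {i = i} {ts = ts} eq (fit rep) (proj₁ (rep-reg r≤K rep e))
      in ts [ reg r ]≔ τ ,
         rep-at (λ j → subst (λ v → Represents v (lookup (ts [ reg r ]≔ τ) j) × v ≤ M) (update-self e (toℕ j))
           (repAt (rep-update {ρ} {ts} r≤K rep new z≤n) j)) ,
         subst (λ t → config (q , runₚ) i t ⇝ config (q₀ , runₚ) i (ts [ reg r ]≔ τ)) ([]≔-lookup ts (reg r)) p

    step-suc : ∀ {q r q₀ q₁ i ρ v} → instr q ≡ dec r q₀ q₁ → r ≤ K → ρ r ≡ suc v →
               (q , i , ρ) ⟶ (q₁ , i , update ρ r v)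
    step-suc {q} {r} {q₀} {q₁} {i} {ρ} {v} eq r≤K e = reaching λ {ts} rep →
      let old , le = rep-reg r≤K rep e
          τ , new , p = Decrement.decrement {i = i} {ts = ts} eq (fit rep) old le
      in ts [ reg r ]≔ τ , rep-update r≤K rep new (≤-trans (n≤1+n v) le) ,
         subst (λ t → config (q , runₚ) i t ⇝ config (q₁ , runₚ) i (ts [ reg r ]≔ τ)) ([]≔-lookup ts (reg r)) p

    idle-step : ∀ {q q′ m i ts} → verdictOf (instr q) ≡ nothing →
                (∀ hs → perform (instr q) (q , runₚ) (scan w i) hs ≡ ((q′ , runₚ) , m , idle hs)) →
                AllFit ts → config (q , runₚ) i ts ⇝ config (q′ , runₚ) (moveInput w m i) ts
    idle-step {q} {q′} {m} {i} {ts} v eq fits =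
      next fits v (subst (_⇝ config (q′ , runₚ) (moveInput w m i) ts) (≡-sym adv) (done fits))
      where
      adv : advance (config (q , runₚ) i ts) ≡ config (q′ , runₚ) (moveInput w m i) ts
      adv rewrite eq (Vec.map Tape.head ts) = cong (config _ _) (zip-idle ts)

    step-move : ∀ {q m q′ i ρ} → instr q ≡ move m q′ → (q , i , ρ) ⟶ (q′ , moveInput w m i , ρ)
    step-move {q} eq = reaching λ {ts} rep → ts , rep ,
      idle-step (cong verdictOf eq) (λ hs → cong (λ I → perform I (q , runₚ) _ hs) eq) (fit rep)

    step-test : ∀ {q P q₀ q₁ i ρ} → instr q ≡ test P q₀ q₁ →
                (q , i , ρ) ⟶ ((if P (scan w i) then q₀ else q₁) , i , ρ)
    step-test {q} eq = reaching λ {ts} rep → ts , rep ,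
      idle-step {m = stay} (cong verdictOf eq) (λ hs → cong (λ I → perform I (q , runₚ) _ hs) eq) (fit rep)

    step-true : ∀ {q P q₀ q₁ i ρ} → instr q ≡ test P q₀ q₁ → P (scan w i) ≡ true → (q , i , ρ) ⟶ (q₀ , i , ρ)
    step-true {q} {P} {q₀} {q₁} {i} {ρ} eq e =
      subst (λ b → (q , i , ρ) ⟶ ((if b then q₀ else q₁) , i , ρ)) e (step-test eq)

    step-false : ∀ {q P q₀ q₁ i ρ} → instr q ≡ test P q₀ q₁ → P (scan w i) ≡ false → (q , i , ρ) ⟶ (q₁ , i , ρ)
    step-false {q} {P} {q₀} {q₁} {i} {ρ} eq e =
      subst (λ b → (q , i , ρ) ⟶ ((if b then q₀ else q₁) , i , ρ)) e (step-test eq)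

    -- The induction is on the execution: the last premise of a loop rule concerns the same program
    -- at the same place, so induction on the program would not reach it.
    simulate : ∀ {p i ρ i′ ρ′} (emb : Pos p → Q) (ex : Q) →
               (∀ x → instr (emb x) ≡ instrAt p emb ex x) → maxReg p ≤ K →
               Exec w M p (i , ρ) (i′ , ρ′) → (emb (entry p) , i , ρ) ⟶ (ex , i′ , ρ′)
    simulate emb ex ld b (exec-inc lt) = step-inc (ld tt) b lt
    simulate emb ex ld b exec-move = step-move (ld tt)
    simulate {p ⨾ q} emb ex ld b (exec-⨾ {s′ = _ , _} e₁ e₂) =
      ⟶-trans (simulate (emb ∘ inj₁) (emb (inj₂ (entry q))) (ld ∘ inj₁) (m⊔n≤o⇒m≤o _ _ b) e₁)
              (simulate (emb ∘ inj₂) ex (ld ∘ inj₂) (m⊔n≤o⇒n≤o (maxReg p) _ b) e₂)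
    simulate emb ex ld b (while-zero e) = step-zero (ld (inj₁ tt)) (m⊔n≤o⇒m≤o _ _ b) e
    simulate {while r p} emb ex ld b (while-suc {s = _ , _} e e₁ e₂) =
      ⟶-trans (step-suc (ld (inj₁ tt)) (m⊔n≤o⇒m≤o _ _ b) e)
        (⟶-trans (simulate (emb ∘ inj₂) (emb (inj₁ tt)) (ld ∘ inj₂) (m⊔n≤o⇒n≤o r _ b) e₁)
          (simulate emb ex ld b e₂))
    simulate emb ex ld b (until-stop e) = step-true (ld (inj₁ tt)) e
    simulate {until P p} emb ex ld b (until-go {s = _ , _} e e₁ e₂) =
      ⟶-trans (step-false (ld (inj₁ tt)) e)
        (⟶-trans (simulate (emb ∘ inj₂) (emb (inj₁ tt)) (ld ∘ inj₂) b e₁) (simulate emb ex ld b e₂))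
    simulate {ifz r p q} emb ex ld b (ifz-zero e e₁) =
      ⟶-trans (step-zero (ld (inj₁ tt)) (m⊔n≤o⇒m≤o _ _ b) e)
        (simulate (emb ∘ inj₂ ∘ inj₁) ex (ld ∘ inj₂ ∘ inj₁) (m⊔n≤o⇒m≤o _ _ (m⊔n≤o⇒n≤o r _ b)) e₁)
    simulate {ifz r p q} emb ex ld b (ifz-suc e e₁) =
      ⟶-trans (step-suc (ld (inj₁ tt)) (m⊔n≤o⇒m≤o _ _ b) e)
        (simulate (emb ∘ inj₂ ∘ inj₂) ex (ld ∘ inj₂ ∘ inj₂) (m⊔n≤o⇒n≤o (maxReg p) _ (m⊔n≤o⇒n≤o r _ b)) e₁)
    simulate {cond P p q} emb ex ld b (cond-true e e₁) =
      ⟶-trans (step-true (ld (inj₁ tt)) e)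
        (simulate (emb ∘ inj₂ ∘ inj₁) ex (ld ∘ inj₂ ∘ inj₁) (m⊔n≤o⇒m≤o _ _ b) e₁)
    simulate {cond P p q} emb ex ld b (cond-false e e₁) =
      ⟶-trans (step-false (ld (inj₁ tt)) e)
        (simulate (emb ∘ inj₂ ∘ inj₂) ex (ld ∘ inj₂ ∘ inj₂) (m⊔n≤o⇒n≤o (maxReg p) _ b) e₁)

    open RunProperties machine w

    -- Since the configuration no longer changes after halting, a finite run bounds the space at all
    -- times.
    halting : ∀ {c c′ b} → c ⇝ c′ → Machine.verdict machine (state c′) ≡ just b →
              (∃[ t ] iterate step c t ≡ c′) × (∀ t → AllFit (work (iterate step c t)))
    halting (done fits) e = (0 , refl) , λ t → subst (AllFit ∘ work) (≡-sym (iterate-halted t e)) fits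
    halting {c} (next fits v p) e with halting p e
    ... | (t , eq) , all = (suc t , trans (cong (λ c → iterate step c t) (step-running {c} v)) eq) ,
      λ { zero → fits ; (suc s) → subst (λ c → AllFit (work (iterate step c s))) (≡-sym (step-running {c} v)) (all s) }

    space-fit : ∀ {n} (ts : Vec (Tape (Fin 3)) n) → (∀ j → Fits (lookup ts j)) →
                Vec.sum (Vec.map cells ts) ≤ n * suc (suc L)
    space-fit []       fits = z≤n
    space-fit (t ∷ ts) fits = +-mono-≤ (fits 0F) (space-fit ts (fits ∘ Fin.suc))

    rep-initial : Rep (λ _ → 0) (Vec.replicate (suc K) (tape [] 0F []))
    rep-initial = rep-at λ j →
      subst (Represents 0) (≡-sym (lookup-replicate j (tape [] 0F []))) (represents [] 0 refl refl z≤n) , z≤n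

    outcome : ∀ {q i ρ b} → (start , 0 , λ _ → 0) ⟶ (q , i , ρ) → instr q ≡ halt b →
              HaltsWith b × (∀ t → space (configAt t) ≤ suc K * suc (suc L))
    outcome path e with reach path rep-initial
    ... | ts , _ , p with halting p (cong verdictOf e)
    ... | (t , eq) , all =
      (t , trans (cong (Machine.verdict machine ∘ state) (trans (configAt≡iterate t) eq)) (cong verdictOf e)) ,
      λ s → subst (λ c → space c ≤ suc K * suc (suc L)) (≡-sym (configAt≡iterate s)) (space-fit (work
          (iterate step initial s)) (fitAt (all s)))

-- Numeral lengths and the logarithmic bound

n≤2^⌈log₂n⌉ : ∀ n → n ≤ 2 ^ ⌈log₂ n ⌉
n≤2^⌈log₂n⌉ = <-rec _ go
  where
  open ≤-Reasoning
  go : ∀ n → (∀ {m} → m < n → m ≤ 2 ^ ⌈log₂ m ⌉) → n ≤ 2 ^ ⌈log₂ n ⌉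
  go 0 rec = z≤n
  go 1 rec = ≤-refl
  go n@(suc (suc m)) rec = begin
    n                            ≡⟨ ⌊n/2⌋+⌈n/2⌉≡n n ⟨
    ⌊ n /2⌋ + ⌈ n /2⌉            ≤⟨ +-monoˡ-≤ ⌈ n /2⌉ (⌊n/2⌋≤⌈n/2⌉ n) ⟩
    ⌈ n /2⌉ + ⌈ n /2⌉            ≡⟨ cong (⌈ n /2⌉ +_) (+-identityʳ ⌈ n /2⌉) ⟨
    2 * ⌈ n /2⌉                  ≤⟨ *-monoʳ-≤ 2 (rec (⌈n/2⌉<n m)) ⟩
    2 * 2 ^ ⌈log₂ ⌈ n /2⌉ ⌉      ≡⟨ cong (λ e → 2 * 2 ^ e) (⌈log₂⌈n/2⌉⌉≡⌈log₂n⌉∸1 n) ⟩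
    -- As `n` is at least 2, its logarithm is at least 1 and the truncated subtraction is exact.
    2 ^ suc (⌈log₂ n ⌉ ∸ 1)      ≡⟨ cong (2 ^_) (m+[n∸m]≡n (⌈log₂⌉-mono-≤ {2} {n} (s≤s (s≤s z≤n)))) ⟩
    2 ^ ⌈log₂ n ⌉                ∎

-- For inputs of length `n`, `3 + n` leaves room for the right end marker at `1 + n` and for the
-- literals up to 2. The estimate gives a factor `4 + 1`; rounding it up to 8 costs three digits.
numeral-short : ∀ n bs → value bs ≤ 3 + n → length bs ≤ 3 + ⌈log₂ n ⌉
numeral-short n bs le = subst₂ _≤_ (⌊log₂[2^n]⌋≡n _) (⌊log₂[2^n]⌋≡n _) (⌊log₂⌋-mono-≤ (begin
  2 ^ length bs          ≤⟨ 2^length≤value bs ⟩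
  suc (value bs)         ≤⟨ s≤s le ⟩
  4 + n                  ≤⟨ +-mono-≤ (*-monoʳ-≤ 4 (m^n>0 2 a)) (n≤2^⌈log₂n⌉ n) ⟩
  4 * 2 ^ a + 2 ^ a      ≤⟨ +-monoʳ-≤ (4 * 2 ^ a) (m≤m+n _ (3 * 2 ^ a)) ⟩
  4 * 2 ^ a + 4 * 2 ^ a  ≡⟨ *-distribʳ-+ (2 ^ a) 4 4 ⟨
  8 * 2 ^ a              ≡⟨ ^-distribˡ-+-* 2 3 a ⟨
  2 ^ (3 + a)            ∎))
  where
  open ≤-Reasoning
  a = ⌈log₂ n ⌉

-- The verdict is read off counter 0.

logspace : ∀ {k} {P : Language k} (p : Prog k) (v : List (Fin k) → ℕ) →
  (∀ w → Σ[ i ∈ ℕ ] Σ[ ρ ∈ (ℕ → ℕ) ] Exec w (3 + length w) p (0 , λ _ → 0) (i , ρ) × ρ 0 ≡ v w) →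
  (∀ w → P w ⇔ (v w ≢ 0)) → InLogspace P
-- Each of the `suc (maxReg p)` tapes has at most `2 + (3 + a)` cells, `a` being the logarithm, and
-- `5 + a ≤ 5 * suc a`.
logspace {k} {P} p v computes correct = C.machine , suc (maxReg p) * 5 , record
  { halts = λ w → proj₁ (result w) , proj₁ (proj₂ (proj₂ (result w)))
  ; correct = λ w → mk⇔ (accepts w) (accepted w)
  ; bounded = λ w t → ≤-trans (proj₂ (proj₂ (proj₂ (result w))) t) (bound w)
  }
  where
  Q : Set
  Q = Pos p ⊎ Fin 3

  instr : Q → Instr k Q
  instr (inj₁ x)  = instrAt p inj₁ (inj₂ 0F) x
  instr (inj₂ 0F) = dec 0 (inj₂ 1F) (inj₂ 2F)
  instr (inj₂ 1F) = halt false
  instr (inj₂ 2F) = halt true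

  module C = Counters (finite-⊎ (finite-Pos p) (finite-Fin 3)) instr (inj₁ (entry p)) (maxReg p)

  Answer : ℕ → Bool → Set
  Answer n b = (n ≡ 0 × b ≡ false) ⊎ (n ≢ 0 × b ≡ true)

  result : ∀ w → Σ[ b ∈ Bool ] Answer (v w) b × Run.HaltsWith C.machine w b ×
    (∀ t → Run.space C.machine w (Run.configAt C.machine w t) ≤ suc (maxReg p) * (5 + ⌈log₂ length w ⌉))
  result w with computes w
  ... | i , ρ , exec , e = helper (v w) e
    where
    open C.Simulation w (3 + length w) (3 + ⌈log₂ length w ⌉) (numeral-short (length w))
    path : (inj₁ (entry p) , 0 , λ _ → 0) ⟶ (inj₂ 0F , i , ρ)
    path = simulate inj₁ (inj₂ 0F) (λ _ → refl) ≤-refl exec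
    helper : ∀ n → ρ 0 ≡ n → Σ[ b ∈ Bool ] Answer n b × Run.HaltsWith C.machine w b ×
      (∀ t → Run.space C.machine w (Run.configAt C.machine w t) ≤ suc (maxReg p) * (5 + ⌈log₂ length w ⌉))
    helper zero    e = false , inj₁ (refl , refl) , outcome (⟶-trans path (step-zero refl z≤n e)) refl
    helper (suc n) e = true , inj₂ ((λ ()) , refl) , outcome (⟶-trans path (step-suc refl z≤n e)) refl

  accepts : ∀ w → P w → Run.HaltsWith C.machine w true
  accepts w Pw with result w
  ... | b , inj₁ (e , _)    , _ = ⊥-elim (Equivalence.to (correct w) Pw e)
  ... | b , inj₂ (_ , refl) , h , _ = h

  accepted : ∀ w → Run.HaltsWith C.machine w true → P w
  accepted w h with result w
  ... | b , inj₂ (ne , _) , _ = Equivalence.from (correct w) ne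
  ... | b , inj₁ (_ , refl) , h′ , _ with () ← RunProperties.halts-unique C.machine w h h′

  bound : ∀ w → suc (maxReg p) * (5 + ⌈log₂ length w ⌉) ≤ suc (maxReg p) * 5 * suc ⌈log₂ length w ⌉
  bound w = ≤-trans
    (*-monoʳ-≤ (suc (maxReg p)) (≤-trans (+-monoʳ-≤ 5 (m≤n*m a 5)) (≤-reflexive (≡-sym (*-suc 5 a)))))
    (≤-reflexive (≡-sym (*-assoc (suc (maxReg p)) 5 (suc a))))
    where a = ⌈log₂ length w ⌉

-- A language of functions on input positions.  In the body of `iter`,
-- variable 0 is the number of remaining iterations and variable 1 the state.

data Tm (k : ℕ) : ℕ → Set where
  var  : ∀ {m} → Fin m → Tm k m
  lit  : ∀ {m} → Fin 3 → Tm k m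
  next : ∀ {m} → Tm k m → Tm k m
  prev : ∀ {m} → Tm k m → Tm k m
  top  : ∀ {m} → Tm k m
  is   : ∀ {m} → (InputCell k → Bool) → Tm k m → Tm k m
  ifz  : ∀ {m} → Tm k m → Tm k m → Tm k m → Tm k m
  iter : ∀ {m} → (start count : Tm k m) → Tm k (suc (suc m)) → Tm k m
  call : ∀ {m j} → Tm k j → Vec (Tm k m) j → Tm k m

isStart isEnd : ∀ {k} → InputCell k → Bool
isStart ⊢ = true
isStart _ = false
isEnd ⊣ = true
isEnd _ = false

-- The body sees the indices from `c - 1` down to 0, because the decremented loop counter itself
-- serves as the index.
loop : (ℕ → ℕ → ℕ) → ℕ → ℕ → ℕ
loop f zero    s = s
loop f (suc c) s = loop f c (f c s)

choose : ℕ → ℕ → ℕ → ℕ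
choose zero    a b = a
choose (suc _) a b = b

bit : Bool → ℕ
bit b = if b then 1 else 0

module Semantics {k : ℕ} (w : List (Fin k)) where

  end : ℕ
  end = suc (length w)

  -- It saturates at the end marker, so that no term can exceed the counter bound.
  succ : ℕ → ℕ
  succ p = if isEnd (scan w p) then p else suc p

  eval  : ∀ {m} → Tm k m → Vec ℕ m → ℕ
  evals : ∀ {m j} → Vec (Tm k m) j → Vec ℕ m → Vec ℕ j
  eval (var i)      vs = lookup vs i
  eval (lit n)      vs = toℕ n
  eval (next t)     vs = succ (eval t vs)
  eval (prev t)     vs = pred (eval t vs)
  eval top          vs = end
  eval (is P t)     vs = bit (P (scan w (eval t vs)))
  eval (ifz t a b)  vs = choose (eval t vs) (eval a vs) (eval b vs)
  eval (iter s c b) vs = loop (λ n z → eval b (n ∷ z ∷ vs)) (eval c vs) (eval s vs)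
  eval (call f ts)  vs = eval f (evals ts vs)
  evals []       vs = []
  evals (t ∷ ts) vs = eval t vs ∷ evals ts vs

-- Compilation of terms into counter programs

skip : ∀ {k} → Prog k
skip = move stay

clear : ∀ {k} → ℕ → Prog k
clear r = while r skip

transfer : ∀ {k} → ℕ → ℕ → Prog k
transfer a b = while a (inc b)

-- Reading a counter destroys it; the second copy, in the scratch counter `b`, restores `r`.
duplicate : ∀ {k} → ℕ → ℕ → ℕ → Prog k
duplicate r a b = while r (inc a ⨾ inc b) ⨾ transfer b r

rewind : ∀ {k} → Prog k
rewind = until isStart (move left)

block : ∀ j → ℕ → Vec ℕ j
block zero    l = []
block (suc j) l = l ∷ block j (suc l)

clears : ∀ {k} → ℕ → ℕ → Prog k
clears zero    l = skip
clears (suc j) l = clear l ⨾ clears j (suc l)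

-- code t σ l evaluates t, the variables of which are held in the counters σ
-- below l, into the counter l.

code  : ∀ {k m} → Tm k m → Vec ℕ m → ℕ → Prog k
codes : ∀ {k m j} → Vec (Tm k m) j → Vec ℕ m → ℕ → Prog k
code (var i)      σ l = duplicate (lookup σ i) l (suc l)
code (lit 0F)     σ l = skip
code (lit 1F)     σ l = inc l
code (lit 2F)     σ l = inc l ⨾ inc l
code (next t)     σ l = code t σ l ⨾ duplicate l (suc l) (2 + l) ⨾ while (suc l) (move right) ⨾
                        cond isEnd skip (inc l) ⨾ rewind
-- The test itself decrements a positive counter, so both branches are empty.
code (prev t)     σ l = code t σ l ⨾ ifz l skip skip
code top          σ l = until isEnd (inc l ⨾ move right) ⨾ rewind
code (is P t)     σ l = code t σ l ⨾ while l (move right) ⨾ cond P (inc l) skip ⨾ rewind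
code (ifz t a b)  σ l = code t σ l ⨾ ifz l (code a σ l) (clear l ⨾ code b σ l)
code (iter s c b) σ l = code s σ l ⨾ code c σ (suc l) ⨾
                        while (suc l) (code b (suc l ∷ l ∷ σ) (2 + l) ⨾ clear l ⨾ transfer (2 + l) l)
code {_} {_} (call {_} {j} f ts) σ l = codes ts σ (suc l) ⨾ code f (block j (suc l)) (suc l + j) ⨾
                        clears j (suc l) ⨾ transfer (suc l + j) l
codes []       σ l = skip
codes (t ∷ ts) σ l = code t σ l ⨾ codes ts σ (suc l)

-- Correctness of the compiled programs

module Correctness {k : ℕ} (w : List (Fin k)) where
  open Semantics w

  M : ℕ
  M = 3 + length w

  end≤M : end ≤ M
  end≤M = s≤s (m≤n+m (length w) 2)

  scan-end : ∀ (w : List (Fin k)) p → length w < p → scan w p ≡ ⊣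
  scan-end []      (suc p)       lt       = refl
  scan-end (a ∷ w) (suc (suc p)) (s≤s lt) = scan-end w (suc p) lt

  isEnd-scan : ∀ (w : List (Fin k)) p → p ≤ length w → isEnd (scan w p) ≡ false
  isEnd-scan w       zero          le       = refl
  isEnd-scan (a ∷ w) (suc zero)    le       = refl
  isEnd-scan (a ∷ w) (suc (suc p)) (s≤s le) = isEnd-scan w (suc p) le

  -- A counter may exceed the last position that the head can reach; both read as the right end
  -- marker.
  scan-clamp : ∀ (w : List (Fin k)) p → scan w (p ⊓ suc (length w)) ≡ scan w p
  scan-clamp w       zero          = refl
  scan-clamp []      (suc p)       = cong (λ q → scan [] (suc q)) (⊓-zeroʳ p)
  scan-clamp (a ∷ w) (suc zero)    = refl
  scan-clamp (a ∷ w) (suc (suc p)) = scan-clamp w (suc p)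

  succ≤M : ∀ p → p ≤ M → succ p ≤ M
  succ≤M p le with p ≤? length w
  ... | yes p≤ rewrite isEnd-scan w p p≤ = ≤-trans (s≤s p≤) end≤M
  ... | no p≰  rewrite scan-end w p (≰⇒> p≰) = le

  loop-bound : ∀ f → (∀ c s → c < M → s ≤ M → f c s ≤ M) → ∀ c s → c ≤ M → s ≤ M → loop f c s ≤ M
  loop-bound f h zero    s c≤ s≤ = s≤
  loop-bound f h (suc c) s c≤ s≤ = loop-bound f h c (f c s) (≤-trans (n≤1+n c) c≤) (h c s c≤ s≤)

  choose-bound : ∀ n {a b} → a ≤ M → b ≤ M → choose n a b ≤ M
  choose-bound zero    a≤ b≤ = a≤
  choose-bound (suc n) a≤ b≤ = b≤

  bit≤1 : ∀ b → bit b ≤ 1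
  bit≤1 false = z≤n
  bit≤1 true  = ≤-refl

  Bounded : ∀ {m} → Vec ℕ m → Set
  Bounded vs = ∀ i → lookup vs i ≤ M

  cons-bounded : ∀ {m v} {vs : Vec ℕ m} → v ≤ M → Bounded vs → Bounded (v ∷ vs)
  cons-bounded v≤ vs≤ 0F          = v≤
  cons-bounded v≤ vs≤ (Fin.suc i) = vs≤ i

  eval-bound  : ∀ {m} (t : Tm k m) {vs} → Bounded vs → eval t vs ≤ M
  evals-bound : ∀ {m j} (ts : Vec (Tm k m) j) {vs} → Bounded vs → Bounded (evals ts vs)
  eval-bound (var i)      b = b i
  eval-bound (lit 0F)     b = z≤n
  eval-bound (lit 1F)     b = s≤s z≤n
  eval-bound (lit 2F)     b = s≤s (s≤s z≤n)
  eval-bound (next t)     b = succ≤M _ (eval-bound t b)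
  eval-bound (prev t)     b = ≤-trans pred[n]≤n (eval-bound t b)
  eval-bound top          b = end≤M
  eval-bound (is P t)     b = ≤-trans (bit≤1 _) (s≤s z≤n)
  eval-bound (ifz t a c)  {vs} b = choose-bound (eval t vs) (eval-bound a b) (eval-bound c b)
  eval-bound (iter s c t) b = loop-bound _
    (λ n z n< z≤ → eval-bound t (cons-bounded (<⇒≤ n<) (cons-bounded z≤ b))) _ _ (eval-bound c b) (eval-bound s b)
  eval-bound (call f ts)  b = eval-bound f (evals-bound ts b)
  evals-bound (t ∷ ts) b 0F          = eval-bound t b
  evals-bound (t ∷ ts) b (Fin.suc i) = evals-bound ts b i

  infix 4 _⊢_⇝_
  _⊢_⇝_ : Prog k → Store → Store → Set
  p ⊢ s ⇝ s′ = Exec w M p s s′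

  Sets : ℕ → ℕ → (ℕ → ℕ) → (ℕ → ℕ) → Set
  Sets l v ρ ρ′ = ρ′ l ≡ v × (∀ j → j ≢ l → ρ′ j ≡ ρ j)

  sets-update : ∀ ρ l v → Sets l v ρ (update ρ l v)
  sets-update ρ l v = update-same ρ l v , λ j j≢ → update-other ρ l v j≢

  sets-trans : ∀ {l v v′ ρ ρ′ ρ″} → Sets l v ρ ρ′ → Sets l v′ ρ′ ρ″ → Sets l v′ ρ ρ″
  sets-trans (_ , f) (e , g) = e , λ j j≢ → trans (g j j≢) (f j j≢)

  clear-correct : ∀ r v i ρ → ρ r ≡ v → ∃[ ρ′ ] (clear r ⊢ (i , ρ) ⇝ (i , ρ′)) × Sets r 0 ρ ρ′
  clear-correct r zero    i ρ e = ρ , while-zero e , e , λ _ _ → refl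
  clear-correct r (suc v) i ρ e with clear-correct r v i (update ρ r v) (update-same ρ r v)
  ... | ρ′ , x , s = ρ′ , while-suc e exec-move x , sets-trans (sets-update ρ r v) s

  transfer-correct : ∀ a b v i ρ → a ≢ b → ρ a ≡ v → ρ b + v ≤ M →
    ∃[ ρ′ ] (transfer a b ⊢ (i , ρ) ⇝ (i , ρ′)) × ρ′ a ≡ 0 × ρ′ b ≡ ρ b + v × (∀ j → j ≢ a → j ≢ b → ρ′ j ≡ ρ j)
  transfer-correct a b zero    i ρ a≢b e le = ρ , while-zero e , e , ≡-sym (+-identityʳ _) , λ _ _ _ → refl
  transfer-correct a b (suc v) i ρ a≢b e le =
    let ρ₁ = update ρ a v
        ρ₁b : ρ₁ b ≡ ρ b
        ρ₁b = update-other ρ a v (a≢b ∘ ≡-sym)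
        ρ₂ = update ρ₁ b (suc (ρ₁ b))
        ρ₂b : ρ₂ b ≡ suc (ρ b)
        ρ₂b = trans (update-same ρ₁ b _) (cong suc ρ₁b)
        ρ′ , x , ea , eb , eo = transfer-correct a b v i ρ₂ a≢b
          (trans (update-other ρ₁ b _ a≢b) (update-same ρ a v))
          (subst (_≤ M) (trans (+-suc (ρ b) v) (cong (_+ v) (≡-sym ρ₂b))) le)
    in ρ′ , while-suc e (exec-inc (subst (_< M) (≡-sym ρ₁b) (≤-trans (subst (suc (ρ b) ≤_) (≡-sym (+-suc (ρ b) v))
        (m≤m+n _ v)) le))) x ,
       ea , trans eb (trans (cong (_+ v) ρ₂b) (≡-sym (+-suc (ρ b) v))) ,
       λ j j≢a j≢b → trans (eo j j≢a j≢b) (trans (update-other ρ₁ b _ j≢b) (update-other ρ a v j≢a))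

  spread-correct : ∀ r a b v i ρ → r ≢ a → r ≢ b → a ≢ b → ρ r ≡ v → ρ a + v ≤ M → ρ b + v ≤ M →
    ∃[ ρ′ ] (while r (inc a ⨾ inc b) ⊢ (i , ρ) ⇝ (i , ρ′)) × ρ′ r ≡ 0 × ρ′ a ≡ ρ a + v × ρ′ b ≡ ρ b + v ×
      (∀ j → j ≢ r → j ≢ a → j ≢ b → ρ′ j ≡ ρ j)
  spread-correct r a b zero i ρ r≢a r≢b a≢b e la lb =
    ρ , while-zero e , e , ≡-sym (+-identityʳ _) , ≡-sym (+-identityʳ _) , λ _ _ _ _ → refl
  spread-correct r a b (suc v) i ρ r≢a r≢b a≢b e la lb =
    let ρ₁ = update ρ r v
        ρ₁a : ρ₁ a ≡ ρ a
        ρ₁a = update-other ρ r v (r≢a ∘ ≡-sym)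
        ρ₂ = update ρ₁ a (suc (ρ₁ a))
        ρ₂b : ρ₂ b ≡ ρ b
        ρ₂b = trans (update-other ρ₁ a _ (a≢b ∘ ≡-sym)) (update-other ρ r v (r≢b ∘ ≡-sym))
        ρ₃ = update ρ₂ b (suc (ρ₂ b))
        ρ₃a : ρ₃ a ≡ suc (ρ a)
        ρ₃a = trans (update-other ρ₂ b _ a≢b) (trans (update-same ρ₁ a _) (cong suc ρ₁a))
        ρ₃b : ρ₃ b ≡ suc (ρ b)
        ρ₃b = trans (update-same ρ₂ b _) (cong suc ρ₂b)
        ρ′ , x , er , ea , eb , eo = spread-correct r a b v i ρ₃ r≢a r≢b a≢b
          (trans (update-other ρ₂ b _ r≢b) (trans (update-other ρ₁ a _ r≢a) (update-same ρ r v)))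
          (subst (_≤ M) (trans (+-suc (ρ a) v) (cong (_+ v) (≡-sym ρ₃a))) la)
          (subst (_≤ M) (trans (+-suc (ρ b) v) (cong (_+ v) (≡-sym ρ₃b))) lb)
    in ρ′ , while-suc e (exec-⨾ (exec-inc (room a (ρ₁ a) ρ₁a la)) (exec-inc (room b (ρ₂ b) ρ₂b lb))) x ,
       er , trans ea (trans (cong (_+ v) ρ₃a) (≡-sym (+-suc (ρ a) v))) ,
       trans eb (trans (cong (_+ v) ρ₃b) (≡-sym (+-suc (ρ b) v))) ,
       λ j j≢r j≢a j≢b → trans (eo j j≢r j≢a j≢b)
         (trans (update-other ρ₂ b _ j≢b) (trans (update-other ρ₁ a _ j≢a) (update-other ρ r v j≢r)))
    where
    room : ∀ c x → x ≡ ρ c → ρ c + suc v ≤ M → x < M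
    room c x e le = subst (_< M) (≡-sym e) (≤-trans (subst (suc (ρ c) ≤_) (≡-sym (+-suc (ρ c) v)) (m≤m+n _ v)) le)

  duplicate-correct : ∀ r a b i ρ → r ≢ a → r ≢ b → a ≢ b → ρ r ≤ M → ρ a ≡ 0 → ρ b ≡ 0 →
    ∃[ ρ′ ] (duplicate r a b ⊢ (i , ρ) ⇝ (i , ρ′)) × Sets a (ρ r) ρ ρ′
  duplicate-correct r a b i ρ r≢a r≢b a≢b le ea eb =
    let ρ₁ , x₁ , r₁ , a₁ , b₁ , o₁ = spread-correct r a b (ρ r) i ρ r≢a r≢b a≢b refl
          (subst (λ z → z + ρ r ≤ M) (≡-sym ea) le) (subst (λ z → z + ρ r ≤ M) (≡-sym eb) le)
        b₁′ : ρ₁ b ≡ ρ r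
        b₁′ = trans b₁ (cong (_+ ρ r) eb)
        ρ₂ , x₂ , b₂ , r₂ , o₂ = transfer-correct b r (ρ r) i ρ₁ (r≢b ∘ ≡-sym) b₁′
          (subst (λ z → z + ρ r ≤ M) (≡-sym r₁) le)
    in ρ₂ , exec-⨾ x₁ x₂ , trans (o₂ a a≢b (r≢a ∘ ≡-sym)) (trans a₁ (cong (_+ ρ r) ea)) ,
       λ j j≢a → others ρ₁ ρ₂ b₂ (trans r₂ (cong (_+ ρ r) r₁)) o₁ o₂ j j≢a
    where
    others : ∀ ρ₁ ρ₂ → ρ₂ b ≡ 0 → ρ₂ r ≡ ρ r → (∀ j → j ≢ r → j ≢ a → j ≢ b → ρ₁ j ≡ ρ j) →
             (∀ j → j ≢ b → j ≢ r → ρ₂ j ≡ ρ₁ j) → ∀ j → j ≢ a → ρ₂ j ≡ ρ j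
    others ρ₁ ρ₂ b₂ r₂ o₁ o₂ j j≢a with j ≟ b | j ≟ r
    ... | yes refl | _        = trans b₂ (≡-sym eb)
    ... | no _     | yes refl = r₂
    ... | no j≢b   | no j≢r   = trans (o₂ j j≢b j≢r) (o₁ j j≢r j≢a j≢b)

  right-clamp : ∀ p → moveInput w right (p ⊓ end) ≡ suc p ⊓ end
  right-clamp p = cong suc (trans (⊓-assoc p end (length w)) (cong (p ⊓_) (m≥n⇒m⊓n≡n (n≤1+n (length w)))))

  seek-correct : ∀ r v p ρ → ρ r ≡ v →
    ∃[ ρ′ ] (while r (move right) ⊢ (p ⊓ end , ρ) ⇝ ((v + p) ⊓ end , ρ′)) × Sets r 0 ρ ρ′
  seek-correct r zero    p ρ e = ρ , while-zero e , e , λ _ _ → refl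
  seek-correct r (suc v) p ρ e with seek-correct r v (suc p) (update ρ r v) (update-same ρ r v)
  ... | ρ′ , x , s = ρ′ ,
    subst (λ q → while r (move right) ⊢ (p ⊓ end , ρ) ⇝ (q ⊓ end , ρ′)) (+-suc v p)
      (while-suc e (subst (λ q → move right ⊢ (p ⊓ end , update ρ r v) ⇝ (q , update ρ r v)) (right-clamp p) exec-move) x) ,
    sets-trans (sets-update ρ r v) s

  isStart-scan : ∀ (w : List (Fin k)) p → isStart (scan w (suc p)) ≡ false
  isStart-scan []      p       = refl
  isStart-scan (a ∷ w) zero    = refl
  isStart-scan (a ∷ w) (suc p) = isStart-scan w p

  rewind-correct : ∀ p ρ → rewind ⊢ (p , ρ) ⇝ (0 , ρ)
  rewind-correct zero    ρ = until-stop refl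
  rewind-correct (suc p) ρ = until-go (isStart-scan w p) exec-move (rewind-correct p ρ)

  top-correct : ∀ l d p ρ → d + p ≡ end → ρ l + d ≤ M →
    ∃[ ρ′ ] (until isEnd (inc l ⨾ move right) ⊢ (p , ρ) ⇝ (end , ρ′)) × Sets l (ρ l + d) ρ ρ′
  top-correct l zero .end ρ refl le = ρ , until-stop (cong isEnd (scan-end w end ≤-refl)) , ≡-sym (+-identityʳ _) , λ _ _ → refl
  top-correct l (suc d) p ρ e le
    with top-correct l d (suc p) (update ρ l (suc (ρ l))) (trans (+-suc d p) e)
      (subst (_≤ M) (trans (+-suc (ρ l) d) (cong (_+ d) (≡-sym (update-same ρ l _)))) le)
  ... | ρ′ , x , s = ρ′ ,
    until-go (isEnd-scan w p p≤)
      (exec-⨾ (exec-inc (≤-trans (subst (suc (ρ l) ≤_) (≡-sym (+-suc (ρ l) d)) (m≤m+n _ d)) le))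
        (subst (λ q → move right ⊢ (p , ρ₁) ⇝ (q , ρ₁)) (m≤n⇒m⊓n≡m (s≤s p≤)) exec-move)) x ,
    subst (λ v → Sets l v ρ ρ′) (trans (cong (_+ d) (update-same ρ l _)) (≡-sym (+-suc (ρ l) d)))
      (sets-trans (sets-update ρ l _) s)
    where
    ρ₁ = update ρ l (suc (ρ l))
    p≤ : p ≤ length w
    p≤ = s≤s⁻¹ (subst (suc p ≤_) e (s≤s (m≤n+m p d)))

  -- Counters from `l` on are free scratch space. They have to be zero because `duplicate` and `inc`
  -- add to what is there.
  record World (l : ℕ) (ρ : ℕ → ℕ) : Set where
    field
      zeros   : ∀ j → l ≤ j → ρ j ≡ 0
      bounded : ∀ j → ρ j ≤ M
  open World

  Below : ∀ {m} → Vec ℕ m → ℕ → Set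
  Below σ l = ∀ i → lookup σ i < l

  below-≤ : ∀ {m} {σ : Vec ℕ m} {l l′} → l ≤ l′ → Below σ l → Below σ l′
  below-≤ le b i = ≤-trans (b i) le

  below-∷ : ∀ {m r} {σ : Vec ℕ m} {l} → r < l → Below σ l → Below (r ∷ σ) l
  below-∷ lt b 0F          = lt
  below-∷ lt b (Fin.suc i) = b i

  world-sets : ∀ {l v ρ ρ′} → World l ρ → Sets l v ρ ρ′ → v ≤ M → World (suc l) ρ′
  world-sets {l} {v} {ρ} {ρ′} W (e , f) v≤ = record
    { zeros = λ j l<j → trans (f j (>⇒≢ l<j)) (zeros W j (<⇒≤ l<j))
    ; bounded = λ j → go j
    }
    where
    go : ∀ j → ρ′ j ≤ M
    go j with j ≟ l
    ... | yes refl = subst (_≤ M) (≡-sym e) v≤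
    ... | no j≢l   = subst (_≤ M) (≡-sym (f j j≢l)) (bounded W j)

  world-reset : ∀ {l ρ ρ′} → World l ρ → (∀ j → ρ′ j ≡ ρ j) → World l ρ′
  world-reset W f = record
    { zeros = λ j le → trans (f j) (zeros W j le) ; bounded = λ j → subst (_≤ M) (≡-sym (f j)) (bounded W j) }

  map-agree : ∀ {m} (σ : Vec ℕ m) {ρ ρ′ : ℕ → ℕ} → (∀ i → ρ′ (lookup σ i) ≡ ρ (lookup σ i)) →
              Vec.map ρ′ σ ≡ Vec.map ρ σ
  map-agree []      f = refl
  map-agree (r ∷ σ) f = cong₂ _∷_ (f 0F) (map-agree σ (f ∘ Fin.suc))

  map-sets : ∀ {m l v ρ ρ′} (σ : Vec ℕ m) → Below σ l → Sets l v ρ ρ′ → Vec.map ρ′ σ ≡ Vec.map ρ σ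
  map-sets σ b (_ , f) = map-agree σ λ i → f (lookup σ i) (<⇒≢ (b i))

  map-bounded : ∀ {m l ρ} (σ : Vec ℕ m) → World l ρ → Bounded (Vec.map ρ σ)
  map-bounded (r ∷ σ) W 0F          = bounded W r
  map-bounded (r ∷ σ) W (Fin.suc i) = map-bounded σ W i

  clears-correct : ∀ j l ρ → ∃[ ρ′ ] (clears j l ⊢ (0 , ρ) ⇝ (0 , ρ′)) ×
    (∀ i → i < l → ρ′ i ≡ ρ i) × (∀ i → l ≤ i → i < l + j → ρ′ i ≡ 0) × (∀ i → l + j ≤ i → ρ′ i ≡ ρ i)
  clears-correct zero l ρ = ρ , exec-move , (λ _ _ → refl) ,
    (λ i le lt → ⊥-elim (<⇒≱ lt (subst (_≤ i) (≡-sym (+-identityʳ l)) le))) , λ _ _ → refl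
  clears-correct (suc j) l ρ =
    let ρ₁ , x₁ , e₁ , o₁ = clear-correct l _ 0 ρ refl
        ρ₂ , x₂ , b₂ , c₂ , a₂ = clears-correct j (suc l) ρ₁
    in ρ₂ , exec-⨾ x₁ x₂ ,
       (λ i lt → trans (b₂ i (m<n⇒m<1+n lt)) (o₁ i (<⇒≢ lt))) ,
       (λ i le lt → inside ρ₁ ρ₂ e₁ b₂ c₂ i le (subst (i <_) (+-suc l j) lt)) ,
       (λ i le → trans (a₂ i (subst (_≤ i) (+-suc l j) le))
         (o₁ i (>⇒≢ (≤-trans (s≤s (m≤m+n l j)) (subst (_≤ i) (+-suc l j) le)))))
    where
    inside : ∀ ρ₁ ρ₂ → ρ₁ l ≡ 0 → (∀ i → i < suc l → ρ₂ i ≡ ρ₁ i) →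
             (∀ i → suc l ≤ i → i < suc l + j → ρ₂ i ≡ 0) → ∀ i → l ≤ i → i < suc l + j → ρ₂ i ≡ 0
    inside ρ₁ ρ₂ e₁ b₂ c₂ i le lt with l ≟ i
    ... | yes refl = trans (b₂ l ≤-refl) e₁
    ... | no l≢i   = c₂ i (≤∧≢⇒< le l≢i) lt

  -- The head returns to position 0 and all counters but `l` are restored, so subterms can be
  -- evaluated one after another as on a stack.
  Computes : ∀ {m} → Tm k m → Set
  Computes t = ∀ σ l ρ → Below σ l → World l ρ →
    ∃[ ρ′ ] (code t σ l ⊢ (0 , ρ) ⇝ (0 , ρ′)) × Sets l (eval t (Vec.map ρ σ)) ρ ρ′

  inc-correct : ∀ {l v ρ ρ′ i} → Sets l v ρ ρ′ → suc v ≤ M →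
                ∃[ ρ″ ] (inc l ⊢ (i , ρ′) ⇝ (i , ρ″)) × Sets l (suc v) ρ ρ″
  inc-correct {l} {ρ′ = ρ′} s@(refl , _) le = _ , exec-inc le , sets-trans s (sets-update ρ′ l _)

  -- Every iteration is compared with the store `ρ₀` before the loop, which fixes the values of the
  -- outer variables throughout.
  loop-correct : ∀ {m} (b : Tm k (suc (suc m))) → Computes b → ∀ σ l ρ₀ → Below σ l → World l ρ₀ →
    ∀ v s ρ → v ≤ M → s ≤ M → ρ (suc l) ≡ v → ρ l ≡ s → (∀ j → j ≢ l → j ≢ suc l → ρ j ≡ ρ₀ j) →
    ∃[ ρ′ ] (while (suc l) (code b (suc l ∷ l ∷ σ) (2 + l) ⨾ clear l ⨾ transfer (2 + l) l) ⊢ (0 , ρ) ⇝ (0 , ρ′)) ×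
      Sets l (loop (λ n z → eval b (n ∷ z ∷ Vec.map ρ₀ σ)) v s) ρ₀ ρ′
  loop-correct b cb σ l ρ₀ below W zero s ρ v≤ s≤ ec es o = ρ , while-zero ec , es , others
    where
    others : ∀ j → j ≢ l → ρ j ≡ ρ₀ j
    others j j≢l with j ≟ suc l
    ... | yes refl = trans ec (≡-sym (zeros W (suc l) (n≤1+n l)))
    ... | no j≢    = o j j≢l j≢
  loop-correct b cb σ l ρ₀ below W (suc v) s ρ v≤ s≤ ec es o =
    let ρ₁ = update ρ (suc l) v
        e₁ = update-same ρ (suc l) v
        l₁ : ρ₁ l ≡ s
        l₁ = trans (update-other ρ (suc l) v (<⇒≢ ≤-refl)) es
        o₁ : ∀ j → j ≢ l → j ≢ suc l → ρ₁ j ≡ ρ₀ j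
        o₁ j a c = trans (update-other ρ (suc l) v c) (o j a c)
        W₁ : World (2 + l) ρ₁
        W₁ = record
          { zeros = λ j le → trans (o₁ j (>⇒≢ (<⇒≤ le)) (>⇒≢ le)) (zeros W j (≤-trans (n≤1+n l) (<⇒≤ le)))
          ; bounded = bound₁ ρ₁ e₁ l₁ o₁ }
        ρ₂ , x₂ , s₂ = cb (suc l ∷ l ∷ σ) (2 + l) ρ₁
          (below-∷ ≤-refl (below-∷ (n≤1+n (suc l)) (below-≤ {σ = σ} (≤-trans (n≤1+n l) (n≤1+n (suc l))) below))) W₁
        env : Vec.map ρ₁ (suc l ∷ l ∷ σ) ≡ v ∷ s ∷ Vec.map ρ₀ σ
        env = cong₂ _∷_ e₁ (cong₂ _∷_ l₁ (map-agree σ λ i → o₁ _ (<⇒≢ (below i)) (<⇒≢ (m<n⇒m<1+n (below i)))))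
        b₂ : ρ₂ (2 + l) ≡ eval b (v ∷ s ∷ Vec.map ρ₀ σ)
        b₂ = trans (proj₁ s₂) (cong (eval b) env)
        val≤ : eval b (v ∷ s ∷ Vec.map ρ₀ σ) ≤ M
        val≤ = eval-bound b (cons-bounded (≤-trans (n≤1+n v) v≤) (cons-bounded s≤ (map-bounded σ W)))
        ρ₃ , x₃ , e₃ , o₃ = clear-correct l _ 0 ρ₂ refl
        ρ₄ , x₄ , a₄ , b₄ , o₄ = transfer-correct (2 + l) l (eval b (v ∷ s ∷ Vec.map ρ₀ σ)) 0 ρ₃ (>⇒≢ (n≤1+n (suc l)))
          (trans (o₃ (2 + l) (>⇒≢ (n≤1+n (suc l)))) b₂) (subst (λ z → z + _ ≤ M) (≡-sym e₃) val≤)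
        l≢ : suc l ≢ l
        l≢ = >⇒≢ ≤-refl
        2l≢ : suc l ≢ 2 + l
        2l≢ = <⇒≢ ≤-refl
        ρ₅ , x₅ , s₅ = loop-correct b cb σ l ρ₀ below W v (eval b (v ∷ s ∷ Vec.map ρ₀ σ)) ρ₄ (≤-trans (n≤1+n v) v≤) val≤
          (trans (o₄ (suc l) 2l≢ l≢) (trans (o₃ (suc l) l≢) (trans (proj₂ s₂ (suc l) 2l≢) e₁)))
          (trans b₄ (cong (_+ _) e₃))
          (others ρ₁ ρ₂ ρ₃ ρ₄ o₁ (proj₂ s₂) o₃ o₄ a₄)
    in ρ₅ , while-suc ec (exec-⨾ x₂ (exec-⨾ x₃ x₄)) x₅ , s₅
    where
    bound₁ : ∀ ρ₁ → ρ₁ (suc l) ≡ v → ρ₁ l ≡ s → (∀ j → j ≢ l → j ≢ suc l → ρ₁ j ≡ ρ₀ j) → ∀ j → ρ₁ j ≤ M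
    bound₁ ρ₁ e₁ l₁ o₁ j with j ≟ l | j ≟ suc l
    ... | yes refl | _        = subst (_≤ M) (≡-sym l₁) s≤
    ... | no _     | yes refl = subst (_≤ M) (≡-sym e₁) (≤-trans (n≤1+n v) v≤)
    ... | no a     | no c     = subst (_≤ M) (≡-sym (o₁ j a c)) (bounded W j)
    others : ∀ (ρ₁ ρ₂ ρ₃ ρ₄ : ℕ → ℕ) → (∀ j → j ≢ l → j ≢ suc l → ρ₁ j ≡ ρ₀ j) → (∀ j → j ≢ 2 + l → ρ₂ j ≡ ρ₁ j) →
      (∀ j → j ≢ l → ρ₃ j ≡ ρ₂ j) → (∀ j → j ≢ 2 + l → j ≢ l → ρ₄ j ≡ ρ₃ j) → ρ₄ (2 + l) ≡ 0 →
      ∀ j → j ≢ l → j ≢ suc l → ρ₄ j ≡ ρ₀ j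
    others ρ₁ ρ₂ ρ₃ ρ₄ o₁ o₂ o₃ o₄ a₄ j a c with j ≟ 2 + l
    ... | yes refl = trans a₄ (≡-sym (zeros W (2 + l) (≤-trans (n≤1+n l) (n≤1+n (suc l)))))
    ... | no d     = trans (o₄ j d a) (trans (o₃ j a) (trans (o₂ j d) (o₁ j a c)))

  code-correct  : ∀ {m} (t : Tm k m) → Computes t
  codes-correct : ∀ {m j} (ts : Vec (Tm k m) j) σ l ρ → Below σ l → World l ρ →
    ∃[ ρ′ ] (codes ts σ l ⊢ (0 , ρ) ⇝ (0 , ρ′)) × Vec.map ρ′ (block j l) ≡ evals ts (Vec.map ρ σ) ×
      (∀ i → i < l → ρ′ i ≡ ρ i) × World (l + j) ρ′

  code-correct (var i) σ l ρ below W
    with duplicate-correct (lookup σ i) l (suc l) 0 ρ (<⇒≢ (below i)) (<⇒≢ (m<n⇒m<1+n (below i))) (<⇒≢ ≤-refl)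
           (bounded W _) (zeros W l ≤-refl) (zeros W (suc l) (n≤1+n l))
  ... | ρ′ , x , s = ρ′ , x , subst (λ v → Sets l v ρ ρ′) (≡-sym (lookup-map i ρ σ)) s
  code-correct (lit 0F) σ l ρ below W = ρ , exec-move , zeros W l ≤-refl , λ _ _ → refl
  code-correct (lit 1F) σ l ρ below W
    with inc-correct {l} {0} {ρ} {ρ} {0} (zeros W l ≤-refl , λ _ _ → refl) (s≤s z≤n)
  ... | ρ₁ , x₁ , s₁ = ρ₁ , x₁ , s₁
  code-correct (lit 2F) σ l ρ below W =
    let ρ₁ , x₁ , s₁ = inc-correct {l} {0} {ρ} {ρ} {0} (zeros W l ≤-refl , λ _ _ → refl) (s≤s z≤n)
        ρ₂ , x₂ , s₂ = inc-correct s₁ (s≤s (s≤s z≤n))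
    in ρ₂ , exec-⨾ x₁ x₂ , s₂
  code-correct (next t) σ l ρ below W =
    let ρ₁ , x₁ , s₁ = code-correct t σ l ρ below W
        v = eval t (Vec.map ρ σ)
        v≤ = eval-bound t (map-bounded σ W)
        W₁ = world-sets W s₁ v≤
        ρ₂ , x₂ , e₂ , o₂ = duplicate-correct l (suc l) (2 + l) 0 ρ₁ (<⇒≢ ≤-refl) (<⇒≢ (n≤1+n (suc l))) (<⇒≢ ≤-refl)
          (bounded W₁ l) (zeros W₁ (suc l) ≤-refl) (zeros W₁ (2 + l) (n≤1+n (suc l)))
        ρ₃ , x₃ , e₃ , o₃ = seek-correct (suc l) v 0 ρ₂ (trans e₂ (proj₁ s₁))
        s₃ : Sets l v ρ ρ₃
        s₃ = trans (o₃ l (<⇒≢ ≤-refl)) (trans (o₂ l (<⇒≢ ≤-refl)) (proj₁ s₁)) , others ρ₁ ρ₂ ρ₃ (proj₂ s₁) o₂ e₃ o₃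
        at-v : scan w ((v + 0) ⊓ end) ≡ scan w v
        at-v = trans (scan-clamp w (v + 0)) (cong (scan w) (+-identityʳ v))
        ρ₄ , x₄ , s₄ = branch v v≤ ρ₃ s₃ (isEnd (scan w v)) refl at-v
    in ρ₄ , exec-⨾ x₁ (exec-⨾ x₂ (exec-⨾ x₃ (exec-⨾ x₄ (rewind-correct _ ρ₄)))) , s₄
    where
    others : ∀ (ρ₁ ρ₂ ρ₃ : ℕ → ℕ) → (∀ j → j ≢ l → ρ₁ j ≡ ρ j) → (∀ j → j ≢ suc l → ρ₂ j ≡ ρ₁ j) →
             ρ₃ (suc l) ≡ 0 → (∀ j → j ≢ suc l → ρ₃ j ≡ ρ₂ j) → ∀ j → j ≢ l → ρ₃ j ≡ ρ j
    others ρ₁ ρ₂ ρ₃ o₁ o₂ e₃ o₃ j a with j ≟ suc l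
    ... | yes refl = trans e₃ (≡-sym (zeros W (suc l) (n≤1+n l)))
    ... | no c     = trans (o₃ j c) (trans (o₂ j c) (o₁ j a))
    branch : ∀ v → v ≤ M → ∀ ρ₃ → Sets l v ρ ρ₃ → ∀ b → isEnd (scan w v) ≡ b → ∀ {i} → scan w i ≡ scan w v →
      ∃[ ρ₄ ] (cond isEnd skip (inc l) ⊢ (i , ρ₃) ⇝ (i , ρ₄)) × Sets l (if b then v else suc v) ρ ρ₄
    branch v v≤ ρ₃ s₃ true  e at-v = ρ₃ , cond-true (trans (cong isEnd at-v) e) exec-move , s₃
    branch v v≤ ρ₃ s₃ false e at-v
      with inc-correct s₃ (subst (_≤ M) (cong (λ b → if b then v else suc v) e) (succ≤M v v≤))
    ... | ρ₄ , x₄ , s₄ = ρ₄ , cond-false (trans (cong isEnd at-v) e) x₄ , s₄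
  code-correct (prev t) σ l ρ below W with code-correct t σ l ρ below W
  ... | ρ₁ , x₁ , s₁ with eval t (Vec.map ρ σ)
  ... | zero  = ρ₁ , exec-⨾ x₁ (ifz-zero (proj₁ s₁) exec-move) , s₁
  ... | suc v = update ρ₁ l v , exec-⨾ x₁ (ifz-suc (proj₁ s₁) exec-move) , sets-trans s₁ (sets-update ρ₁ l v)
  code-correct top σ l ρ below W
    with top-correct l end 0 ρ (+-identityʳ end) (subst (λ z → z + end ≤ M) (≡-sym (zeros W l ≤-refl)) end≤M)
  ... | ρ₁ , x₁ , s₁ = ρ₁ , exec-⨾ x₁ (rewind-correct end ρ₁) ,
    subst (λ z → Sets l (z + end) ρ ρ₁) (zeros W l ≤-refl) s₁
  code-correct (is P t) σ l ρ below W =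
    let ρ₁ , x₁ , s₁ = code-correct t σ l ρ below W
        v = eval t (Vec.map ρ σ)
        ρ₂ , x₂ , s₂ = seek-correct l v 0 ρ₁ (proj₁ s₁)
        ρ₃ , x₃ , s₃ = branch ρ₂ (sets-trans s₁ s₂) (P (scan w v)) {(v + 0) ⊓ end}
          (cong P (trans (scan-clamp w (v + 0)) (cong (scan w) (+-identityʳ v))))
    in ρ₃ , exec-⨾ x₁ (exec-⨾ x₂ (exec-⨾ x₃ (rewind-correct _ ρ₃))) , s₃
    where
    branch : ∀ ρ₂ → Sets l 0 ρ ρ₂ → ∀ b {i} → P (scan w i) ≡ b →
      ∃[ ρ₃ ] (cond P (inc l) skip ⊢ (i , ρ₂) ⇝ (i , ρ₃)) × Sets l (bit b) ρ ρ₃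
    branch ρ₂ s₂ true  e with inc-correct s₂ (s≤s z≤n)
    ... | ρ₃ , x₃ , s₃ = ρ₃ , cond-true e x₃ , s₃
    branch ρ₂ s₂ false e = ρ₂ , cond-false e exec-move , s₂
  code-correct (ifz t a b) σ l ρ below W with code-correct t σ l ρ below W
  ... | ρ₁ , x₁ , s₁ with eval t (Vec.map ρ σ)
  ... | zero =
    let same : ∀ j → ρ₁ j ≡ ρ j
        same = reset s₁
        ρ₂ , x₂ , s₂ = code-correct a σ l ρ₁ below (world-reset W same)
    in ρ₂ , exec-⨾ x₁ (ifz-zero (proj₁ s₁) x₂) ,
       sets-trans s₁ (subst (λ vs → Sets l (eval a vs) ρ₁ ρ₂) (map-sets σ below s₁) s₂)
    where
    reset : ∀ {ρ₁} → Sets l 0 ρ ρ₁ → ∀ j → ρ₁ j ≡ ρ j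
    reset (e , f) j with j ≟ l
    ... | yes refl = trans e (≡-sym (zeros W l ≤-refl))
    ... | no j≢    = f j j≢
  ... | suc v =
    let s₁′ = sets-trans s₁ (sets-update ρ₁ l v)
        ρ₂ , x₂ , s₂ = clear-correct l v 0 (update ρ₁ l v) (update-same ρ₁ l v)
        s₂′ = sets-trans s₁′ s₂
        ρ₃ , x₃ , s₃ = code-correct b σ l ρ₂ below (world-reset W (reset s₂′))
    in ρ₃ , exec-⨾ x₁ (ifz-suc (proj₁ s₁) (exec-⨾ x₂ x₃)) ,
       sets-trans s₂′ (subst (λ vs → Sets l (eval b vs) ρ₂ ρ₃) (map-sets σ below s₂′) s₃)
    where
    reset : ∀ {ρ₁} → Sets l 0 ρ ρ₁ → ∀ j → ρ₁ j ≡ ρ j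
    reset (e , f) j with j ≟ l
    ... | yes refl = trans e (≡-sym (zeros W l ≤-refl))
    ... | no j≢    = f j j≢
  code-correct (iter s c b) σ l ρ below W =
    let ρ₁ , x₁ , s₁ = code-correct s σ l ρ below W
        s≤ = eval-bound s (map-bounded σ W)
        ρ₂ , x₂ , s₂ = code-correct c σ (suc l) ρ₁ (below-≤ {σ = σ} (n≤1+n l) below) (world-sets W s₁ s≤)
        ρ₃ , x₃ , s₃ = loop-correct b (code-correct b) σ l ρ below W (eval c (Vec.map ρ σ)) (eval s (Vec.map ρ σ)) ρ₂
          (eval-bound c (map-bounded σ W)) s≤
          (trans (proj₁ s₂) (cong (eval c) (map-sets σ below s₁)))
          (trans (proj₂ s₂ l (<⇒≢ ≤-refl)) (proj₁ s₁))
          (λ j a d → trans (proj₂ s₂ j d) (proj₂ s₁ j a))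
    in ρ₃ , exec-⨾ x₁ (exec-⨾ x₂ x₃) , s₃
  code-correct (call {_} {j} f ts) σ l ρ below W =
    let ρ₁ , x₁ , env , o₁ , W₁ = codes-correct ts σ (suc l) ρ (below-≤ {σ = σ} (n≤1+n l) below) (world-suc W)
        ρ₂ , x₂ , e₂ , o₂ = code-correct f (block j (suc l)) (suc l + j) ρ₁ (block-below j (suc l)) W₁
        ρ₃ , x₃ , b₃ , c₃ , a₃ = clears-correct j (suc l) ρ₂
        v = eval f (evals ts (Vec.map ρ σ))
        v≤ = eval-bound f (evals-bound ts (map-bounded σ W))
        l< : l < suc l + j
        l< = s≤s (m≤m+n l j)
        l₃ : ρ₃ l ≡ 0
        l₃ = trans (b₃ l ≤-refl) (trans (o₂ l (<⇒≢ l<)) (trans (o₁ l ≤-refl) (zeros W l ≤-refl)))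
        ρ₄ , x₄ , a₄ , b₄ , o₄ = transfer-correct (suc l + j) l v 0 ρ₃ (>⇒≢ l<)
          (trans (a₃ _ ≤-refl) (trans e₂ (cong (eval f) env))) (subst (λ z → z + v ≤ M) (≡-sym l₃) v≤)
    in ρ₄ , exec-⨾ x₁ (exec-⨾ x₂ (exec-⨾ x₃ x₄)) , trans b₄ (cong (_+ v) l₃) ,
       others ρ₁ ρ₂ ρ₃ ρ₄ o₁ (zeros W₁) o₂ b₃ c₃ a₃ a₄ o₄
    where
    world-suc : ∀ {l ρ} → World l ρ → World (suc l) ρ
    world-suc W = record { zeros = λ j le → zeros W j (<⇒≤ le) ; bounded = bounded W }
    block-below : ∀ j l → Below (block j l) (l + j)
    block-below (suc j) l 0F          = subst (l <_) (≡-sym (+-suc l j)) (s≤s (m≤m+n l j))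
    block-below (suc j) l (Fin.suc i) = subst (lookup (block j (suc l)) i <_) (≡-sym (+-suc l j)) (block-below j (suc l) i)
    others : ∀ (ρ₁ ρ₂ ρ₃ ρ₄ : ℕ → ℕ) → (∀ i → i < suc l → ρ₁ i ≡ ρ i) → (∀ i → suc l + j ≤ i → ρ₁ i ≡ 0) →
      (∀ i → i ≢ suc l + j → ρ₂ i ≡ ρ₁ i) →
      (∀ i → i < suc l → ρ₃ i ≡ ρ₂ i) → (∀ i → suc l ≤ i → i < suc l + j → ρ₃ i ≡ 0) →
      (∀ i → suc l + j ≤ i → ρ₃ i ≡ ρ₂ i) → ρ₄ (suc l + j) ≡ 0 →
      (∀ i → i ≢ suc l + j → i ≢ l → ρ₄ i ≡ ρ₃ i) → ∀ i → i ≢ l → ρ₄ i ≡ ρ i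
    others ρ₁ ρ₂ ρ₃ ρ₄ o₁ z₁ o₂ b₃ c₃ a₃ a₄ o₄ i i≢l with i ≟ suc l + j
    ... | yes refl = trans a₄ (≡-sym (zeros W _ (≤-trans (n≤1+n l) (m≤m+n (suc l) j))))
    ... | no i≢ with i <? suc l
    ... | yes i< = trans (o₄ i i≢ i≢l) (trans (b₃ i i<) (trans (o₂ i i≢) (o₁ i i<)))
    ... | no i≮ with i <? suc l + j
    ... | yes i<′ = trans (o₄ i i≢ i≢l) (trans (c₃ i (≮⇒≥ i≮) i<′) (≡-sym (zeros W i (<⇒≤ (≮⇒≥ i≮)))))
    ... | no i≮′  = trans (o₄ i i≢ i≢l) (trans (a₃ i (≮⇒≥ i≮′)) (trans (o₂ i i≢)
      (trans (z₁ i (≮⇒≥ i≮′)) (≡-sym (zeros W i (<⇒≤ (≮⇒≥ i≮)))))))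
  codes-correct [] σ l ρ below W = ρ , exec-move , refl , (λ _ _ → refl) , subst (λ n → World n ρ) (≡-sym (+-identityʳ l)) W
  codes-correct {_} {suc j} (t ∷ ts) σ l ρ below W =
    let ρ₁ , x₁ , s₁ = code-correct t σ l ρ below W
        ρ₂ , x₂ , env , o₂ , W₂ = codes-correct ts σ (suc l) ρ₁ (below-≤ {σ = σ} (n≤1+n l) below)
          (world-sets W s₁ (eval-bound t (map-bounded σ W)))
    in ρ₂ , exec-⨾ x₁ x₂ ,
       cong₂ _∷_ (trans (o₂ l ≤-refl) (proj₁ s₁)) (trans env (cong (evals ts) (map-sets σ below s₁))) ,
       (λ i lt → trans (o₂ i (m<n⇒m<1+n lt)) (proj₂ s₁ i (<⇒≢ lt))) ,
       subst (λ n → World n ρ₂) (≡-sym (+-suc l j)) W₂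

logspace-term : ∀ {k} {P : Language k} (t : Tm k 0) → (∀ w → P w ⇔ (Semantics.eval w t [] ≢ 0)) → InLogspace P
logspace-term t = logspace (code t [] 0) (λ w → Semantics.eval w t []) λ w →
  let open Correctness w
      ρ , x , e , _ = code-correct t [] 0 (λ _ → 0) (λ ()) (record { zeros = λ _ _ → refl ; bounded = λ _ → z≤n })
  in 0 , ρ , x , e

-- Orientations of bipartite graphs

-- r follows p in the cyclic order on C.

Next : (ℕ → Set) → ℕ → ℕ → Set
Next C p r = C r × ((p < r × (∀ c → C c → p < c → r ≤ c)) ⊎ ((∀ c → C c → c ≤ p) × (∀ c → C c → r ≤ c)))

-- If `p < q`, the successor of `p` lies above `p` and is at most `q`, while that of `q` lies above
-- `q` or is the minimum, hence at most `p`.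
next-≮ : ∀ {C p q r} → C p → C q → Next C p r → Next C q r → ¬ (p < q)
next-≮ Cp Cq (_ , inj₂ (last , _))    _                        p<q = <⇒≱ p<q (last _ Cq)
next-≮ Cp Cq (_ , inj₁ (p<r , least)) (_ , inj₁ (q<r , _))     p<q = <⇒≱ q<r (least _ Cq p<q)
next-≮ Cp Cq (_ , inj₁ (p<r , least)) (_ , inj₂ (_ , minimal)) p<q = <⇒≱ p<r (minimal _ Cp)

next-injective : ∀ {C p q r} → C p → C q → Next C p r → Next C q r → p ≡ q
next-injective Cp Cq np nq = ≤-antisym (≮⇒≥ (next-≮ Cq Cp nq np)) (≮⇒≥ (next-≮ Cp Cq np nq))

-- Induction around a cycle, cut open at `q`: it starts just after `q` and reaches `q` itself last.
module Cycle {C : ℕ → Set} {N : ℕ} (C<N : ∀ {c} → C c → c < N) {f : ℕ → ℕ} (f-next : ∀ {c} → C c → Next C c (f c))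
             {P : ℕ → Set} {q : ℕ} (Cq : C q) (start : P (f q)) (step : ∀ {c} → C c → c ≢ q → P c → P (f c)) where

  -- The disjunction keeps `q` out of the stretch from `c` to just below `z`, where `step` is
  -- applied.
  ascend : ∀ n {c z} → z ∸ c ≤ n → C c → C z → c ≤ z → z ≤ q ⊎ q < c → P c → P z
  ascend n {c} {z} le Cc Cz c≤z side Pc with m≤n⇒m<n∨m≡n c≤z
  ... | inj₂ refl = Pc
  ascend zero    le Cc Cz c≤z side Pc | inj₁ c<z = ⊥-elim (<⇒≱ c<z (m∸n≡0⇒m≤n (n≤0⇒n≡0 le)))
  ascend (suc n) {c} {z} le Cc Cz c≤z side Pc | inj₁ c<z with f-next Cc
  ... | Cf , inj₂ (last , _)      = ⊥-elim (<⇒≱ c<z (last _ Cz))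
  ... | Cf , inj₁ (c<f , least) =
    ascend n (s≤s⁻¹ (≤-trans (∸-monoʳ-< c<f (least _ Cz c<z)) le)) Cf Cz (least _ Cz c<z) (side′ side) (step Cc (c≢q side) Pc)
    where
    c≢q : z ≤ q ⊎ q < c → c ≢ q
    c≢q (inj₁ z≤q) = <⇒≢ (≤-trans c<z z≤q)
    c≢q (inj₂ q<c) = >⇒≢ q<c
    side′ : z ≤ q ⊎ q < c → z ≤ q ⊎ q < f c
    side′ (inj₁ z≤q) = inj₁ z≤q
    side′ (inj₂ q<c) = inj₂ (<-trans q<c c<f)

  wrap : ∀ n {c} → N ∸ c ≤ n → C c → q < c → P c → ∃[ m ] C m × (∀ c → C c → m ≤ c) × P m
  wrap zero    le Cc q<c Pc = ⊥-elim (<⇒≱ (C<N Cc) (m∸n≡0⇒m≤n (n≤0⇒n≡0 le)))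
  wrap (suc n) {c} le Cc q<c Pc with f-next Cc | step Cc (>⇒≢ q<c) Pc
  ... | Cf , inj₂ (_ , min)    | Pf = f c , Cf , min , Pf
  ... | Cf , inj₁ (c<f , _)    | Pf = wrap n (s≤s⁻¹ (≤-trans (∸-monoʳ-< c<f (<⇒≤ (C<N Cf))) le)) Cf (<-trans q<c c<f) Pf

  all : ∀ {z} → C z → P z
  all {z} Cz with f-next Cq | z ≤? q
  ... | Cf , inj₂ (_ , min)      | yes z≤q = ascend (z ∸ f q) ≤-refl Cf Cz (min _ Cz) (inj₁ z≤q) start
  ... | Cf , inj₂ (last , _)     | no z≰q  = ⊥-elim (z≰q (last _ Cz))
  ... | Cf , inj₁ (q<f , least)  | no z≰q  = ascend (z ∸ f q) ≤-refl Cf Cz (least _ Cz (≰⇒> z≰q)) (inj₂ q<f) start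
  ... | Cf , inj₁ (q<f , least)  | yes z≤q with wrap (N ∸ f q) ≤-refl Cf q<f start
  ... | m , Cm , min , Pm = ascend (z ∸ m) ≤-refl Cm Cz (min _ Cz) (inj₁ z≤q) Pm

-- A bipartite graph with edges E; the end of edge p on side s is key s p.

Consistent : (ℕ → Set) → (Bool → ℕ → ℕ) → (ℕ → Bool) → Set
Consistent E key o = ∀ {p q} → E p → E q → o p ≡ o q → key (o p) p ≡ key (o p) q → p ≡ q

-- A partial orientation that settles every conflict it touches, so that
-- autarkies can be combined by priority.

Autarky : (ℕ → Set) → (Bool → ℕ → ℕ) → (ℕ → Maybe Bool) → Set
Autarky E key o = ∀ {p q s} → E p → E q → p ≢ q → o p ≡ just s → key s p ≡ key s q → o q ≡ just (not s)

-- Combining autarkies by priority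

first : List (ℕ → Maybe Bool) → ℕ → Maybe Bool
first []       z = nothing
first (o ∷ os) z with o z
... | just s  = just s
... | nothing = first os z

module _ {E : ℕ → Set} {key : Bool → ℕ → ℕ} where
  open import Data.List.Relation.Unary.All as All using (All; []; _∷_)

  -- If the leading autarky gives one of two distinct edges to their common end, it gives the other
  -- one to the opposite end, so they cannot both be owned on side `s`. If it settles neither, the
  -- rest of the list decides both.
  first-consistent : ∀ {os} → All (Autarky E key) os → ∀ {p q s} → E p → E q →
    first os p ≡ just s → first os q ≡ just s → key s p ≡ key s q → p ≡ q
  first-consistent {o ∷ os} (A ∷ As) {p} {q} {s} Ep Eq ep eq k with p ≟ q
  ... | yes p≡q = p≡q
  ... | no p≢q with o p in op | o q in oq
  first-consistent {o ∷ os} (A ∷ As) {s = s} Ep Eq refl refl k | no p≢q | just _ | just _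
    with () ← not-¬ refl (≡-sym (just-injective (trans (≡-sym (A Ep Eq p≢q op k)) oq)))
  first-consistent {o ∷ os} (A ∷ As) Ep Eq refl eq k | no p≢q | just _ | nothing
    with () ← trans (≡-sym (A Ep Eq p≢q op k)) oq
  first-consistent {o ∷ os} (A ∷ As) Ep Eq ep refl k | no p≢q | nothing | just _
    with () ← trans (≡-sym (A Eq Ep (p≢q ∘ ≡-sym) oq (≡-sym k))) op
  first-consistent {o ∷ os} (A ∷ As) Ep Eq ep eq k | no p≢q | nothing | nothing =
    first-consistent As Ep Eq ep eq k

  first-∷ : ∀ o os z → first os z ≢ nothing → first (o ∷ os) z ≢ nothing
  first-∷ o os z ne with o z
  ... | just _  = λ ()
  ... | nothing = ne

  first-head : ∀ o os z → o z ≢ nothing → first (o ∷ os) z ≢ nothing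
  first-head o os z ne with o z
  ... | just _  = λ ()
  ... | nothing = ⊥-elim (ne refl)

  collect : (E? : ∀ p → Dec (E p)) → (own : ℕ → ℕ → Maybe Bool) → (∀ {e} → E e → Autarky E key (own e)) →
    (∀ {e} → E e → own e e ≢ nothing) →
    ∀ n → Σ[ os ∈ List (ℕ → Maybe Bool) ] All (Autarky E key) os × (∀ {e} → E e → e < n → first os e ≢ nothing)
  collect E? own aut covers zero = [] , [] , λ _ ()
  collect E? own aut covers (suc n) with collect E? own aut covers n | E? n
  ... | os , As , c | no ¬E = os , As , λ Ee lt → c Ee (≤∧≢⇒< (s≤s⁻¹ lt) λ { refl → ¬E Ee })
  ... | os , As , c | yes En = own n ∷ os , aut En ∷ As , cover
    where
    cover : ∀ {e} → E e → e < suc n → first (own n ∷ os) e ≢ nothing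
    cover {e} Ee lt with e ≟ n
    ... | yes refl = first-head (own n) os n (covers Ee)
    ... | no e≢n   = first-∷ (own n) os e (c Ee (≤∧≢⇒< (s≤s⁻¹ lt) e≢n))

  autarkies⇒consistent : ∀ {N} → (∀ {p} → E p → p < N) → (E? : ∀ p → Dec (E p)) → (own : ℕ → ℕ → Maybe Bool) →
    (∀ {e} → E e → Autarky E key (own e)) → (∀ {e} → E e → own e e ≢ nothing) → ∃[ o ] Consistent E key o
  autarkies⇒consistent {N} E<N E? own aut covers with collect E? own aut covers N
  ... | os , As , c = o , λ Ep Eq same k → first-consistent As Ep Eq (o-just Ep) (trans (o-just Eq) (cong just (≡-sym same))) k
    where
    o : ℕ → Bool
    -- Every edge is settled by its own autarky, so the default only reaches positions that are no
    -- edges.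
    o z = maybe′ id true (first os z)
    o-just : ∀ {z} → E z → first os z ≡ just (o z)
    o-just {z} Ez with first os z in eq
    ... | just s  = refl
    ... | nothing = ⊥-elim (c Ez (E<N Ez) eq)

iterate-suc : ∀ (f : ℕ → ℕ) a n → iterate f a (suc n) ≡ f (iterate f a n)
iterate-suc f a n = trans (≡-sym (iterate-is-fold a f (suc n))) (cong f (iterate-is-fold a f n))

if-true : ∀ {A : Set} {b} {x y : A} → b ≡ true → (if b then x else y) ≡ x
if-true refl = refl

if-false : ∀ {A : Set} {b} {x y : A} → b ≡ false → (if b then x else y) ≡ y
if-false refl = refl

-- The walk and the owners that it reports

module Walk (N : ℕ) (nx : Bool → ℕ → ℕ → ℕ) where

  -- The walk from edge e towards its end on side s: a state is an edge p just
  -- traversed towards side s.  The walk leaves along the next edge on side s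
  -- and then along the next edge on the other side, where e is skipped; having
  -- traversed e backwards it turns round.

  turn : Bool → ℕ → ℕ → ℕ
  turn s e b = if b ≡ᵇ e then e else nx (not s) e b

  -- Edges lie below `N`, so `nx s N` skips nothing. One call traverses two edges, away from side
  -- `s` and back to it.
  advance : Bool → ℕ → ℕ → ℕ
  advance s e a = turn s e (nx s N a)

  -- It freezes at the first double step that meets `z`, so a fixed number of iterations preserves
  -- the first meeting for `report`.
  seek : Bool → ℕ → ℕ → ℕ → ℕ
  seek s e z a = if a ≡ᵇ z then a else if nx s N a ≡ᵇ z then a else advance s e a

  -- The end at which the walk first arrives along z.

  report : Bool → ℕ → ℕ → Maybe Bool
  report s z a = if a ≡ᵇ z then just s else if nx s N a ≡ᵇ z then just (not s) else nothing

  own : Bool → ℕ → ℕ → Maybe Bool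
  own s e z = report s z (iterate (seek s e z) e N)

  ≡ᵇ-refl : ∀ n → (n ≡ᵇ n) ≡ true
  ≡ᵇ-refl zero    = refl
  ≡ᵇ-refl (suc n) = ≡ᵇ-refl n

  ≡ᵇ-true : ∀ {m n} → (m ≡ᵇ n) ≡ true → m ≡ n
  ≡ᵇ-true {m} {n} e = ≡ᵇ⇒≡ m n (subst T (≡-sym e) _)

  ≡ᵇ-false : ∀ {m n} → m ≢ n → (m ≡ᵇ n) ≡ false
  ≡ᵇ-false {m} {n} ne with m ≡ᵇ n in e
  ... | true  = ⊥-elim (ne (≡ᵇ-true e))
  ... | false = refl

  just≢nothing : ∀ {b : Bool} → just b ≢ nothing
  just≢nothing ()

  own-self : ∀ s e → own s e e ≢ nothing
  own-self s e eq = just≢nothing (trans (≡-sym reported) (trans (cong (report s e) (≡-sym (stays N))) eq))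
    where
    stays : ∀ n → iterate (seek s e e) e n ≡ e
    stays zero    = refl
    stays (suc n) = trans (cong (λ a → iterate (seek s e e) a n) (if-true (≡ᵇ-refl e))) (stays n)
    reported : report s e e ≡ just s
    reported = if-true (≡ᵇ-refl e)

  -- Walks in a consistently oriented graph

  module Completeness {E : ℕ → Set} {key : Bool → ℕ → ℕ} (E<N : ∀ {p} → E p → p < N)
    (nx-next : ∀ s x {p} → E p → p ≢ x → Next (λ c → E c × key s c ≡ key s p × c ≢ x) p (nx s x p))
    (o : ℕ → Bool) (consistent : Consistent E key o) {e : ℕ} (Ee : E e) where

    s₀ : Bool
    s₀ = o e

    skipped : Bool → ℕ
    skipped s with s ≟ᵇ s₀
    ... | yes _ = N
    ... | no _  = e

    -- A dart (p , s) traverses the edge p towards side s.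

    Dart : Set
    Dart = ℕ × Bool

    -- Half of `advance`. At this granularity both sides follow one rule, with `skipped` as the only
    -- asymmetry, and injectivity can be shown step by step.
    φ : Dart → Dart
    φ (p , s) with p ≟ skipped s
    ... | yes _ = p , not s
    ... | no _  = nx s (skipped s) p , not s

    d : ℕ → Dart
    d zero    = e , s₀
    d (suc t) = φ (d t)

    At : Bool → ℕ → ℕ → Set
    At s z c = E c × key s c ≡ z × c ≢ skipped s

    K : Bool → ℕ → ℕ → Set
    K s p = At s (key s p)

    skipped-other : ∀ {s} → s ≢ s₀ → skipped s ≡ e
    skipped-other {s} ne with s ≟ᵇ s₀
    ... | yes eq = ⊥-elim (ne eq)
    ... | no _   = refl

    skipped-same : skipped s₀ ≡ N
    skipped-same with s₀ ≟ᵇ s₀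
    ... | yes _  = refl
    ... | no ne  = ⊥-elim (ne refl)

    skipped-edge : ∀ {p s} → E p → p ≡ skipped s → p ≡ e × not s ≡ s₀
    skipped-edge {p} {s} Ep eq with s ≟ᵇ s₀
    ... | yes _ = ⊥-elim (<⇒≢ (E<N Ep) eq)
    ... | no ne = eq , ≡-sym (¬-not (ne ∘ ≡-sym))

    data Step : Dart → Dart → Set where
      bounce : ∀ {s} → skipped s ≡ e → not s ≡ s₀ → Step (e , s) (e , not s)
      along  : ∀ {p s r} → p ≢ skipped s → Next (K s p) p r → r ≡ nx s (skipped s) p → Step (p , s) (r , not s)

    φ-step : ∀ p s → E p → Step (p , s) (φ (p , s))
    φ-step p s Ep with p ≟ skipped s
    ... | no ne  = along ne (nx-next s (skipped s) Ep ne) refl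
    ... | yes eq with skipped-edge Ep eq
    ... | refl , not≡ = bounce (≡-sym eq) not≡

    step-E : ∀ {p s p′ s′} → E p → Step (p , s) (p′ , s′) → E p′
    step-E Ep (bounce _ _)                = Ep
    step-E Ep (along _ ((Er , _) , _) _) = Er

    d-E : ∀ t → E (proj₁ (d t))
    d-E zero    = Ee
    d-E (suc t) = step-E (d-E t) (φ-step _ _ (d-E t))

    -- Invariant: the walk leaves an end only after arriving along the edge it owns.

    Arrival : ℕ → Set
    Arrival t = ∀ {p s} → d t ≡ (p , s) → p ≢ skipped s →
      ∃[ t′ ] t′ ≤ t × ∃[ q ] E q × key s q ≡ key s p × o q ≡ s × d t′ ≡ (q , s)

    not≢ : ∀ {s : Bool} → not s ≢ s
    not≢ {true} ()
    not≢ {false} ()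

    -- If the end reached along `p` does not own `p`, the end just left does, and by the invariant
    -- the walk had arrived there along its owned edge, which is `p`. So the walk returns to an end
    -- that it left earlier along `p`, and the invariant at that departure supplies the arrival.
    arrival-step : ∀ t → (∀ {t′} → t′ < suc t → Arrival t′) → Arrival (suc t)
    arrival-step t rec {p} {s} eq ne with d t in dt | φ-step (proj₁ (d t)) (proj₂ (d t)) (d-E t)
    ... | p₀ , s₁ | st = go st eq
      where
      go : ∀ {p₁ s₂} → Step (p₀ , s₁) (p₁ , s₂) → (p₁ , s₂) ≡ (p , s) →
           ∃[ t′ ] t′ ≤ suc t × ∃[ q ] E q × key s q ≡ key s p × o q ≡ s × d t′ ≡ (q , s)
      go (bounce _ not≡) refl = suc t , ≤-refl , e , Ee , refl , ≡-sym not≡ , trans (cong φ dt) eq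
      go (along ne₀ ((Ep , k , _) , _) _) refl with o p ≟ᵇ s
      ... | yes op = suc t , ≤-refl , p , Ep , refl , op , trans (cong φ dt) eq
      ... | no op≢ with rec ≤-refl dt ne₀
      ... | t′ , t′≤ , q , Eq , kq , oq , dt′ with consistent Eq Ep (trans oq op′) (subst (λ σ → key σ q ≡ key σ p)
          (≡-sym oq) (trans kq (≡-sym k)))
        where
        op′ : s₁ ≡ o p
        op′ = trans (≡-sym (not-involutive s₁)) (≡-sym (¬-not op≢))
      -- At time 0 the edge is `e`, which is skipped at the end now reached.
      go (along ne₀ ((Ep , k , _) , _) _) refl | no op≢ | zero , t′≤ , .p , Eq , kq , oq , refl | refl =
        ⊥-elim (ne (≡-sym (skipped-other not≢)))
      go (along ne₀ ((Ep , k , _) , _) _) refl | no op≢ | suc t″ , t′≤ , .p , Eq , kq , oq , dt′ | refl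
        with d t″ in dt″ | φ-step (proj₁ (d t″)) (proj₂ (d t″)) (d-E t″)
      ... | p₂ , s₂ | st₂ = back st₂ dt′
        where
        back : ∀ {p₁ s₃} → Step (p₂ , s₂) (p₁ , s₃) → (p₁ , s₃) ≡ (p , s₁) →
               ∃[ t′ ] t′ ≤ suc t × ∃[ q ] E q × key s q ≡ key s p × o q ≡ s × d t′ ≡ (q , s)
        back (bounce sk _) refl = ⊥-elim (ne (≡-sym (trans (cong skipped (not-involutive s₂)) sk)))
        back (along ne₂ ((_ , k₂ , _) , _) _) refl with rec (s≤s (≤-trans (n≤1+n t″) t′≤)) dt″ ne₂
        ... | t₃ , t₃≤ , q₃ , Eq₃ , k₃ , o₃ , d₃ rewrite not-involutive s₂ =
          t₃ , ≤-trans t₃≤ (≤-trans (n≤1+n t″) (≤-trans t′≤ (n≤1+n t))) , q₃ , Eq₃ , trans k₃ (≡-sym k₂) , o₃ , d₃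

    arrival : ∀ t → Arrival t
    arrival = <-rec Arrival λ
      { zero rec refl ne → 0 , z≤n , e , Ee , refl , refl , refl
      ; (suc t) rec → arrival-step t rec }

    -- The end being left owns `p`, and by `arrival` the walk came to it along an edge it owns; by
    -- consistency this was `p`.
    arrives-first : ∀ t {p s} → d t ≡ (p , s) → o p ≢ s → ∃[ t′ ] t′ < t × proj₁ (d t′) ≡ p
    arrives-first zero refl op≢ = ⊥-elim (op≢ refl)
    arrives-first (suc t) {p} {s} eq op≢ with d t in dt | φ-step (proj₁ (d t)) (proj₂ (d t)) (d-E t)
    ... | p₀ , s₁ | st = go st eq
      where
      go : ∀ {p₁ s₂} → Step (p₀ , s₁) (p₁ , s₂) → (p₁ , s₂) ≡ (p , s) → ∃[ t′ ] t′ < suc t × proj₁ (d t′) ≡ p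
      go (bounce _ not≡) refl = ⊥-elim (op≢ (≡-sym not≡))
      go (along ne₀ ((Ep , k , _) , _) _) refl with arrival t dt ne₀
      ... | t′ , t′≤ , q , Eq , kq , oq , dt′ = t′ , s≤s t′≤ , trans (cong proj₁ dt′)
        (consistent Eq Ep (trans oq s₁≡) (subst (λ σ → key σ q ≡ key σ p) (≡-sym oq) (trans kq (≡-sym k))))
        where
        s₁≡ : s₁ ≡ o p
        s₁≡ = trans (≡-sym (not-involutive s₁)) (≡-sym (¬-not op≢))

    -- Two ordinary steps are separated by `next-injective`. A bounce leaves along `e` at the very
    -- end where ordinary steps skip `e`.
    φ-injective : ∀ {p s q σ} → E p → E q → φ (p , s) ≡ φ (q , σ) → (p , s) ≡ (q , σ)
    φ-injective {p} {s} {q} {σ} Ep Eq eq = go (φ-step p s Ep) (φ-step q σ Eq) eq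
      where
      not-inj : ∀ {a b} → not a ≡ not b → a ≡ b
      not-inj {a} {b} e = trans (≡-sym (not-involutive a)) (trans (cong not e) (not-involutive b))
      go : ∀ {p₁ s₁ q₁ σ₁} → Step (p , s) (p₁ , s₁) → Step (q , σ) (q₁ , σ₁) → (p₁ , s₁) ≡ (q₁ , σ₁) → (p , s) ≡ (q , σ)
      go (bounce _ _) (bounce _ _) eq with ,-injective eq
      ... | refl , es = cong (e ,_) (not-inj es)
      go (bounce sk _) (along ne ((_ , _ , r≢) , _) _) eq with ,-injective eq
      ... | refl , es = ⊥-elim (r≢ (trans (≡-sym sk) (cong skipped (not-inj es))))
      go (along ne ((_ , _ , r≢) , _) _) (bounce sk _) eq with ,-injective eq
      ... | refl , es = ⊥-elim (r≢ (trans (≡-sym sk) (cong skipped (≡-sym (not-inj es)))))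
      go (along ne ((Er , k , r≢) , n) _) (along ne′ ((_ , k′ , _) , n′) _) eq with ,-injective eq
      ... | refl , es with not-inj es
      ... | refl = cong (_, s) (next-injective {K s p} (Ep , refl , ne) (Eq , ≡-sym same , ne′) ((Er , k , r≢) , n)
                     (subst (λ z → Next (At s z) q _) (≡-sym same) ((Er , k′ , r≢) , n′)))
        where
        same : key s p ≡ key s q
        same = trans (≡-sym k) k′

    -- By injectivity a repetition can be traced back to time 0, so the walk is periodic from its
    -- start.
    rewind-walk : ∀ i j → d i ≡ d (i + j) → d j ≡ (e , s₀)
    rewind-walk zero    j eq = ≡-sym eq
    rewind-walk (suc i) j eq = rewind-walk i j (φ-injective (d-E i) (d-E (i + j)) eq)

    visited : ℕ → ℕ
    visited = λ i → iterate (advance s₀ e) e i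

    φ-even : ∀ a → E a → φ (a , s₀) ≡ (nx s₀ N a , not s₀)
    φ-even a Ea with a ≟ skipped s₀
    ... | yes eq = ⊥-elim (<⇒≢ (E<N Ea) (trans eq skipped-same))
    ... | no _   = cong (λ x → nx s₀ x a , not s₀) skipped-same

    φ-odd : ∀ b → φ (b , not s₀) ≡ (turn s₀ e b , s₀)
    φ-odd b with b ≟ skipped (not s₀)
    ... | yes eq = cong₂ _,_ (trans b≡e (≡-sym (if-true (trans (cong (_≡ᵇ e) b≡e) (≡ᵇ-refl e)))))
                     (not-involutive s₀)
      where
      b≡e : b ≡ e
      b≡e = trans eq (skipped-other not≢)
    ... | no ne  = cong₂ _,_ (trans (cong (λ x → nx (not s₀) x b) (skipped-other not≢))
                     (≡-sym (if-false (≡ᵇ-false λ b≡e → ne (trans b≡e (≡-sym (skipped-other not≢)))))))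
                     (not-involutive s₀)

    d-even : ∀ i → d (i + i) ≡ (visited i , s₀)
    d-odd  : ∀ i → d (suc (i + i)) ≡ (nx s₀ N (visited i) , not s₀)
    d-even zero    = refl
    d-even (suc i) = trans (cong (d ∘ suc) (+-suc i i)) (trans (cong φ (d-odd i))
      (trans (φ-odd _) (cong (_, s₀) (≡-sym (iterate-suc (advance s₀ e) e i)))))
    d-odd i = trans (cong φ (d-even i)) (φ-even (visited i) (subst E (cong proj₁ (d-even i)) (d-E (i + i))))

    visited<N : ∀ i → visited i < N
    visited<N i = E<N (subst E (cong proj₁ (d-even i)) (d-E (i + i)))

    -- Two of the first `N + 1` states coincide, and a state stands for two darts; hence the `N`
    -- iterations in `own` cover a full period.
    period : ∃[ T ] 0 < T × T ≤ N + N × d T ≡ (e , s₀)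
    period with pigeonhole {N} {suc N} ≤-refl (λ i → fromℕ< (visited<N (toℕ i)))
    ... | i , j , i<j , eq = k + k , +-mono-<-≤ (m<n⇒0<n∸m i<j) z≤n ,
      +-mono-≤ k≤N k≤N , rewind-walk (toℕ i + toℕ i) (k + k) same
      where
      k : ℕ
      k = toℕ j ∸ toℕ i
      k≤N : k ≤ N
      k≤N = ≤-trans (m∸n≤m (toℕ j) (toℕ i)) (s≤s⁻¹ (toℕ<n j))
      visited≡ : visited (toℕ i) ≡ visited (toℕ j)
      visited≡ = trans (≡-sym (toℕ-fromℕ< _)) (trans (cong toℕ eq) (toℕ-fromℕ< _))
      same : d (toℕ i + toℕ i) ≡ d (toℕ i + toℕ i + (k + k))
      same = trans (d-even (toℕ i)) (trans (cong (_, s₀) visited≡) (trans (≡-sym (d-even (toℕ j)))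
        (cong d (≡-sym (trans (+-exchange (toℕ i) (toℕ i) k k) (cong₂ _+_ (m+[n∸m]≡n (<⇒≤ i<j)) (m+[n∸m]≡n (<⇒≤ i<j))))))))
        where
        +-exchange : ∀ a b c d → (a + b) + (c + d) ≡ (a + c) + (b + d)
        +-exchange a b c d = trans (+-assoc a b (c + d)) (trans (cong (a +_) (trans (≡-sym (+-assoc b c d))
          (trans (cong (_+ d) (+-comm b c)) (+-assoc c b d)))) (≡-sym (+-assoc a c (b + d))))

    φ-along : ∀ {p s} → p ≢ skipped s → φ (p , s) ≡ (nx s (skipped s) p , not s)
    φ-along {p} {s} ne with p ≟ skipped s
    ... | yes eq = ⊥-elim (ne eq)
    ... | no _   = refl

    module Closure {T : ℕ} (dT : d T ≡ (e , s₀)) where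

      -- Only a bounce can produce the initial dart, so an ordinary step never completes the period.
      leave : ∀ {t c s} → t < T → d t ≡ (c , s) → c ≢ skipped s → suc t < T × d (suc t) ≡ (nx s (skipped s) c , not s)
      leave {t} {c} {s} t<T eq ne = ≤∧≢⇒< t<T over , next-dart
        where
        next-dart : d (suc t) ≡ (nx s (skipped s) c , not s)
        next-dart = trans (cong φ eq) (φ-along ne)
        over : suc t ≢ T
        over refl with ,-injective (trans (≡-sym dT) next-dart)
        ... | e≡ , s≡ with nx-next s (skipped s) (subst E (cong proj₁ eq) (d-E t)) ne
        ... | (_ , _ , r≢) , _ = r≢ (trans (≡-sym e≡) (≡-sym (skipped-other λ s≡s₀ → not≢ (trans (≡-sym s≡) (≡-sym s≡s₀)))))

      -- Depth-first traversal without mentioning a tree. An edge `c` other than `q` leads to the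
      -- owner of `c`; by induction on the remaining time all edges there are left along before `T`,
      -- including `c` itself, so the walk comes back and continues with the edge after `c`. Cyclic
      -- induction then covers all edges at this end.
      closed : ∀ n t → T ∸ t ≤ n → t < T → ∀ {q s} → d t ≡ (q , s) → o q ≡ s →
               ∀ {c} → K s q c → ∃[ t′ ] t < t′ × t′ < T × d t′ ≡ (c , not s)
      closed zero    t le t<T eq oq = ⊥-elim (<⇒≱ t<T (m∸n≡0⇒m≤n (n≤0⇒n≡0 le)))
      closed (suc n) t le t<T {q} {s} eq oq =
        Cycle.all {K s q} {N} (E<N ∘ proj₁)
          (λ { {c} (Ec , k , ne) → subst (λ z → Next (At s z) c (nx s (skipped s) c)) k (nx-next s (skipped s) Ec ne) })
          {λ c → ∃[ t′ ] t < t′ × t′ < T × d t′ ≡ (c , not s)} {q} (Eq , refl , q≢)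
          (suc t , ≤-refl , leave t<T eq q≢) onward
        where
        Eq : E q
        Eq = subst E (cong proj₁ eq) (d-E t)
        q≢ : q ≢ skipped s
        q≢ q≡ with skipped-edge Eq q≡
        ... | refl , not≡ = not≢ (trans not≡ oq)
        onward : ∀ {c} → K s q c → c ≢ q → ∃[ t′ ] t < t′ × t′ < T × d t′ ≡ (c , not s) →
                 ∃[ t′ ] t < t′ × t′ < T × d t′ ≡ (nx s (skipped s) c , not s)
        onward {c} (Ec , k , c≢) c≢q (t′ , t<t′ , t′<T , eq′)
          with closed n t′ (s≤s⁻¹ (≤-trans (∸-monoʳ-< t<t′ (<⇒≤ t′<T)) le)) t′<T eq′ oc (Ec , refl , c≢′)
          where
          oc : o c ≡ not s
          oc = ¬-not λ oc≡s → c≢q (consistent Ec Eq (trans oc≡s (≡-sym oq)) (subst (λ σ → key σ c ≡ key σ q) (≡-sym oc≡s) k))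
          c≢′ : c ≢ skipped (not s)
          c≢′ c≡ with skipped-edge Ec c≡
          ... | refl , nn≡ = not≢ (trans nn≡ oc)
        ... | t″ , t′<t″ , t″<T , eq″ with leave t″<T (trans eq″ (cong (c ,_) (not-involutive s))) c≢
        ... | lt , eq₃ = suc t″ , <-trans t<t′ (<-trans t′<t″ ≤-refl) , lt , eq₃

    module Meeting (z : ℕ) where

      Unmet : ℕ → Set
      Unmet n = ∀ t → t < n → proj₁ (d t) ≢ z

      Meets : ℕ → Set
      Meets i = visited i ≡ z ⊎ nx s₀ N (visited i) ≡ z

      seek-met : ∀ n {i} → Meets i → iterate (seek s₀ e z) (visited i) n ≡ visited i
      seek-met zero    m = refl
      seek-met (suc n) {i} m = trans (cong (λ a → iterate (seek s₀ e z) a n) (stop m)) (seek-met n {i} m)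
        where
        stop : Meets i → seek s₀ e z (visited i) ≡ visited i
        stop (inj₁ eq) = if-true (trans (cong (_≡ᵇ z) eq) (≡ᵇ-refl z))
        stop (inj₂ eq) with visited i ≡ᵇ z
        ... | true  = refl
        ... | false = if-true (trans (cong (_≡ᵇ z) eq) (≡ᵇ-refl z))

      unmet-suc : ∀ i → Unmet (i + i) → visited i ≢ z → Unmet (suc (i + i))
      unmet-suc i u ne t t< with m≤n⇒m<n∨m≡n (s≤s⁻¹ t<)
      ... | inj₁ lt   = u t lt
      ... | inj₂ refl = λ eq → ne (trans (≡-sym (cong proj₁ (d-even i))) eq)

      unmet-suc² : ∀ i → Unmet (i + i) → visited i ≢ z → nx s₀ N (visited i) ≢ z → Unmet (suc i + suc i)
      unmet-suc² i u ne₁ ne₂ t t< with m≤n⇒m<n∨m≡n (s≤s⁻¹ (subst (t <_) (cong suc (+-suc i i)) t<))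
      ... | inj₁ lt   = unmet-suc i u ne₁ t lt
      ... | inj₂ refl = λ eq → ne₂ (trans (≡-sym (cong proj₁ (d-odd i))) eq)

      seeking : ∀ n i → Unmet (i + i) → ∃[ j ] iterate (seek s₀ e z) (visited i) n ≡ visited j × Unmet (j + j) × (n + i ≤ j ⊎ Meets j)
      seeking zero    i u = i , refl , u , inj₁ ≤-refl
      seeking (suc n) i u with visited i ≟ z | nx s₀ N (visited i) ≟ z
      ... | yes m | _     = i , seek-met (suc n) {i} (inj₁ m) , u , inj₂ (inj₁ m)
      ... | no _  | yes m = i , seek-met (suc n) {i} (inj₂ m) , u , inj₂ (inj₂ m)
      ... | no a  | no b with seeking n (suc i) (unmet-suc² i u a b)
      ... | j , eq , uj , side = j , trans (cong (λ a → iterate (seek s₀ e z) a n) go) eq , uj ,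
        Sum.map₁ (subst (_≤ j) (+-suc n i)) side
        where
        go : seek s₀ e z (visited i) ≡ visited (suc i)
        go = trans (if-false (≡ᵇ-false a)) (trans (if-false (≡ᵇ-false b)) (≡-sym (iterate-suc (advance s₀ e) e i)))

      own-time : ∀ {σ} → own s₀ e z ≡ just σ → ∃[ t ] d t ≡ (z , σ) × Unmet t
      own-time eq with seeking N 0 (λ _ ())
      ... | j , eqj , u , _ with visited j ≟ z | nx s₀ N (visited j) ≟ z | trans (≡-sym (cong (report s₀ z) eqj)) eq
      ... | yes a | _     | eq′ rewrite if-true {x = just s₀} {y = if nx s₀ N (visited j) ≡ᵇ z then just
          (not s₀) else nothing} (trans (cong (_≡ᵇ z) a) (≡ᵇ-refl z))
        with refl ← eq′ = j + j , trans (d-even j) (cong (_, s₀) a) , u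
      ... | no a  | yes b | eq′ rewrite ≡ᵇ-false a | b | ≡ᵇ-refl z
        with refl ← eq′ = suc (j + j) , trans (d-odd j) (cong (_, not s₀) b) , unmet-suc j u a
      ... | no a  | no b  | eq′ rewrite ≡ᵇ-false a | ≡ᵇ-false b with () ← eq′

      own-nothing : own s₀ e z ≡ nothing → Unmet (N + N)
      own-nothing eq with seeking N 0 (λ _ ())
      ... | j , eqj , u , inj₁ le = λ t t< → u t (≤-trans t< (+-mono-≤ N≤j N≤j))
        where
        N≤j : N ≤ j
        N≤j = subst (_≤ j) (+-identityʳ N) le
      ... | j , eqj , u , inj₂ m = ⊥-elim (met m (trans (≡-sym (cong (report s₀ z) eqj)) eq))
        where
        met : Meets j → report s₀ z (visited j) ≢ nothing
        met (inj₁ a) eq′ = just≢nothing (trans (≡-sym (if-true (trans (cong (_≡ᵇ z) a) (≡ᵇ-refl z)))) eq′)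
        met (inj₂ b) eq′ with visited j ≡ᵇ z
        ... | true  = just≢nothing eq′
        ... | false = just≢nothing (trans (≡-sym (if-true (trans (cong (_≡ᵇ z) b) (≡ᵇ-refl z)))) eq′)

    d-periodic : ∀ {T} → d T ≡ (e , s₀) → ∀ j → d (j + T) ≡ d j
    d-periodic dT zero    = dT
    d-periodic dT (suc j) = cong φ (d-periodic dT j)

    -- By `arrives-first` the reported end of an edge agrees with `o` wherever there is one, and
    -- `closed` shows that edges sharing a reported end are met as well.
    own-autarky : Autarky E key (own s₀ e)
    own-autarky {p} {q} {s} Ep Eq p≢q eq k with period | Meeting.own-time p eq
    ... | T , 0<T , T≤ , dT | t , dt , unmet = owned
      where
      op : o p ≡ s
      op with o p ≟ᵇ s
      ... | yes op≡ = op≡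
      ... | no op≢ with arrives-first t dt op≢
      ... | t′ , t′<t , met = ⊥-elim (unmet t′ t′<t met)
      -- Otherwise `p` would have been met one period earlier.
      t<T : t < T
      t<T = ≰⇒> λ T≤t → unmet (t ∸ T) (∸-monoʳ-< 0<T T≤t)
        (trans (≡-sym (cong proj₁ (d-periodic dT (t ∸ T)))) (trans (cong (proj₁ ∘ d) (m∸n+n≡m T≤t)) (cong proj₁ dt)))
      met : ∃[ t′ ] t′ < T × proj₁ (d t′) ≡ q
      met with q ≟ skipped s
      -- An edge skipped at this end is `e`, with which the walk starts.
      ... | yes q≡ = 0 , 0<T , ≡-sym (proj₁ (skipped-edge Eq q≡))
      ... | no q≢ with Closure.closed dT (T ∸ t) t ≤-refl t<T dt op (Eq , ≡-sym k , q≢)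
      ... | t′ , _ , t′<T , dt′ = t′ , t′<T , cong proj₁ dt′
      owned : own s₀ e q ≡ just (not s)
      owned with own s₀ e q in eq′
      ... | nothing with met
      ... | t′ , t′<T , dt′ = ⊥-elim (Meeting.own-nothing q eq′ t′ (≤-trans t′<T T≤) dt′)
      owned | just σ with Meeting.own-time q eq′
      ... | t₁ , dt₁ , unmet₁ = cong just (trans (≡-sym oq) (¬-not λ oq≡s →
              p≢q (consistent Ep Eq (trans op (≡-sym oq≡s)) (subst (λ σ′ → key σ′ p ≡ key σ′ q) (≡-sym op) k))))
        where
        oq : o q ≡ σ
        oq with o q ≟ᵇ σ
        ... | yes oq≡ = oq≡
        ... | no oq≢ with arrives-first t₁ dt₁ oq≢
        ... | t′ , t′<t , met′ = ⊥-elim (unmet₁ t′ t′<t met′)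

-- Connectives, subtraction and bounded search as terms

module _ {k : ℕ} where

  infixr 6 _∧′_
  infixr 5 _∨′_

  not′ : ∀ {m} → Tm k m → Tm k m
  not′ a = ifz a (lit 1F) (lit 0F)

  _∧′_ _∨′_ monus eq : ∀ {m} → Tm k m → Tm k m → Tm k m
  a ∧′ b = ifz a (lit 0F) b
  a ∨′ b = ifz a b (lit 1F)
  monus a b = iter a b (prev (var 1F))
  eq a b = ifz (monus a b) (not′ (monus b a)) (lit 0F)

  lt : ∀ {m} → Tm k m → Tm k m → Tm k m
  lt a b = monus b a

  -- Inside a loop, variable 1 is the accumulated result, which the property `f` must not see.
  weaken : ∀ {m} → Tm k (suc m) → Tm k (suc (suc m))
  weaken f = call f (var 0F ∷ tabulate (λ i → var (Fin.suc (Fin.suc i))))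

  -- Indices run downwards, so the last hit that `least` records is the smallest one; `top` stands
  -- for no hit.
  all′ least : ∀ {m} → Tm k (suc m) → Tm k m
  all′ f  = iter (lit 1F) top (ifz (var 1F) (lit 0F) (weaken f))
  least f = iter top top (ifz (weaken f) (var 1F) (var 0F))

True : ℕ → Set
True n = n ≢ 0

true? : ∀ n → Dec (True n)
true? n = ¬? (n ≟ 0)

true-bit : ∀ {b} → True (bit b) ⇔ b ≡ true
true-bit {true}  = mk⇔ (λ _ → refl) (λ _ ())
true-bit {false} = mk⇔ (λ t → ⊥-elim (t refl)) (λ ())

true-not : ∀ n → True (choose n 1 0) ⇔ (¬ True n)
true-not zero    = mk⇔ (λ _ t → t refl) (λ _ ())
true-not (suc n) = mk⇔ (λ t → ⊥-elim (t refl)) (λ f → ⊥-elim (f λ ()))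

true-∧ : ∀ a {b} → True (choose a 0 b) ⇔ (True a × True b)
true-∧ zero    = mk⇔ (λ t → ⊥-elim (t refl)) (λ (t , _) → ⊥-elim (t refl))
true-∧ (suc a) = mk⇔ (λ t → (λ ()) , t) proj₂

true-∨ : ∀ a {b} → True (choose a b 1) ⇔ (True a ⊎ True b)
true-∨ zero    = mk⇔ inj₂ (λ { (inj₁ t) → ⊥-elim (t refl) ; (inj₂ t) → t })
true-∨ (suc a) = mk⇔ (λ _ → inj₁ λ ()) (λ _ ())

loop-const : ∀ f c z → loop (λ _ → f) c z ≡ iterate f z c
loop-const f zero    z = refl
loop-const f (suc c) z = loop-const f c (f z)

loop-cong : ∀ {f g : ℕ → ℕ → ℕ} → (∀ c z → f c z ≡ g c z) → ∀ c z → loop f c z ≡ loop g c z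
loop-cong h zero    z = refl
loop-cong {f} h (suc c) z = trans (cong (loop f c) (h c z)) (loop-cong h c _)

loop-pred : ∀ a b → loop (λ _ → pred) b a ≡ a ∸ b
loop-pred a       zero    = refl
loop-pred zero    (suc b) = trans (loop-pred zero b) (0∸n≡0 b)
loop-pred (suc a) (suc b) = loop-pred a b

-- The value `N` encodes an unsuccessful search, hence the condition in `found`.
record Least (N : ℕ) (P : ℕ → Set) (r : ℕ) : Set where
  constructor least-at
  field
    below : ∀ c → c < N → c < r → ¬ P c
    found : r < N → P r
    bound : r ≤ N

module TermSemantics {k : ℕ} (w : List (Fin k)) where
  open Semantics w public

  private variable
    m : ℕ

  eval-monus : ∀ (a b : Tm k m) vs → eval (monus a b) vs ≡ eval a vs ∸ eval b vs
  eval-monus a b vs = loop-pred (eval a vs) (eval b vs)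

  true-lt : ∀ (a b : Tm k m) vs → True (eval (lt a b) vs) ⇔ eval a vs < eval b vs
  true-lt a b vs = mk⇔
    (λ t → ≰⇒> λ le → t (trans (eval-monus b a vs) (m≤n⇒m∸n≡0 le)))
    (λ a<b e → <⇒≱ a<b (m∸n≡0⇒m≤n (trans (≡-sym (eval-monus b a vs)) e)))

  eval-eq : ∀ (a b : Tm k m) vs → eval (eq a b) vs ≡ bit (eval a vs ≡ᵇ eval b vs)
  eval-eq a b vs = trans (cong₂ (λ x y → choose x (choose y 1 0) 0) (eval-monus a b vs) (eval-monus b a vs))
                         (go (eval a vs) (eval b vs))
    where
    go : ∀ x y → choose (x ∸ y) (choose (y ∸ x) 1 0) 0 ≡ bit (x ≡ᵇ y)
    go zero    zero    = refl
    go zero    (suc y) = refl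
    go (suc x) zero    = refl
    go (suc x) (suc y) = go x y

  true-eq : ∀ (a b : Tm k m) vs → True (eval (eq a b) vs) ⇔ eval a vs ≡ eval b vs
  true-eq a b vs = mk⇔
    (λ t → ≡ᵇ⇒≡ _ _ (subst T (≡-sym (to true-bit (subst True (eval-eq a b vs) t))) _))
    (λ e → subst True (≡-sym (eval-eq a b vs)) (from true-bit (T⇒ (≡⇒≡ᵇ _ _ e))))
    where
    T⇒ : ∀ {b} → T b → b ≡ true
    T⇒ {true} _ = refl

  eval-weaken : ∀ (f : Tm k (suc m)) c z vs → eval (weaken f) (c ∷ z ∷ vs) ≡ eval f (c ∷ vs)
  eval-weaken f c z vs = cong (λ us → eval f (c ∷ us)) (trans (evals-tabulate (λ i → Fin.suc (Fin.suc i))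
      (c ∷ z ∷ vs)) (tabulate∘lookup vs))
    where
    evals-tabulate : ∀ {m j} (g : Fin j → Fin m) us → evals (tabulate (var ∘ g)) us ≡ tabulate (lookup us ∘ g)
    evals-tabulate {j = zero}  g us = refl
    evals-tabulate {j = suc j} g us = cong (lookup us (g 0F) ∷_) (evals-tabulate (g ∘ Fin.suc) us)

  true-all : ∀ (f : Tm k (suc m)) vs → True (eval (all′ f) vs) ⇔ (∀ c → c < end → True (eval f (c ∷ vs)))
  true-all f vs = mk⇔ (λ t → proj₂ (forth end 1 t)) (λ h → back end (λ c lt → h c lt) 1 λ ())
    where
    h : ℕ → ℕ → ℕ
    h c z = eval (ifz (var 1F) (lit 0F) (weaken f)) (c ∷ z ∷ vs)
    forth : ∀ c z → True (loop h c z) → True z × (∀ d → d < c → True (eval f (d ∷ vs)))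
    forth zero    z t = t , λ _ ()
    forth (suc c) z t with forth c (h c z) t
    ... | hz , rest with to (true-∧ z) hz
    ... | tz , tf = tz , λ d d<c → case d d<c
      where
      case : ∀ d → d < suc c → True (eval f (d ∷ vs))
      case d d<c with m≤n⇒m<n∨m≡n (s≤s⁻¹ d<c)
      ... | inj₁ lt   = rest d lt
      ... | inj₂ refl = subst True (eval-weaken f c z vs) tf
    back : ∀ c → (∀ d → d < c → True (eval f (d ∷ vs))) → ∀ z → True z → True (loop h c z)
    back zero    g z t = t
    back (suc c) g z t = back c (λ d lt → g d (m<n⇒m<1+n lt)) (h c z)
      (from (true-∧ z) (t , subst True (≡-sym (eval-weaken f c z vs)) (g c ≤-refl)))

  least-spec : ∀ (f : Tm k (suc m)) vs → Least end (λ c → True (eval f (c ∷ vs))) (eval (least f) vs)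
  least-spec f vs = go end end ≤-refl ((λ c c<e e≤c → ⊥-elim (<⇒≱ c<e e≤c)) , (λ lt → ⊥-elim (<-irrefl refl lt)) , ≤-refl)
    where
    P : ℕ → Set
    P c = True (eval f (c ∷ vs))
    h : ℕ → ℕ → ℕ
    h c z = eval (ifz (weaken f) (var 1F) (var 0F)) (c ∷ z ∷ vs)
    Inv : ℕ → ℕ → Set
    Inv c z = (∀ d → d < end → c ≤ d → d < z → ¬ P d) × (z < end → P z) × z ≤ end
    go : ∀ c z → c ≤ end → Inv c z → Least end P (loop h c z)
    go zero    z le (a , f′ , b) = least-at (λ d d< → a d d< z≤n) f′ b
    go (suc c) z le (a , f′ , b) with eval (weaken f) (c ∷ z ∷ vs) in e
    ... | zero = go c z (<⇒≤ le) (above , f′ , b)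
      where
      above : ∀ d → d < end → c ≤ d → d < z → ¬ P d
      above d d< c≤d d<z with m≤n⇒m<n∨m≡n c≤d
      ... | inj₁ lt   = a d d< lt d<z
      ... | inj₂ refl = λ t → t (trans (≡-sym (eval-weaken f c z vs)) e)
    ... | suc n = go c c (<⇒≤ le) ((λ d d< c≤d d<c → ⊥-elim (<⇒≱ d<c c≤d)) ,
      (λ _ t → 1+n≢0 (trans (≡-sym e) (trans (eval-weaken f c z vs) t))) , (<⇒≤ le))

-- Numerals on the input

isOne isTwo isDigit isSep isStop : InputCell 4 → Bool
isOne (sym 0F) = true
isOne _        = false
isTwo (sym 1F) = true
isTwo _        = false
isDigit (sym 0F) = true
isDigit (sym 1F) = true
isDigit _        = false
isSep (sym 2F) = true
isSep _        = false
isStop (sym 3F) = true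
isStop _        = false

-- `ptrT` rests on the separator once the digits are exhausted, and `digitT` is 0 there, so numerals
-- of different lengths are compared as if padded with zeros. `compareT` yields 0, 1, 2 for equal,
-- less, greater.
advT digitT afterT lenT : Tm 4 1
ptrT compareT cmpT nthT : Tm 4 2
advT     = ifz (is isDigit (var 0F)) (var 0F) (next (var 0F))
digitT   = ifz (is isTwo (var 0F)) (is isOne (var 0F)) (lit 2F)
ptrT     = iter (var 0F) (var 1F) (call advT (var 1F ∷ []))
compareT = ifz (monus (var 1F) (var 0F)) (ifz (monus (var 0F) (var 1F)) (lit 0F) (lit 2F)) (lit 1F)
-- The loop counter runs downwards, so that the most significant digit is compared first.
cmpT     = iter (lit 0F) top (ifz (var 1F)
             (call compareT (call digitT (call ptrT (var 2F ∷ var 0F ∷ []) ∷ []) ∷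
                             call digitT (call ptrT (var 3F ∷ var 0F ∷ []) ∷ []) ∷ [])) (var 1F))
afterT   = next (call ptrT (var 0F ∷ top ∷ []))
nthT     = iter (var 0F) (var 1F) (call afterT (var 1F ∷ []))
lenT     = least (is isStop (call nthT (var 1F ∷ var 0F ∷ [])))

-- A variable of the formula may exceed every counter on a short input. Being fixed, it is built
-- into the term as a numeral and matched letter by letter.
numeralT : ℕᵇ → Tm 4 1
numeralT ℕᵇ.zero  = is isSep (var 0F)
numeralT 2[1+ b ] = is isTwo (var 0F) ∧′ call (numeralT b) (next (var 0F) ∷ [])
numeralT 1+[2 b ] = is isOne (var 0F) ∧′ call (numeralT b) (next (var 0F) ∷ [])

domT : ∀ {m} → Tm 4 m
domT = call afterT (lit 1F ∷ [])

colT : ℕ → Tm 4 0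
colT x = least (call (numeralT (ℕᵇ.fromℕ x)) (call nthT (domT ∷ var 0F ∷ []) ∷ []))

least-unique : ∀ {N P r} → Least N P r → ∀ j → j < N → P j → (∀ c → c < j → ¬ P c) → r ≡ j
least-unique {N} {P} {r} (least-at below found bound) j j<N Pj small with <-cmp r j
... | tri< r<j _ _ = ⊥-elim (small r r<j (found (<-trans r<j j<N)))
... | tri≈ _ e _   = e
... | tri> _ _ j<r = ⊥-elim (below j j<N j<r Pj)

-- Reading and comparing numerals

module Numbers (w : Word) where
  open TermSemantics w public

  adv : ℕ → ℕ
  adv z = if isDigit (scan w z) then succ z else z

  digitAt : ℕ → ℕ
  digitAt z = eval digitT (z ∷ [])

  -- This value may be exponential in the length of the input, so it only serves to specify terms;
  -- none computes it.
  W : ℕ → ℕ → ℕ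
  W z zero    = 0
  W z (suc n) = digitAt z + 2 * W (adv z) n

  num : ℕ → ℕ
  num q = W q end

  after : ℕ → ℕ
  after q = eval afterT (q ∷ [])

  nth : ℕ → ℕ → ℕ
  nth p j = eval nthT (p ∷ j ∷ [])

  eval-adv : ∀ z → eval advT (z ∷ []) ≡ adv z
  eval-adv z with isDigit (scan w z)
  ... | true  = refl
  ... | false = refl

  eval-ptr : ∀ q i → eval ptrT (q ∷ i ∷ []) ≡ iterate adv q i
  eval-ptr q i = trans (loop-cong (λ _ z → eval-adv z) i q) (loop-const adv i q)

  comp : ℕ → ℕ → ℕ
  comp u v = choose (v ∸ u) (choose (u ∸ v) 0 2) 1

  eval-compare : ∀ u v → eval compareT (u ∷ v ∷ []) ≡ comp u v
  eval-compare u v = cong₂ (λ x y → choose x (choose y 0 2) 1) (loop-pred v u) (loop-pred u v)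

  comp-< : ∀ {u v} → u < v → comp u v ≡ 1
  comp-< {u} {v} u<v with v ∸ u in e
  ... | zero  = ⊥-elim (<⇒≱ u<v (m∸n≡0⇒m≤n e))
  ... | suc _ = refl

  comp-> : ∀ {u v} → v < u → comp u v ≡ 2
  comp-> {u} {v} v<u rewrite m≤n⇒m∸n≡0 (<⇒≤ v<u) with u ∸ v in e
  ... | zero  = ⊥-elim (<⇒≱ v<u (m∸n≡0⇒m≤n e))
  ... | suc _ = refl

  comp-refl : ∀ u → comp u u ≡ 0
  comp-refl u rewrite n∸n≡0 u = refl

  digit≤2 : ∀ z → digitAt z ≤ 2
  digit≤2 z with isTwo (scan w z) | isOne (scan w z)
  ... | true  | _     = ≤-refl
  ... | false | true  = s≤s z≤n
  ... | false | false = z≤n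

  stuck : ∀ z → digitAt z ≡ 0 → adv z ≡ z
  stuck z e with scan w z
  ... | ⊢      = refl
  ... | ⊣      = refl
  ... | sym 2F = refl
  ... | sym 3F = refl

  W-stuck : ∀ n z → digitAt z ≡ 0 → W z n ≡ 0
  W-stuck zero    z e = refl
  W-stuck (suc n) z e rewrite stuck z e | e | W-stuck n z e = refl

  -- Here `b` is positive because `v` is, and `a + 2 * u ≤ 2 * suc u ≤ 2 * v < b + 2 * v`.
  carry : ∀ {a b u v} → a ≤ 2 → (b ≡ 0 → v ≡ 0) → u < v → a + 2 * u < b + 2 * v
  carry {b = zero} a≤2 b0 u<v rewrite b0 refl with () ← u<v
  carry {a} {suc b} {u} {v} a≤2 b0 u<v = s≤s (≤-trans (+-monoˡ-≤ (2 * u) a≤2)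
    (≤-trans (≤-reflexive (≡-sym (*-suc 2 u))) (≤-trans (*-monoʳ-≤ 2 u<v) (m≤n+m _ b))))

  -- For bijective digits a, b ≤ 2 a zero digit only occurs past the end of a numeral.
  comp-digits : ∀ {a b} u v → a ≤ 2 → b ≤ 2 → (a ≡ 0 → u ≡ 0) → (b ≡ 0 → v ≡ 0) →
                choose (comp u v) (comp a b) (comp u v) ≡ comp (a + 2 * u) (b + 2 * v)
  comp-digits {a} {b} u v a≤2 b≤2 a0 b0 with <-cmp u v
  ... | tri< u<v _ _ rewrite comp-< u<v = ≡-sym (comp-< (carry {a} {b} a≤2 b0 u<v))
  ... | tri> _ _ v<u rewrite comp-> v<u = ≡-sym (comp-> (carry {b} {a} b≤2 a0 v<u))
  ... | tri≈ _ refl _ rewrite comp-refl u =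
    cong₂ (λ x y → choose x (choose y 0 2) 1) (≡-sym (cancel b a)) (≡-sym (cancel a b))
    where
    cancel : ∀ a b → a + 2 * u ∸ (b + 2 * u) ≡ a ∸ b
    cancel a b = trans (cong₂ _∸_ (+-comm a (2 * u)) (+-comm b (2 * u))) ([m+n]∸[m+o]≡n∸o (2 * u) a b)

  -- When the loop counter is `c`, the state compares the numbers formed by the digits from index
  -- `c` on.
  eval-cmp : ∀ q q′ → eval cmpT (q ∷ q′ ∷ []) ≡ comp (num q) (num q′)
  eval-cmp q q′ = trans (go end 0) (cong (λ m → comp (W q m) (W q′ m)) (+-identityʳ end))
    where
    h : ℕ → ℕ → ℕ
    h c z = choose z (eval compareT (eval digitT (eval ptrT (q ∷ c ∷ []) ∷ []) ∷ eval digitT (eval ptrT (q′ ∷ c ∷ []) ∷ []) ∷ [])) z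
    refine : ∀ c n → h c (comp (W (iterate adv q (suc c)) n) (W (iterate adv q′ (suc c)) n))
                     ≡ comp (W (iterate adv q c) (suc n)) (W (iterate adv q′ c) (suc n))
    refine c n
      rewrite eval-ptr q c | eval-ptr q′ c | eval-compare (digitAt (iterate adv q c)) (digitAt (iterate adv q′ c))
            | iterate-suc adv q c | iterate-suc adv q′ c =
      comp-digits (W (adv z) n) (W (adv z′) n) (digit≤2 z) (digit≤2 z′) (zero-digit z) (zero-digit z′)
      where
      z = iterate adv q c
      z′ = iterate adv q′ c
      zero-digit : ∀ z → digitAt z ≡ 0 → W (adv z) n ≡ 0
      zero-digit z e rewrite stuck z e = W-stuck n z e
    go : ∀ c n → loop h c (comp (W (iterate adv q c) n) (W (iterate adv q′ c) n)) ≡ comp (W q (c + n)) (W q′ (c + n))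
    go zero    n = refl
    go (suc c) n = trans (cong (loop h c) (refine c n))
      (trans (go c (suc n)) (cong (λ m → comp (W q m) (W q′ m)) (+-suc c n)))

  true-same : ∀ q q′ → (¬ True (eval cmpT (q ∷ q′ ∷ []))) ⇔ num q ≡ num q′
  true-same q q′ = mk⇔ forth λ e t → t (trans (eval-cmp q q′) (trans (cong (comp (num q)) (≡-sym e)) (comp-refl (num q))))
    where
    forth : ¬ True (eval cmpT (q ∷ q′ ∷ [])) → num q ≡ num q′
    forth ¬t with <-cmp (num q) (num q′)
    ... | tri< lt _ _ = ⊥-elim (¬t λ e → 1+n≢0 (trans (≡-sym (comp-< lt)) (trans (≡-sym (eval-cmp q q′)) e)))
    ... | tri≈ _ e _  = e
    ... | tri> _ _ gt = ⊥-elim (¬t λ e → 1+n≢0 (trans (≡-sym (comp-> gt)) (trans (≡-sym (eval-cmp q q′)) e)))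

  cmp-less : ∀ q q′ → eval cmpT (q ∷ q′ ∷ []) ≡ 1 ⇔ num q < num q′
  cmp-less q q′ = mk⇔ forth λ lt → trans (eval-cmp q q′) (comp-< lt)
    where
    forth : eval cmpT (q ∷ q′ ∷ []) ≡ 1 → num q < num q′
    forth e with <-cmp (num q) (num q′)
    ... | tri< lt _ _ = lt
    ... | tri≈ _ e′ _ with () ← trans (≡-sym (comp-refl (num q))) (trans (cong (comp (num q)) e′) (trans (≡-sym (eval-cmp q q′)) e))
    ... | tri> _ _ gt with () ← trans (≡-sym (comp-> gt)) (trans (≡-sym (eval-cmp q q′)) e)

  -- Positions count from 1; position 0 is the left end marker.

  record At (p : ℕ) (u : Word) : Set where
    constructor at
    field
      prefix : Word
      w≡     : w ≡ prefix ++ u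
      p≡     : p ≡ suc (length prefix)

  at-≡ : ∀ {p u u′} → u ≡ u′ → At p u → At p u′
  at-≡ refl a = a

  at-skip : ∀ {p} u {v} → At p (u ++ v) → At (p + length u) v
  at-skip u {v} (at pre w≡ p≡) = at (pre ++ u) (trans w≡ (≡-sym (++-assoc pre u v)))
    (trans (cong (_+ length u) p≡) (cong suc (≡-sym (length-++ pre))))

  at-end : ∀ {p u} → At p u → p + length u ≡ end
  at-end {_} {u} (at pre w≡ p≡) = trans (cong (_+ length u) p≡) (cong suc (trans (≡-sym (length-++ pre)) (cong length (≡-sym w≡))))

  scan-++ : ∀ (pre : Word) a u → scan (pre ++ a ∷ u) (suc (length pre)) ≡ sym a
  scan-++ []            a u = refl
  scan-++ (_ ∷ [])      a u = refl
  scan-++ (_ ∷ b ∷ pre) a u = scan-++ (b ∷ pre) a u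

  at-scan : ∀ {p a u} → At p (a ∷ u) → scan w p ≡ sym a
  at-scan {_} {a} {u} (at pre w≡ p≡) = trans (cong₂ scan w≡ p≡) (scan-++ pre a u)

  at-next : ∀ {p a u} → At p (a ∷ u) → At (succ p) u
  at-next {p} {a} {u} A = subst (λ q → At q u) (trans (+-comm p 1) (≡-sym (if-false (cong isEnd (at-scan A))))) (at-skip [ a ] A)

  after-digits : ∀ b n {q u} → length (digits b) ≤ n → At q (digits b ++ 2F ∷ u) → At (iterate adv q n) (2F ∷ u)
  after-digits ℕᵇ.zero zero le A = A
  after-digits ℕᵇ.zero (suc n) {q} {u} le A =
    after-digits ℕᵇ.zero n z≤n (subst (λ z → At z (2F ∷ u)) (≡-sym (if-false (cong isDigit (at-scan A)))) A)
  after-digits 2[1+ b ] (suc n) {q} {u} (s≤s le) A =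
    after-digits b n le (subst (λ z → At z (digits b ++ 2F ∷ u)) (≡-sym (if-true (cong isDigit (at-scan A)))) (at-next A))
  after-digits 1+[2 b ] (suc n) {q} {u} (s≤s le) A =
    after-digits b n le (subst (λ z → At z (digits b ++ 2F ∷ u)) (≡-sym (if-true (cong isDigit (at-scan A)))) (at-next A))

  digits-short : ∀ b {q u} → At q (digits b ++ 2F ∷ u) → length (digits b) ≤ end
  digits-short b {q} {u} A = subst (length (digits b) ≤_) (at-end A)
    (≤-trans (subst (length (digits b) ≤_) (≡-sym (length-++ (digits b))) (m≤m+n _ _)) (m≤n+m _ q))

  after-number : ∀ b {q u} → At q (digits b ++ 2F ∷ u) → At (after q) u
  after-number b {q} {u} A =
    at-next (subst (λ z → At z (2F ∷ u)) (≡-sym (eval-ptr q end)) (after-digits b end (digits-short b A) A))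

  digitOf : InputCell 4 → ℕ
  digitOf c = choose (bit (isTwo c)) (bit (isOne c)) 2

  W-digits : ∀ b n {q u} → length (digits b) ≤ n → At q (digits b ++ 2F ∷ u) → W q n ≡ ℕᵇ.toℕ b
  W-digits ℕᵇ.zero n {q} le A = W-stuck n q (cong digitOf (at-scan A))
  W-digits 2[1+ b ] (suc n) {q} {u} (s≤s le) A = trans
    (cong₂ (λ d v → d + 2 * v) (cong digitOf (at-scan A)) (trans (cong (λ z → W z n) (if-true (cong isDigit
        (at-scan A)))) (W-digits b n le (at-next A))))
    (≡-sym (*-suc 2 (ℕᵇ.toℕ b)))
  W-digits 1+[2 b ] (suc n) {q} {u} (s≤s le) A =
    cong₂ (λ d v → d + 2 * v) (cong digitOf (at-scan A)) (trans (cong (λ z → W z n) (if-true (cong isDigit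
        (at-scan A)))) (W-digits b n le (at-next A)))

  num-digits : ∀ b {q u} → At q (digits b ++ 2F ∷ u) → num q ≡ ℕᵇ.toℕ b
  num-digits b A = W-digits b end (digits-short b A) A

  encodeℕ-++ : ∀ n u → encodeℕ n ++ u ≡ digits (ℕᵇ.fromℕ n) ++ 2F ∷ u
  encodeℕ-++ n u = ++-assoc (digits (ℕᵇ.fromℕ n)) [ 2F ] u

  after-encodeℕ : ∀ n {q u} → At q (encodeℕ n ++ u) → At (after q) u
  after-encodeℕ n A = after-number (ℕᵇ.fromℕ n) (at-≡ (encodeℕ-++ n _) A)

  num-encodeℕ : ∀ n {q u} → At q (encodeℕ n ++ u) → num q ≡ n
  num-encodeℕ n A = trans (num-digits (ℕᵇ.fromℕ n) (at-≡ (encodeℕ-++ n _) A)) (ℕᵇₚ.toℕ-fromℕ n)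

  reads : ∀ {p a u} (P : InputCell 4 → Bool) → At p (a ∷ u) → True (bit (P (scan w p))) ⇔ P (sym a) ≡ true
  reads P A = mk⇔ (λ t → trans (≡-sym (cong P (at-scan A))) (to true-bit t)) (λ e → from true-bit (trans (cong P (at-scan A)) e))

  true-numeral : ∀ b b′ {q u} → At q (digits b ++ 2F ∷ u) → True (eval (numeralT b′) (q ∷ [])) ⇔ b ≡ b′
  true-numeral b b′ A = mk⇔ (λ t → forth b b′ A t) λ { refl → back b A }
    where
    forth : ∀ b b′ {q u} → At q (digits b ++ 2F ∷ u) → True (eval (numeralT b′) (q ∷ [])) → b ≡ b′
    forth ℕᵇ.zero  ℕᵇ.zero   A t = refl
    forth ℕᵇ.zero  2[1+ b′ ] A t with () ← to (reads isTwo A) (proj₁ (to (true-∧ _) t))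
    forth ℕᵇ.zero  1+[2 b′ ] A t with () ← to (reads isOne A) (proj₁ (to (true-∧ _) t))
    forth 2[1+ b ] ℕᵇ.zero   A t with () ← to (reads isSep A) t
    forth 2[1+ b ] 2[1+ b′ ] A t = cong 2[1+_] (forth b b′ (at-next A) (proj₂ (to (true-∧ _) t)))
    forth 2[1+ b ] 1+[2 b′ ] A t with () ← to (reads isOne A) (proj₁ (to (true-∧ _) t))
    forth 1+[2 b ] ℕᵇ.zero   A t with () ← to (reads isSep A) t
    forth 1+[2 b ] 2[1+ b′ ] A t with () ← to (reads isTwo A) (proj₁ (to (true-∧ _) t))
    forth 1+[2 b ] 1+[2 b′ ] A t = cong 1+[2_] (forth b b′ (at-next A) (proj₂ (to (true-∧ _) t)))
    back : ∀ b {q u} → At q (digits b ++ 2F ∷ u) → True (eval (numeralT b) (q ∷ []))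
    back ℕᵇ.zero  A = from (reads isSep A) refl
    back 2[1+ b ] A = from (true-∧ _) (from (reads isTwo A) refl , back b (at-next A))
    back 1+[2 b ] A = from (true-∧ _) (from (reads isOne A) refl , back b (at-next A))

  true-numeralℕ : ∀ n x {q u} → At q (encodeℕ n ++ u) → True (eval (numeralT (ℕᵇ.fromℕ x)) (q ∷ [])) ⇔ n ≡ x
  true-numeralℕ n x A = mk⇔
    (λ t → trans (≡-sym (ℕᵇₚ.toℕ-fromℕ n)) (trans (cong ℕᵇ.toℕ (to (true-numeral (ℕᵇ.fromℕ n) (ℕᵇ.fromℕ x) (at-≡
        (encodeℕ-++ n _) A)) t)) (ℕᵇₚ.toℕ-fromℕ x)))
    λ { refl → from (true-numeral (ℕᵇ.fromℕ n) (ℕᵇ.fromℕ n) (at-≡ (encodeℕ-++ n _) A)) refl }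

  encodeℕs : List ℕ → Word
  encodeℕs = concatMap encodeℕ

  nth-encodeℕs : ∀ ns j {p u} → At p (encodeℕs ns ++ u) → j ≤ length ns → At (nth p j) (encodeℕs (drop j ns) ++ u)
  nth-encodeℕs ns zero A le = A
  nth-encodeℕs (n ∷ ns) (suc j) {p} {u} A (s≤s le) = nth-encodeℕs ns j (after-encodeℕ n (at-≡ (++-assoc (encodeℕ n)
      (encodeℕs ns) u) A)) le

  nth-lookup : ∀ ns (i : Fin (length ns)) {p u} → At p (encodeℕs ns ++ u) → ∃[ v ] At (nth p (toℕ i)) (encodeℕ (List.lookup ns i) ++ v)
  nth-lookup ns i {p} {u} A = split ns i (nth-encodeℕs ns (toℕ i) A (toℕ≤n i))
    where
    split : ∀ ns (i : Fin (length ns)) → At (nth p (toℕ i)) (encodeℕs (drop (toℕ i) ns) ++ u) →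
            ∃[ v ] At (nth p (toℕ i)) (encodeℕ (List.lookup ns i) ++ v)
    split ns i A′ = _ , at-≡ (trans (cong (λ ms → encodeℕs ms ++ u) (drop-lookup ns i)) (++-assoc (encodeℕ (List.lookup ns i)) _ u)) A′
      where
      drop-lookup : ∀ (ns : List ℕ) i → drop (toℕ i) ns ≡ List.lookup ns i ∷ drop (suc (toℕ i)) ns
      drop-lookup (n ∷ ns) 0F          = refl
      drop-lookup (n ∷ ns) (Fin.suc i) = drop-lookup ns i

  stop-number : ∀ n {q u} → At q (encodeℕ n ++ u) → isStop (scan w q) ≡ false
  stop-number n {q} {u} A = go (ℕᵇ.fromℕ n) (at-≡ (encodeℕ-++ n u) A)
    where
    go : ∀ b → At q (digits b ++ 2F ∷ u) → isStop (scan w q) ≡ false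
    go ℕᵇ.zero  A = cong isStop (at-scan A)
    go 2[1+ b ] A = cong isStop (at-scan A)
    go 1+[2 b ] A = cong isStop (at-scan A)

  length-encodeℕs : ∀ ns → length ns ≤ length (encodeℕs ns)
  length-encodeℕs []       = z≤n
  length-encodeℕs (n ∷ ns) = subst (suc (length ns) ≤_) (≡-sym (length-++ (encodeℕ n)))
    (+-mono-≤ (subst (1 ≤_) (≡-sym (length-++ (digits (ℕᵇ.fromℕ n)))) (m≤n+m 1 _)) (length-encodeℕs ns))

  encodeList-++ : ∀ ns u → encodeList ns ++ u ≡ encodeℕs ns ++ 3F ∷ u
  encodeList-++ ns u = ++-assoc (encodeℕs ns) [ 3F ] u

  length<end : ∀ ns {p u} → At p (encodeList ns ++ u) → length ns < end
  length<end ns {p} {u} A = subst (length ns <_) (at-end A′) (≤-trans (s≤s (length-encodeℕs ns))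
    (≤-trans (subst (suc (length (encodeℕs ns)) ≤_) (≡-sym (length-++ (encodeℕs ns)))
      (≤-trans (≤-reflexive (+-comm 1 _)) (+-monoʳ-≤ (length (encodeℕs ns)) (s≤s z≤n)))) (m≤n+m _ p)))
    where
    A′ : At p (encodeℕs ns ++ 3F ∷ u)
    A′ = at-≡ (encodeList-++ ns u) A

  eval-len : ∀ ns {p u} → At p (encodeList ns ++ u) → eval lenT (p ∷ []) ≡ length ns
  eval-len ns {p} {u} A = least-unique (least-spec (is isStop (call nthT (var 1F ∷ var 0F ∷ []))) (p ∷ []))
    (length ns) (length<end ns A)
    (from true-bit (cong isStop (at-scan (at-≡ (cong (λ ms → encodeℕs ms ++ 3F ∷ u) (drop-all
        (length ns) ns ≤-refl)) (nth-encodeℕs ns (length ns) A′ ≤-refl)))))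
    λ c c< t → not-stop (stop-number (List.lookup ns (fromℕ< c<)) (proj₂ (nth-lookup ns (fromℕ< c<) A′))) (subst
        (λ j → isStop (scan w (nth p j)) ≡ true) (≡-sym (toℕ-fromℕ< c<)) (to true-bit t))
    where
    A′ : At p (encodeℕs ns ++ 3F ∷ u)
    A′ = at-≡ (encodeList-++ ns u) A
    not-stop : ∀ {b} → b ≡ false → b ≡ true → ⊥
    not-stop refl ()

-- The graph of a team

opaque
  -- The domain list and every row end with the letter `3F`, so a row starts exactly behind a stop
  -- that is not the last letter.
  rowT : Tm 4 1
  rowT = is isStop (prev (var 0F)) ∧′ not′ (is isEnd (var 0F))

module RowStarts (w : Word) where
  open TermSemantics w

  Row : ℕ → Set
  Row p = True (eval rowT (p ∷ []))

  opaque
    unfolding rowT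
    true-row : ∀ p → Row p ⇔ (isStop (scan w (pred p)) ≡ true × isEnd (scan w p) ≢ true)
    true-row p = mk⇔
      (λ r → let a , b = to (true-∧ (bit (isStop (scan w (pred p))))) r in to true-bit a , to (true-not _) b ∘ from true-bit)
      (λ (a , b) → from (true-∧ (bit (isStop (scan w (pred p))))) (from true-bit a , from (true-not _) (b ∘ to true-bit)))

  row-bound : ∀ {p} → Row p → p < end
  row-bound {p} r = ≰⇒> λ le → proj₂ (to (true-row p) r) (cong isEnd (Correctness.scan-end w w p le))

-- Terms for the graph, the walk and the autarky test

module Terms (x y : ℕ) where

  -- Side `true` is the x-end: edges owned there form the part satisfying `dep x y`, as each x-value
  -- then has a single edge.
  column : Bool → ℕ
  column true  = x
  column false = y

  codeT : ∀ {m} → Bool → Tm 4 m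
  codeT true  = lit 1F
  codeT false = lit 2F

  opaque
    cellT : Bool → Tm 4 1
    cellT s = call nthT (var 0F ∷ call (colT (column s)) [] ∷ [])

  opaque
    sameT : Bool → Tm 4 2
    sameT s = not′ (call cmpT (call (cellT s) (var 0F ∷ []) ∷ call (cellT s) (var 1F ∷ []) ∷ []))

  opaque
    smallerT : Tm 4 2
    smallerT = lt (var 0F) (var 1F) ∧′ call rowT (var 0F ∷ []) ∧′
      call (sameT true) (var 0F ∷ var 1F ∷ []) ∧′ call (sameT false) (var 0F ∷ var 1F ∷ [])

  -- Of the rows with equal cells in both columns, the first one represents an edge.

  opaque
    edgeT : Tm 4 1
    edgeT = call rowT (var 0F ∷ []) ∧′ all′ (not′ (call smallerT (var 0F ∷ var 1F ∷ [])))

  opaque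
    memberT : Bool → Tm 4 3
    memberT s = call edgeT (var 0F ∷ []) ∧′ call (sameT s) (var 0F ∷ var 2F ∷ []) ∧′ not′ (eq (var 0F) (var 1F))

  opaque
    laterT : Bool → Tm 4 2
    laterT s = least (lt (var 2F) (var 0F) ∧′ call (memberT s) (var 0F ∷ var 1F ∷ var 2F ∷ []))

  opaque
    earliestT : Bool → Tm 4 2
    earliestT s = least (memberT s)

  opaque
    nxT : Bool → Tm 4 2
    nxT s = ifz (lt (call (laterT s) (var 0F ∷ var 1F ∷ [])) top) (call (earliestT s) (var 0F ∷ var 1F ∷ []))
              (call (laterT s) (var 0F ∷ var 1F ∷ []))

  opaque
    turnT : Bool → Tm 4 2
    turnT s = ifz (eq (var 1F) (var 0F)) (call (nxT (not s)) (var 0F ∷ var 1F ∷ [])) (var 0F)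

  opaque
    seekT : Bool → Tm 4 3
    seekT s = ifz (eq (var 2F) (var 1F))
                (ifz (eq (call (nxT s) (top ∷ var 2F ∷ [])) (var 1F))
                  (call (turnT s) (var 0F ∷ call (nxT s) (top ∷ var 2F ∷ []) ∷ []))
                  (var 2F))
                (var 2F)

  opaque
    reportT : Bool → Tm 4 2
    reportT s = ifz (eq (var 1F) (var 0F))
                  (ifz (eq (call (nxT s) (top ∷ var 1F ∷ [])) (var 0F)) (lit 0F) (codeT (not s)))
                  (codeT s)

  opaque
    ownT : Bool → Tm 4 2
    ownT s = call (reportT s) (var 1F ∷ iter (var 0F) top (call (seekT s) (var 2F ∷ var 3F ∷ var 1F ∷ [])) ∷ [])

  opaque
    violatedT : Bool → Bool → Tm 4 3
    violatedT s σ = call edgeT (var 1F ∷ []) ∧′ call edgeT (var 0F ∷ []) ∧′ not′ (eq (var 1F) (var 0F)) ∧′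
      eq (call (ownT s) (var 2F ∷ var 1F ∷ [])) (codeT σ) ∧′ call (sameT σ) (var 1F ∷ var 0F ∷ []) ∧′
      not′ (eq (call (ownT s) (var 2F ∷ var 0F ∷ [])) (codeT (not σ)))

  opaque
    autarkyT : Bool → Tm 4 1
    autarkyT s = all′ (all′ (not′ (violatedT s true) ∧′ not′ (violatedT s false)))

  opaque
    graphT : Tm 4 0
    graphT = all′ (not′ edgeT ∨′ autarkyT true ∨′ autarkyT false)

  -- Meaning of the graph terms

  module Graph (w : Word) where
    open Numbers w public

    open RowStarts w public

    E : ℕ → Set
    E p = True (eval edgeT (p ∷ []))

    key : Bool → ℕ → ℕ
    key s p = num (eval (cellT s) (p ∷ []))

    opaque
      unfolding cellT
      key-cell : ∀ s p → key s p ≡ num (nth p (eval (colT (column s)) []))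
      key-cell s p = refl

    nx : Bool → ℕ → ℕ → ℕ
    nx s e p = eval (nxT s) (e ∷ p ∷ [])

    opaque
      unfolding sameT
      true-sameT : ∀ s p q → True (eval (sameT s) (p ∷ q ∷ [])) ⇔ key s p ≡ key s q
      true-sameT s p q = mk⇔
        (λ t → to (true-same (eval (cellT s) (p ∷ [])) (eval (cellT s) (q ∷ []))) (to (true-not _) t))
        (λ e → from (true-not _) (from (true-same (eval (cellT s) (p ∷ [])) (eval (cellT s) (q ∷ []))) e))

    Smaller : ℕ → ℕ → Set
    Smaller p c = c < p × Row c × key true c ≡ key true p × key false c ≡ key false p

    opaque
      unfolding smallerT
      true-smaller : ∀ c p → True (eval smallerT (c ∷ p ∷ [])) ⇔ Smaller p c
      true-smaller c p = mk⇔
        (λ t → let a , t₁ = to (true-∧ _) t ; b , t₂ = to (true-∧ _) t₁ ; c₁ , c₂ = to (true-∧ _) t₂ in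
          to (true-lt (var 0F) (var 1F) (c ∷ p ∷ [])) a , b , to (true-sameT true c p) c₁ , to (true-sameT false c p) c₂)
        (λ (a , b , c₁ , c₂) → from (true-∧ _) (from (true-lt (var 0F) (var 1F) (c ∷ p ∷ [])) a ,
          from (true-∧ _) (b , from (true-∧ _) (from (true-sameT true c p) c₁ , from (true-sameT false c p) c₂))))

    opaque
      unfolding edgeT
      edge-spec : ∀ p → E p ⇔ (Row p × (∀ c → ¬ Smaller p c))
      edge-spec p = mk⇔ forth back
        where
        forth : E p → Row p × (∀ c → ¬ Smaller p c)
        forth t with to (true-∧ _) t
        ... | r , a = r , λ c s → to (true-not _) (to (true-all (not′ (call smallerT (var 0F ∷ var 1F ∷ [])))
            (p ∷ [])) a c (row-bound (proj₁ (proj₂ s)))) (from (true-smaller c p) s)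
        back : Row p × (∀ c → ¬ Smaller p c) → E p
        back (r , n) = from (true-∧ _) (r , from (true-all (not′ (call smallerT (var 0F ∷ var 1F ∷ [])))
            (p ∷ [])) λ c _ → from (true-not _) λ t → n c (to (true-smaller c p) t))

    E? : ∀ p → Dec (E p)
    E? p = true? _

    edge-row : ∀ {p} → E p → Row p
    edge-row {p} Ep = proj₁ (to (edge-spec p) Ep)

    E<end : ∀ {p} → E p → p < end
    E<end Ep = row-bound (edge-row Ep)

    Member : Bool → ℕ → ℕ → ℕ → Set
    Member s e p c = E c × key s c ≡ key s p × c ≢ e

    opaque
      unfolding memberT
      true-member : ∀ s e p c → True (eval (memberT s) (c ∷ e ∷ p ∷ [])) ⇔ Member s e p c
      true-member s e p c = mk⇔
        (λ t → let a , t₁ = to (true-∧ _) t ; b , d = to (true-∧ _) t₁ in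
          a , to (true-sameT s c p) b , λ c≡e → to (true-not _) d (from (true-eq (var 0F) (var 1F) (c ∷ e ∷ p ∷ [])) c≡e))
        (λ (a , b , d) → from (true-∧ _) (a , from (true-∧ _) (from (true-sameT s c p) b ,
          from (true-not _) λ t → d (to (true-eq (var 0F) (var 1F) (c ∷ e ∷ p ∷ [])) t))))

    opaque
      unfolding laterT
      later-least : ∀ s e p → Least end (λ c → p < c × Member s e p c) (eval (laterT s) (e ∷ p ∷ []))
      later-least s e p = least-at
        (λ c c<e c<r (p<c , m) → L.below c c<e c<r (from (true-∧ _) (from (true-lt (var 2F) (var 0F)
            (c ∷ e ∷ p ∷ [])) p<c , from (true-member s e p c) m)))
        (λ r<e → let a , b = to (true-∧ _) (L.found r<e) in
          to (true-lt (var 2F) (var 0F) (eval (laterT s) (e ∷ p ∷ []) ∷ e ∷ p ∷ [])) a , to (true-member s e p _) b)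
        L.bound
        where
        module L = Least (least-spec (lt (var 2F) (var 0F) ∧′ call (memberT s) (var 0F ∷ var 1F ∷ var 2F ∷ [])) (e ∷ p ∷ []))

    opaque
      unfolding earliestT
      earliest-least : ∀ s e p → Least end (Member s e p) (eval (earliestT s) (e ∷ p ∷ []))
      earliest-least s e p = least-at (λ c c<e c<r → L.below c c<e c<r ∘ from (true-member s e p c))
        (λ r<e → to (true-member s e p _) (L.found r<e)) L.bound
        where
        module L = Least (least-spec (memberT s) (e ∷ p ∷ []))

    opaque
      unfolding nxT
      nx-next : ∀ s e {p} → E p → p ≢ e → Next (Member s e p) p (nx s e p)
      nx-next s e {p} Ep p≢e = go (true? (eval (lt (call (laterT s) (var 0F ∷ var 1F ∷ [])) top) (e ∷ p ∷ [])))
        where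
        r₁ r₂ : ℕ
        r₁ = eval (laterT s) (e ∷ p ∷ [])
        r₂ = eval (earliestT s) (e ∷ p ∷ [])
        module L₁ = Least (later-least s e p)
        module L₂ = Least (earliest-least s e p)
        r₁<end : True (eval (lt (call (laterT s) (var 0F ∷ var 1F ∷ [])) top) (e ∷ p ∷ [])) ⇔ r₁ < end
        r₁<end = true-lt (call (laterT s) (var 0F ∷ var 1F ∷ [])) top (e ∷ p ∷ [])
        choose-true : ∀ {n a b} → True n → choose n a b ≡ b
        choose-true {zero}  t = ⊥-elim (t refl)
        choose-true {suc n} t = refl
        choose-false : ∀ {n a b} → ¬ True n → choose n a b ≡ a
        choose-false {zero}  f = refl
        choose-false {suc n} f = ⊥-elim (f λ ())
        go : Dec (True (eval (lt (call (laterT s) (var 0F ∷ var 1F ∷ [])) top) (e ∷ p ∷ []))) → Next (Member s e p) p (nx s e p)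
        go (yes t) = subst (Next (Member s e p) p) (≡-sym (choose-true t)) (proj₂ found , inj₁ (proj₁ found , below))
          where
          found : p < r₁ × Member s e p r₁
          found = L₁.found (to r₁<end t)
          below : ∀ c → Member s e p c → p < c → r₁ ≤ c
          below c Mc p<c = ≮⇒≥ λ c<r → L₁.below c (E<end (proj₁ Mc)) c<r (p<c , Mc)
        go (no f) = subst (Next (Member s e p) p) (≡-sym (choose-false f)) (L₂.found r₂<end , inj₂ (last , below))
          where
          last : ∀ c → Member s e p c → c ≤ p
          last c Mc = ≮⇒≥ λ p<c → L₁.below c (E<end (proj₁ Mc)) (<-≤-trans (E<end (proj₁ Mc)) (≮⇒≥ (f ∘ from r₁<end))) (p<c , Mc)
          below : ∀ c → Member s e p c → r₂ ≤ c
          below c Mc = ≮⇒≥ λ c<r → L₂.below c (E<end (proj₁ Mc)) c<r Mc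
          -- The search succeeds because `p` itself is a member.
          r₂<end : r₂ < end
          r₂<end = ≤-<-trans (below p (Ep , refl , p≢e)) (E<end Ep)

    -- All edges lie below `end`, so it can play the part of the absent edge `N`; the terms write it
    -- as `top`.
    open Walk end nx

    label : Maybe Bool → ℕ
    label nothing      = 0
    label (just true)  = 1
    label (just false) = 2

    label-injective : ∀ {a b} → label a ≡ label b → a ≡ b
    label-injective {nothing}    {nothing}    e = refl
    label-injective {just true}  {just true}  e = refl
    label-injective {just false} {just false} e = refl
    label-injective {nothing}    {just true}  ()
    label-injective {nothing}    {just false} ()
    label-injective {just true}  {nothing}    ()
    label-injective {just true}  {just false} ()
    label-injective {just false} {nothing}    ()
    label-injective {just false} {just true}  ()

    eval-label : ∀ {m} s (vs : Vec ℕ m) → eval (codeT s) vs ≡ label (just s)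
    eval-label true  vs = refl
    eval-label false vs = refl

    choose-bit : ∀ b {m n : ℕ} → choose (bit b) m n ≡ (if b then n else m)
    choose-bit true  = refl
    choose-bit false = refl

    eval-if : ∀ {m} (a b c d : Tm 4 m) vs →
              eval (ifz (eq a b) c d) vs ≡ (if eval a vs ≡ᵇ eval b vs then eval d vs else eval c vs)
    eval-if a b c d vs = trans (cong (λ n → choose n (eval c vs) (eval d vs)) (eval-eq a b vs)) (choose-bit (eval a vs ≡ᵇ eval b vs))

    if-cong : ∀ b {m m′ n : ℕ} → m ≡ m′ → (if b then n else m) ≡ (if b then n else m′)
    if-cong b refl = refl

    opaque
      unfolding turnT
      eval-turn : ∀ s e b → eval (turnT s) (e ∷ b ∷ []) ≡ turn s e b
      eval-turn s e b = eval-if (var 1F) (var 0F) (call (nxT (not s)) (var 0F ∷ var 1F ∷ [])) (var 0F) (e ∷ b ∷ [])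

    opaque
      unfolding seekT
      eval-seek : ∀ s e z a → eval (seekT s) (e ∷ z ∷ a ∷ []) ≡ seek s e z a
      eval-seek s e z a = trans
        (eval-if (var 2F) (var 1F) (ifz (eq (call (nxT s) (top ∷ var 2F ∷ [])) (var 1F)) moved (var 2F)) (var 2F) (e ∷ z ∷ a ∷ []))
        (if-cong (a ≡ᵇ z) (trans (eval-if (call (nxT s) (top ∷ var 2F ∷ [])) (var 1F) moved (var 2F) (e ∷ z ∷ a ∷ []))
          (if-cong (nx s end a ≡ᵇ z) (eval-turn s e (nx s end a)))))
        where
        moved : Tm 4 3
        moved = call (turnT s) (var 0F ∷ call (nxT s) (top ∷ var 2F ∷ []) ∷ [])

    opaque
      unfolding reportT
      eval-report : ∀ s z a → eval (reportT s) (z ∷ a ∷ []) ≡ label (report s z a)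
      eval-report s z a = trans (eval-if (var 1F) (var 0F) rest (codeT s) (z ∷ a ∷ [])) (go (a ≡ᵇ z))
        where
        rest : Tm 4 2
        rest = ifz (eq (call (nxT s) (top ∷ var 1F ∷ [])) (var 0F)) (lit 0F) (codeT (not s))
        go′ : ∀ b → (if b then eval (codeT (not s)) (z ∷ a ∷ []) else 0) ≡ label (if b then just (not s) else nothing)
        go′ true  = eval-label (not s) (z ∷ a ∷ [])
        go′ false = refl
        go : ∀ b → (if b then eval (codeT s) (z ∷ a ∷ []) else eval rest (z ∷ a ∷ []))
               ≡ label (if b then just s else if nx s end a ≡ᵇ z then just (not s) else nothing)
        go true  = eval-label s (z ∷ a ∷ [])
        go false = trans (eval-if (call (nxT s) (top ∷ var 1F ∷ [])) (var 0F) (lit 0F) (codeT (not s)) (z ∷ a ∷ []))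
                         (go′ (nx s end a ≡ᵇ z))

    opaque
      unfolding ownT
      eval-own : ∀ s e z → eval (ownT s) (e ∷ z ∷ []) ≡ label (own s e z)
      eval-own s e z = trans (cong (λ a → eval (reportT s) (z ∷ a ∷ []))
          (trans (loop-cong (λ _ a → eval-seek s e z a) end e) (loop-const (seek s e z) end e)))
        (eval-report s z (iterate (seek s e z) e end))

    true-own : ∀ {m} (f : Tm 4 m) vs s σ e z → eval f vs ≡ eval (ownT s) (e ∷ z ∷ []) →
               True (eval (eq f (codeT σ)) vs) ⇔ own s e z ≡ just σ
    true-own f vs s σ e z ef = mk⇔
      (λ t → label-injective (trans (≡-sym (trans ef (eval-own s e z))) (trans (to (true-eq f (codeT σ) vs) t) (eval-label σ vs))))
      (λ o → from (true-eq f (codeT σ) vs) (trans ef (trans (eval-own s e z) (trans (cong label o) (≡-sym (eval-label σ vs))))))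

    Violated : Bool → ℕ → Bool → ℕ → ℕ → Set
    Violated s e σ p q = E p × E q × p ≢ q × own s e p ≡ just σ × key σ p ≡ key σ q × own s e q ≢ just (not σ)

    opaque
      unfolding violatedT
      true-violated : ∀ s e σ p q → True (eval (violatedT s σ) (q ∷ p ∷ e ∷ [])) ⇔ Violated s e σ p q
      true-violated s e σ p q = mk⇔
        (λ t → let a , t₁ = to (true-∧ _) t ; b , t₂ = to (true-∧ _) t₁ ; c , t₃ = to (true-∧ _) t₂
                   d , t₄ = to (true-∧ _) t₃ ; f , g = to (true-∧ _) t₄ in
          a , b , to (true-not _) c ∘ from (true-eq (var 1F) (var 0F) vs) , to owns-p d , to (true-sameT σ p q) f ,
          to (true-not _) g ∘ from owns-q)
        (λ (a , b , c , d , f , g) → from (true-∧ _) (a , from (true-∧ _) (b , from (true-∧ _)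
          (from (true-not _) (c ∘ to (true-eq (var 1F) (var 0F) vs)) , from (true-∧ _) (from owns-p d ,
            from (true-∧ _) (from (true-sameT σ p q) f , from (true-not _) (g ∘ to owns-q)))))))
        where
        vs : Vec ℕ 3
        vs = q ∷ p ∷ e ∷ []
        owns-p : True (eval (eq (call (ownT s) (var 2F ∷ var 1F ∷ [])) (codeT σ)) vs) ⇔ own s e p ≡ just σ
        owns-p = true-own (call (ownT s) (var 2F ∷ var 1F ∷ [])) vs s σ e p refl
        owns-q : True (eval (eq (call (ownT s) (var 2F ∷ var 0F ∷ [])) (codeT (not σ))) vs) ⇔ own s e q ≡ just (not σ)
        owns-q = true-own (call (ownT s) (var 2F ∷ var 0F ∷ [])) vs s (not σ) e q refl

    opaque
      unfolding autarkyT
      true-autarky : ∀ s e → True (eval (autarkyT s) (e ∷ [])) ⇔ Autarky E key (own s e)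
      true-autarky s e = mk⇔ forth back
        where
        clause : Tm 4 3
        clause = not′ (violatedT s true) ∧′ not′ (violatedT s false)
        fine : ∀ p q → True (eval clause (q ∷ p ∷ e ∷ [])) ⇔ (∀ σ → ¬ Violated s e σ p q)
        fine p q = mk⇔
          (λ t → let a , b = to (true-∧ _) t in
            λ { true → to (true-not _) a ∘ from (true-violated s e true p q)
              ; false → to (true-not _) b ∘ from (true-violated s e false p q) })
          (λ f → from (true-∧ _) (from (true-not _) (f true ∘ to (true-violated s e true p q)) ,
            from (true-not _) (f false ∘ to (true-violated s e false p q))))
        forth : True (eval (autarkyT s) (e ∷ [])) → Autarky E key (own s e)
        forth t {p} {q} {σ} Ep Eq p≢q o k = decidable-stable (Maybeₚ.≡-dec _≟ᵇ_ _ _) λ ne →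
          to (fine p q) (to (true-all clause (p ∷ e ∷ [])) (to (true-all (all′ clause) (e ∷ [])) t p (E<end Ep)) q (E<end Eq))
            σ (Ep , Eq , p≢q , o , k , ne)
        back : Autarky E key (own s e) → True (eval (autarkyT s) (e ∷ []))
        back A = from (true-all (all′ clause) (e ∷ [])) λ p _ → from (true-all clause (p ∷ e ∷ [])) λ q _ →
          from (fine p q) λ σ (Ep , Eq , p≢q , o , k , ne) → ne (A Ep Eq p≢q o k)

    opaque
      unfolding graphT
      true-graph : True (eval graphT []) ⇔ (∃[ o ] Consistent E key o)
      true-graph = mk⇔ forth λ (o , c) → from (true-all body []) λ e _ → back o c e
        where
        body : Tm 4 1
        body = not′ edgeT ∨′ autarkyT true ∨′ autarkyT false
        select : ∀ {e} → Dec (True (eval (autarkyT true) (e ∷ []))) → Bool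
        select (yes _) = true
        select (no _)  = false
        side : ℕ → Bool
        side e = select (true? (eval (autarkyT true) (e ∷ [])))
        selected : ∀ {e} (d : Dec (True (eval (autarkyT true) (e ∷ [])))) →
          True (eval (autarkyT true) (e ∷ [])) ⊎ True (eval (autarkyT false) (e ∷ [])) →
          Autarky E key (own (select d) e)
        selected {e} (yes a) _        = to (true-autarky true e) a
        selected {e} (no ¬a) (inj₁ a) = ⊥-elim (¬a a)
        selected {e} (no _)  (inj₂ a) = to (true-autarky false e) a
        good : True (eval graphT []) → ∀ e → E e →
          True (eval (autarkyT true) (e ∷ [])) ⊎ True (eval (autarkyT false) (e ∷ []))
        good t e Ee with to (true-∨ _) (to (true-all body []) t e (E<end Ee))
        ... | inj₁ n = ⊥-elim (to (true-not _) n Ee)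
        ... | inj₂ b = to (true-∨ _) b
        forth : True (eval graphT []) → ∃[ o ] Consistent E key o
        forth t = autarkies⇒consistent E<end E? (λ e → own (side e) e)
          (λ {e} Ee → selected (true? (eval (autarkyT true) (e ∷ []))) (good t e Ee)) (λ {e} _ → own-self (side e) e)
        found : ∀ s e → Autarky E key (own s e) → True (eval body (e ∷ []))
        found true  e A = from (true-∨ (eval (not′ edgeT) (e ∷ []))) (inj₂ (from (true-∨ (eval (autarkyT true)
            (e ∷ []))) (inj₁ (from (true-autarky true e) A))))
        found false e A = from (true-∨ (eval (not′ edgeT) (e ∷ []))) (inj₂ (from (true-∨ (eval (autarkyT true)
            (e ∷ []))) (inj₂ (from (true-autarky false e) A))))
        back : ∀ o → Consistent E key o → ∀ e → True (eval body (e ∷ []))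
        back o c e with E? e
        ... | no ¬E  = from (true-∨ (eval (not′ edgeT) (e ∷ []))) (inj₁ (from (true-not _) ¬E))
        ... | yes Ee = found (o e) e (Completeness.own-autarky E<end (λ s x {p} → nx-next s x {p}) o c Ee)

-- The syntax of instances

encodeRows : List (List ℕ) → Word
encodeRows = concatMap encodeList

-- This is only the division into numbers and lists; distinctness of variables, row lengths and the
-- range of entries are tested separately.
record Layout (w : Word) : Set where
  constructor layout
  field
    size : ℕ
    dom  : List ℕ
    rows : List (List ℕ)
    w≡   : w ≡ encodeℕ size ++ encodeList dom ++ encodeRows rows

-- The words of the form above are characterised by their pairs of adjacent cells.

Adjacent : InputCell 4 → InputCell 4 → Set
Adjacent c c′ = (isStop c′ ≡ true → isSep c ≡ true ⊎ isStop c ≡ true) × (isEnd c′ ≡ true → isStop c ≡ true)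

Chain : InputCell 4 → Word → Set
Chain c []      = Adjacent c ⊣
Chain c (a ∷ w) = Adjacent c (sym a) × Chain (sym a) w

-- Nonterminals chosen by the preceding letter: `Numeral` follows the left end marker or a digit,
-- `Tail` a separator, `Rows` a stop.
Tail Numeral Rows : Word → Set
Tail u    = ∃[ ns ] ∃[ rs ] u ≡ concatMap encodeℕ ns ++ 3F ∷ encodeRows rs
Numeral u = ∃[ b ] ∃[ ns ] ∃[ rs ] u ≡ digits b ++ 2F ∷ concatMap encodeℕ ns ++ 3F ∷ encodeRows rs
Rows u    = ∃[ rs ] u ≡ encodeRows rs

-- Bijective numerals are unique, so any string of digits is the encoding of its value.
encode-toℕ : ∀ b u → encodeℕ (ℕᵇ.toℕ b) ++ u ≡ digits b ++ 2F ∷ u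
encode-toℕ b u = trans (++-assoc (digits (ℕᵇ.fromℕ (ℕᵇ.toℕ b))) [ 2F ] u)
  (cong (λ b → digits b ++ 2F ∷ u) (ℕᵇₚ.toℕ-injective (ℕᵇₚ.toℕ-fromℕ (ℕᵇ.toℕ b))))

cons-number : ∀ {u} → Numeral u → Tail u
cons-number (b , ns , rs , refl) = ℕᵇ.toℕ b ∷ ns , rs ,
  ≡-sym (trans (++-assoc (encodeℕ (ℕᵇ.toℕ b)) (concatMap encodeℕ ns) _) (encode-toℕ b _))

cons-row : ∀ {u} → Tail u → Rows u
cons-row (ns , rs , refl) = ns ∷ rs , ≡-sym (++-assoc (concatMap encodeℕ ns) [ 3F ] (encodeRows rs))

parse-numeral : ∀ c u → isSep c ≡ false → isStop c ≡ false → Chain c u → Numeral u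
parse-tail    : ∀ u → Chain (sym 2F) u → Tail u
parse-rows    : ∀ u → Chain (sym 3F) u → Rows u
parse-numeral c []       e₁ e₂ (_ , f) with () ← trans (≡-sym e₂) (f refl)
parse-numeral c (0F ∷ u) e₁ e₂ (_ , ch) with parse-numeral (sym 0F) u refl refl ch
... | b , ns , rs , eq = 1+[2 b ] , ns , rs , cong (0F ∷_) eq
parse-numeral c (1F ∷ u) e₁ e₂ (_ , ch) with parse-numeral (sym 1F) u refl refl ch
... | b , ns , rs , eq = 2[1+ b ] , ns , rs , cong (1F ∷_) eq
parse-numeral c (2F ∷ u) e₁ e₂ (_ , ch) with parse-tail u ch
... | ns , rs , eq = ℕᵇ.zero , ns , rs , cong (2F ∷_) eq
parse-numeral c (3F ∷ u) e₁ e₂ ((f , _) , _) with f refl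
... | inj₁ e with () ← trans (≡-sym e₁) e
... | inj₂ e with () ← trans (≡-sym e₂) e
parse-tail [] (_ , f) with () ← f refl
parse-tail (0F ∷ u) (_ , ch) with parse-numeral (sym 0F) u refl refl ch
... | b , ns , rs , eq = cons-number (1+[2 b ] , ns , rs , cong (0F ∷_) eq)
parse-tail (1F ∷ u) (_ , ch) with parse-numeral (sym 1F) u refl refl ch
... | b , ns , rs , eq = cons-number (2[1+ b ] , ns , rs , cong (1F ∷_) eq)
parse-tail (2F ∷ u) (_ , ch) with parse-tail u ch
... | ns , rs , eq = cons-number (ℕᵇ.zero , ns , rs , cong (2F ∷_) eq)
parse-tail (3F ∷ u) (_ , ch) with parse-rows u ch
... | rs , eq = [] , rs , cong (3F ∷_) eq
parse-rows []       ch = [] , refl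
parse-rows (0F ∷ u) (_ , ch) with parse-numeral (sym 0F) u refl refl ch
... | b , ns , rs , eq = cons-row (cons-number (1+[2 b ] , ns , rs , cong (0F ∷_) eq))
parse-rows (1F ∷ u) (_ , ch) with parse-numeral (sym 1F) u refl refl ch
... | b , ns , rs , eq = cons-row (cons-number (2[1+ b ] , ns , rs , cong (1F ∷_) eq))
parse-rows (2F ∷ u) (_ , ch) with parse-tail u ch
... | ns , rs , eq = cons-row (cons-number (ℕᵇ.zero , ns , rs , cong (2F ∷_) eq))
parse-rows (3F ∷ u) (_ , ch) with parse-rows u ch
... | rs , eq = cons-row ([] , rs , cong (3F ∷_) eq)

parse : ∀ w → Chain ⊢ w → Layout w
parse w ch with parse-numeral ⊢ w refl refl ch
... | b , ns , rs , refl = layout (ℕᵇ.toℕ b) ns rs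
  (≡-sym (trans (cong (encodeℕ (ℕᵇ.toℕ b) ++_) (++-assoc (concatMap encodeℕ ns) [ 3F ] (encodeRows rs))) (encode-toℕ b _)))

chain-numeral : ∀ c b u → Chain (sym 2F) u → Chain c (digits b ++ 2F ∷ u)
chain-numeral c ℕᵇ.zero  u ch = ((λ ()) , λ ()) , ch
chain-numeral c 2[1+ b ] u ch = ((λ ()) , λ ()) , chain-numeral (sym 1F) b u ch
chain-numeral c 1+[2 b ] u ch = ((λ ()) , λ ()) , chain-numeral (sym 0F) b u ch

chain-encodeℕ : ∀ c n u → Chain (sym 2F) u → Chain c (encodeℕ n ++ u)
chain-encodeℕ c n u ch = subst (Chain c) (≡-sym (++-assoc (digits (ℕᵇ.fromℕ n)) [ 2F ] u)) (chain-numeral c (ℕᵇ.fromℕ n) u ch)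

chain-list : ∀ c ns u → isSep c ≡ true ⊎ isStop c ≡ true → Chain (sym 3F) u → Chain c (encodeList ns ++ u)
chain-list c []       u e ch = ((λ _ → e) , λ ()) , ch
chain-list c (n ∷ ns) u e ch = subst (Chain c)
  (≡-sym (trans (cong (_++ u) (++-assoc (encodeℕ n) (concatMap encodeℕ ns) [ 3F ])) (++-assoc (encodeℕ n) (encodeList ns) u)))
  (chain-encodeℕ c n (encodeList ns ++ u) (chain-list (sym 2F) ns u (inj₁ refl) ch))

chain-rows : ∀ rs → Chain (sym 3F) (encodeRows rs)
chain-rows []       = (λ ()) , λ _ → refl
chain-rows (r ∷ rs) = chain-list (sym 3F) r (encodeRows rs) (inj₂ refl) (chain-rows rs)

layout-chain : ∀ {w} → Layout w → Chain ⊢ w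
layout-chain (layout size dom rows refl) =
  chain-encodeℕ ⊢ size _ (chain-list (sym 2F) dom (encodeRows rows) (inj₁ refl) (chain-rows rows))

-- The left neighbour `c` replaces the end marker, so that the induction can pass to suffixes.
scanFrom : InputCell 4 → Word → ℕ → InputCell 4
scanFrom c w zero    = c
scanFrom c w (suc p) = scan w (suc p)

scanFrom-∷ : ∀ a w p → scanFrom (sym a) w p ≡ scan (a ∷ w) (suc p)
scanFrom-∷ a w zero    = refl
scanFrom-∷ a w (suc p) = refl

chain-adjacent : ∀ c w → Chain c w → ∀ p → p ≤ length w → Adjacent (scanFrom c w p) (scan w (suc p))
chain-adjacent c []      ch        zero    le = ch
chain-adjacent c (a ∷ w) (adj , _) zero    le = adj
chain-adjacent c (a ∷ w) (_ , ch)  (suc p) (s≤s le) =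
  subst (λ c′ → Adjacent c′ (scan w (suc p))) (scanFrom-∷ a w p) (chain-adjacent (sym a) w ch p le)

adjacent-chain : ∀ c w → (∀ p → p ≤ length w → Adjacent (scanFrom c w p) (scan w (suc p))) → Chain c w
adjacent-chain c []      f = f 0 z≤n
adjacent-chain c (a ∷ w) f = f 0 z≤n , adjacent-chain (sym a) w λ p le →
  subst (λ c′ → Adjacent c′ (scan w (suc p))) (≡-sym (scanFrom-∷ a w p)) (f (suc p) (s≤s le))

opaque
  syntaxT : Tm 4 0
  syntaxT = all′ ((not′ (is isStop (next (var 0F))) ∨′ is isSep (var 0F) ∨′ is isStop (var 0F)) ∧′
                  (not′ (is isEnd (next (var 0F))) ∨′ is isStop (var 0F)))

module Syntax (w : Word) where
  open TermSemantics w

  opaque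
    unfolding syntaxT
    true-syntax : True (eval syntaxT []) ⇔ Layout w
    true-syntax = mk⇔
      (λ t → parse w (adjacent-chain ⊢ w λ p le → subst (λ c → Adjacent c (scan w (suc p))) (≡-sym (scanFrom-⊢ p))
        (subst (λ q → Adjacent (scan w p) (scan w q)) (succ≡ p le) (to (adjacent p) (to (true-all body []) t p (s≤s le))))))
      (λ L → from (true-all body []) λ p lt → from (adjacent p)
        (subst (λ q → Adjacent (scan w p) (scan w q)) (≡-sym (succ≡ p (s≤s⁻¹ lt)))
          (subst (λ c → Adjacent c (scan w (suc p))) (scanFrom-⊢ p) (chain-adjacent ⊢ w (layout-chain L) p (s≤s⁻¹ lt)))))
      where
      body : Tm 4 1
      body = (not′ (is isStop (next (var 0F))) ∨′ is isSep (var 0F) ∨′ is isStop (var 0F)) ∧′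
             (not′ (is isEnd (next (var 0F))) ∨′ is isStop (var 0F))
      scanFrom-⊢ : ∀ p → scanFrom ⊢ w p ≡ scan w p
      scanFrom-⊢ zero    = refl
      scanFrom-⊢ (suc p) = refl
      succ≡ : ∀ p → p ≤ length w → succ p ≡ suc p
      succ≡ p le = cong (λ b → if b then p else suc p) (Correctness.isEnd-scan w w p le)
      implies : ∀ a {b} {P : Set} → (True b ⇔ P) → True (choose (choose (bit a) 1 0) b 1) ⇔ (a ≡ true → P)
      implies true  e = mk⇔ (λ t _ → to e t) (λ f → from e (f refl))
      implies false e = mk⇔ (λ _ ()) (λ _ ())
      either : ∀ a b → True (choose (bit a) (bit b) 1) ⇔ (a ≡ true ⊎ b ≡ true)
      either true  b = mk⇔ (λ _ → inj₁ refl) (λ _ ())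
      either false b = mk⇔ (inj₂ ∘ to true-bit) λ { (inj₁ ()) ; (inj₂ e) → from true-bit e }
      adjacent : ∀ p → True (eval body (p ∷ [])) ⇔ Adjacent (scan w p) (scan w (succ p))
      adjacent p = mk⇔
        (λ t → let a , b = to (true-∧ _) t in
          to (implies (isStop (scan w (succ p))) (either (isSep (scan w p)) (isStop (scan w p)))) a ,
          to (implies (isEnd (scan w (succ p))) true-bit) b)
        (λ (a , b) → from (true-∧ _)
          (from (implies (isStop (scan w (succ p))) (either (isSep (scan w p)) (isStop (scan w p)))) a ,
           from (implies (isEnd (scan w (succ p))) true-bit) b))

-- Validity of an encoded instance

unique-lookup : ∀ {A : Set} {xs : List A} → Unique xs → ∀ i j → List.lookup xs i ≡ List.lookup xs j → i ≡ j
unique-lookup (_ ∷ u)  0F          0F          e = refl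
unique-lookup (a ∷ u)  0F          (Fin.suc j) e = ⊥-elim (All.lookup a (∈-lookup j) e)
unique-lookup (a ∷ u)  (Fin.suc i) 0F          e = ⊥-elim (All.lookup a (∈-lookup i) (≡-sym e))
unique-lookup (a ∷ u)  (Fin.suc i) (Fin.suc j) e = cong Fin.suc (unique-lookup u i j e)

lookup-unique : ∀ {A : Set} (xs : List A) → (∀ i j → i Fin.< j → List.lookup xs i ≢ List.lookup xs j) → Unique xs
lookup-unique xs f = subst Unique (tabulate-lookup xs) (unique-tabulate injective)
  where
  injective : ∀ {i j} → List.lookup xs i ≡ List.lookup xs j → i ≡ j
  injective {i} {j} e with Finₚ.<-cmp i j
  ... | tri< lt _ _ = ⊥-elim (f i j lt e)
  ... | tri≈ _ eq _ = eq
  ... | tri> _ _ gt = ⊥-elim (f j i gt (≡-sym e))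

-- Row r of rs starts at position p when rs is laid out from position q.

data RowIn : ℕ → List (List ℕ) → ℕ → List ℕ → Set where
  here  : ∀ {q r rs} → RowIn q (r ∷ rs) q r
  there : ∀ {q r′ rs p r} → RowIn (q + length (encodeList r′)) rs p r → RowIn q (r′ ∷ rs) p r

rowIn-∈ : ∀ {q rs p r} → RowIn q rs p r → r ∈ rs
rowIn-∈ here      = here refl
rowIn-∈ (there i) = there (rowIn-∈ i)

∈-rowIn : ∀ {q rs r} → r ∈ rs → ∃[ p ] RowIn q rs p r
∈-rowIn (here refl) = _ , here
∈-rowIn (there m)   = _ , there (proj₂ (∈-rowIn m))

opaque
  uniqueT : Tm 4 0
  uniqueT = all′ (all′ (not′ (lt (var 1F) (var 0F) ∧′ lt (var 0F) (call lenT (domT ∷ [])) ∧′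
    not′ (call cmpT (call nthT (domT ∷ var 1F ∷ []) ∷ call nthT (domT ∷ var 0F ∷ []) ∷ [])))))

opaque
  scopeT : ℕ → Tm 4 0
  scopeT x = lt (colT x) (call lenT (domT ∷ []))

opaque
  rowsT : Tm 4 0
  rowsT = all′ (not′ rowT ∨′ (eq (call lenT (var 0F ∷ [])) (call lenT (domT ∷ [])) ∧′
    all′ (not′ (lt (var 0F) (call lenT (var 1F ∷ []))) ∨′
      -- The first `lit 1F` is the position of the size; the second is the code for less.
      eq (call cmpT (call nthT (var 1F ∷ var 0F ∷ []) ∷ lit 1F ∷ [])) (lit 1F))))

module Positions {w : Word} (L : Layout w) where
  open Numbers w
  open Layout L

  -- Reading size and domain as one list lets every row, the first included, follow a list, as in
  -- `rowIn-row` and `row-rowIn`.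
  at-1 : At 1 (encodeList (size ∷ dom) ++ encodeRows rows)
  at-1 = at [] (trans w≡ (≡-sym (trans (cong (_++ encodeRows rows) (++-assoc (encodeℕ size) (concatMap encodeℕ dom) [ 3F ]))
    (++-assoc (encodeℕ size) (encodeList dom) (encodeRows rows))))) refl

  p₀ d₀ : ℕ
  p₀ = 1 + length (encodeList (size ∷ dom))
  d₀ = after 1

  at-size : At 1 (encodeℕ size ++ encodeList dom ++ encodeRows rows)
  at-size = at [] w≡ refl

  at-dom : At d₀ (encodeList dom ++ encodeRows rows)
  at-dom = after-encodeℕ size at-size

  at-dom′ : At d₀ (encodeℕs dom ++ 3F ∷ encodeRows rows)
  at-dom′ = at-≡ (encodeList-++ dom (encodeRows rows)) at-dom

  length-dom : eval lenT (d₀ ∷ []) ≡ length dom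
  length-dom = eval-len dom at-dom

  num-dom : ∀ i → num (nth d₀ (toℕ i)) ≡ List.lookup dom i
  num-dom i = num-encodeℕ (List.lookup dom i) (proj₂ (nth-lookup dom i at-dom′))

  dom<end : ∀ i → toℕ {length dom} i < end
  dom<end i = <-trans (toℕ<n i) (length<end dom at-dom)

  opaque
    unfolding uniqueT
    true-unique : True (eval uniqueT []) ⇔ Unique dom
    true-unique = mk⇔ forth back
      where
      same : ∀ {m} → Tm 4 (2 + m)
      same = call cmpT (call nthT (domT ∷ var 1F ∷ []) ∷ call nthT (domT ∷ var 0F ∷ []) ∷ [])
      ordered in-dom clash : Tm 4 2
      ordered = lt (var 1F) (var 0F)
      in-dom = lt (var 0F) (call lenT (domT ∷ []))
      clash = ordered ∧′ in-dom ∧′ not′ same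
      forth : True (eval uniqueT []) → Unique dom
      forth t = lookup-unique dom λ i j i<j e → to (true-not _)
        (to (true-all (not′ clash) (toℕ i ∷ [])) (to (true-all (all′ (not′ clash)) []) t (toℕ i) (dom<end i)) (toℕ j) (dom<end j))
        (from (true-∧ (eval ordered (toℕ j ∷ toℕ i ∷ [])))
          (from (true-lt (var 1F) (var 0F) (toℕ j ∷ toℕ i ∷ [])) i<j ,
           from (true-∧ (eval in-dom (toℕ j ∷ toℕ i ∷ [])))
             (from (true-lt (var 0F) (call lenT (domT ∷ [])) (toℕ j ∷ toℕ i ∷ [])) (subst (toℕ j <_) (≡-sym length-dom) (toℕ<n j)) ,
              from (true-not _) (from (true-same (nth d₀ (toℕ i)) (nth d₀ (toℕ j))) (trans (num-dom i) (trans e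
                  (≡-sym (num-dom j))))))))
      back : Unique dom → True (eval uniqueT [])
      back u = from (true-all (all′ (not′ clash)) []) λ i _ → from (true-all (not′ clash) (i ∷ [])) λ j _ →
        from (true-not _) λ t →
          let a , t₁ = to (true-∧ (eval ordered (j ∷ i ∷ []))) t
              b , c  = to (true-∧ (eval in-dom (j ∷ i ∷ []))) t₁
              i<j = to (true-lt (var 1F) (var 0F) (j ∷ i ∷ [])) a
              j<l = subst (j <_) length-dom (to (true-lt (var 0F) (call lenT (domT ∷ [])) (j ∷ i ∷ [])) b)
              i<l = <-trans i<j j<l
              same-num = to (true-same (nth d₀ i) (nth d₀ j)) (to (true-not _) c)
              e = trans (≡-sym (num-dom (fromℕ< i<l))) (trans (cong (num ∘ nth d₀) (toℕ-fromℕ< i<l))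
                    (trans same-num (trans (cong (num ∘ nth d₀) (≡-sym (toℕ-fromℕ< j<l))) (num-dom (fromℕ< j<l)))))
          in <⇒≢ i<j (trans (≡-sym (toℕ-fromℕ< i<l)) (trans (cong toℕ (unique-lookup u _ _ e)) (toℕ-fromℕ< j<l)))

  col : ℕ → ℕ
  col x = eval (colT x) []

  is-column : ∀ x i → True (eval (numeralT (ℕᵇ.fromℕ x)) (nth d₀ (toℕ i) ∷ [])) ⇔ List.lookup dom i ≡ x
  is-column x i = true-numeralℕ (List.lookup dom i) x (proj₂ (nth-lookup dom i at-dom′))

  col-least : ∀ x → Least end (λ j → True (eval (numeralT (ℕᵇ.fromℕ x)) (nth d₀ j ∷ []))) (col x)
  col-least x = least-spec (call (numeralT (ℕᵇ.fromℕ x)) (call nthT (domT ∷ var 0F ∷ []) ∷ [])) []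

  col-index : Unique dom → ∀ {x} i → List.lookup dom i ≡ x → col x ≡ toℕ i
  col-index u {x} i e = least-unique (col-least x) (toℕ i) (dom<end i) (from (is-column x i) e) small
    where
    small : ∀ c → c < toℕ i → ¬ True (eval (numeralT (ℕᵇ.fromℕ x)) (nth d₀ c ∷ []))
    small c c<i t = <⇒≢ c<i (trans (≡-sym (toℕ-fromℕ< c<)) (cong toℕ (unique-lookup u (fromℕ< c<) i
      (trans (to (is-column x (fromℕ< c<)) (subst (λ j → True (eval (numeralT (ℕᵇ.fromℕ x)) (nth d₀ j ∷ []))) (≡-sym
          (toℕ-fromℕ< c<)) t)) (≡-sym e)))))
      where
      c< : c < length dom
      c< = <-trans c<i (toℕ<n i)

  opaque
    unfolding scopeT
    true-scope : ∀ x → True (eval (scopeT x) []) → ∃[ i ] List.lookup dom i ≡ x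
    true-scope x t = fromℕ< c< , to (is-column x (fromℕ< c<))
      (subst (λ j → True (eval (numeralT (ℕᵇ.fromℕ x)) (nth d₀ j ∷ []))) (≡-sym (toℕ-fromℕ< c<))
        (Least.found (col-least x) (<-trans c< (length<end dom at-dom))))
      where
      c< : col x < length dom
      c< = subst (col x <_) length-dom (to (true-lt (colT x) (call lenT (domT ∷ [])) []) t)

    scope-true : Unique dom → ∀ {x} i → List.lookup dom i ≡ x → True (eval (scopeT x) [])
    scope-true u {x} i e = from (true-lt (colT x) (call lenT (domT ∷ [])) [])
      (subst₂ _<_ (≡-sym (col-index u i e)) (≡-sym length-dom) (toℕ<n i))

  open RowStarts w

  at-entry : ∀ ns {q u} → At q (encodeList ns ++ u) → At (q + length (encodeℕs ns)) (3F ∷ u)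
  at-entry ns {q} {u} A = at-skip (encodeℕs ns) (at-≡ (encodeList-++ ns u) A)

  length-encodeList : ∀ ns q → q + length (encodeList ns) ≡ suc (q + length (encodeℕs ns))
  length-encodeList ns q = trans (cong (q +_) (trans (length-++ (encodeℕs ns)) (+-comm _ 1))) (+-suc q _)

  rowIn-at : ∀ {q rs p r} → At q (encodeRows rs) → RowIn q rs p r → ∃[ u ] At p (encodeList r ++ u)
  rowIn-at A here = _ , A
  rowIn-at A (there {r′ = r′} i) = rowIn-at (at-skip (encodeList r′) A) i

  list<end : ∀ ns {p u} → At p (encodeList ns ++ u) → p < end
  list<end ns {p} {u} A = subst (p <_) (trans (cong (p +_) (≡-sym (length-++ (encodeℕs ns)))) (at-end (at-≡ (encodeList-++ ns u) A)))
    (subst (λ n → p < n) (cong (p +_) (≡-sym (+-suc (length (encodeℕs ns)) (length u)))) (subst (p <_) (≡-sym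
        (+-suc p _)) (s≤s (m≤m+n p _))))

  rowIn-row : ∀ ns {q rs p r} → At q (encodeList ns ++ encodeRows rs) → RowIn (q + length (encodeList ns)) rs p r → Row p
  rowIn-row ns {q} {r ∷ rs} A here = from (true-row _)
    ( trans (cong (isStop ∘ scan w ∘ pred) (length-encodeList ns q)) (cong isStop (at-scan (at-entry ns A)))
    , λ e → not-end (trans (≡-sym (Correctness.isEnd-scan w w _ (s≤s⁻¹ (list<end r (at-skip (encodeList ns) A))))) e))
    where
    not-end : false ≡ true → ⊥
    not-end ()
  rowIn-row ns A (there {r′ = r′} i) = rowIn-row r′ (at-skip (encodeList ns) A) i

  no-stop : ∀ v {q u} → All (_≢ 3F) v → At q (v ++ u) → ∀ j → q ≤ j → j < q + length v → isStop (scan w j) ≢ true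
  no-stop [] [] A j le lt = ⊥-elim (<⇒≱ lt (subst (_≤ j) (≡-sym (+-identityʳ _)) le))
  no-stop (a ∷ v) {q} {u} (a≢ ∷ v≢) A j le lt with m≤n⇒m<n∨m≡n le
  ... | inj₂ refl = λ e → a≢ (stop (trans (≡-sym (cong isStop (at-scan A))) e))
    where
    stop : ∀ {a} → isStop (sym a) ≡ true → a ≡ 3F
    stop {3F} _ = refl
  ... | inj₁ q<j = no-stop v v≢ (subst (λ z → At z (v ++ u)) (+-comm q 1) (at-skip [ a ] {v ++ u} A)) j q<j (subst
      (j <_) (+-suc q (length v)) lt)

  no-stop-digits : ∀ b → All (_≢ 3F) (digits b)
  no-stop-digits ℕᵇ.zero  = []
  no-stop-digits 2[1+ b ] = (λ ()) ∷ no-stop-digits b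
  no-stop-digits 1+[2 b ] = (λ ()) ∷ no-stop-digits b

  no-stop-numbers : ∀ ns → All (_≢ 3F) (encodeℕs ns)
  no-stop-numbers []       = []
  no-stop-numbers (n ∷ ns) = Allₚ.++⁺ (Allₚ.++⁺ (no-stop-digits (ℕᵇ.fromℕ n)) ((λ ()) ∷ [])) (no-stop-numbers ns)

  -- A list contains no stop before its last letter, so the local test cannot succeed inside it: `p`
  -- is the start of the next row or lies beyond that start.
  row-rowIn : ∀ ns rs {q p} → At q (encodeList ns ++ encodeRows rs) → q < p → Row p →
              ∃[ r ] RowIn (q + length (encodeList ns)) rs p r
  row-rowIn ns rs {q} {suc p} A (s≤s q≤p) row with p <? q + length (encodeℕs ns)
  ... | yes p< = ⊥-elim (no-stop (encodeℕs ns) (no-stop-numbers ns) (at-≡ (encodeList-++ ns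
      (encodeRows rs)) A) p q≤p p< (proj₁ (to (true-row (suc p)) row)))
  ... | no p≮ with m≤n⇒m<n∨m≡n (subst (_≤ suc p) (≡-sym (length-encodeList ns q)) (s≤s (≮⇒≥ p≮)))
  row-rowIn ns [] {q} {p} A q<p row | no _ | inj₁ lt =
    ⊥-elim (<⇒≱ (row-bound row) (<⇒≤ (subst (_< p) (trans (≡-sym (+-identityʳ _)) (at-end (at-skip (encodeList ns) A))) lt)))
  row-rowIn ns [] {q} A q<p row | no _ | inj₂ eq =
    ⊥-elim (<⇒≱ (row-bound row) (≤-reflexive (trans (≡-sym (at-end (at-skip (encodeList ns) A))) (trans (+-identityʳ _) eq))))
  row-rowIn ns (r ∷ rs) {q} A q<p row | no _ | inj₂ eq = r , subst (λ p → RowIn (q + length (encodeList ns)) (r ∷ rs) p r) eq here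
  row-rowIn ns (r ∷ rs) {q} A q<p row | no _ | inj₁ lt with row-rowIn r rs (at-skip (encodeList ns) A) lt row
  ... | r′ , i = r′ , there i

  RowAt : ℕ → List ℕ → Set
  RowAt = RowIn p₀ rows

  rowAt-row : ∀ {p r} → RowAt p r → Row p
  rowAt-row = rowIn-row (size ∷ dom) at-1

  row-rowAt : ∀ {p} → Row p → ∃[ r ] RowAt p r
  row-rowAt {p} row = row-rowIn (size ∷ dom) rows at-1 (1< p (proj₁ (to (true-row p) row))) row
    where
    1< : ∀ p → isStop (scan w (pred p)) ≡ true → 1 < p
    1< zero          ()
    1< (suc zero)    ()
    1< (suc (suc p)) _ = s≤s (s≤s z≤n)

  rowAt-at : ∀ {p r} → RowAt p r → ∃[ u ] At p (encodeList r ++ u)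
  rowAt-at = rowIn-at (at-skip (encodeList (size ∷ dom)) at-1)

  ProperRow : List ℕ → Set
  ProperRow r = length r ≡ length dom × (∀ i → List.lookup r i < size)

  opaque
    unfolding rowsT
    true-rows : True (eval rowsT []) ⇔ (∀ {p r} → RowAt p r → ProperRow r)
    true-rows = mk⇔ forth back
      where
      in-bounds below-size entry-ok : Tm 4 2
      in-bounds = lt (var 0F) (call lenT (var 1F ∷ []))
      below-size = eq (call cmpT (call nthT (var 1F ∷ var 0F ∷ []) ∷ lit 1F ∷ [])) (lit 1F)
      entry-ok = not′ in-bounds ∨′ below-size
      full row-ok : Tm 4 1
      full = eq (call lenT (var 0F ∷ [])) (call lenT (domT ∷ []))
      row-ok = full ∧′ all′ entry-ok
      num-size : num 1 ≡ size
      num-size = num-encodeℕ size at-size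
      proper : ∀ {p r} → RowAt p r → True (eval row-ok (p ∷ [])) ⇔ ProperRow r
      proper {p} {r} i with rowAt-at i
      ... | u , A = mk⇔ there′ here′
        where
        len : eval lenT (p ∷ []) ≡ length r
        len = eval-len r A
        num-entry : ∀ i → num (nth p (toℕ i)) ≡ List.lookup r i
        num-entry i = num-encodeℕ (List.lookup r i) (proj₂ (nth-lookup r i (at-≡ (encodeList-++ r u) A)))
        small-entry : ∀ k → True (eval below-size (k ∷ p ∷ [])) ⇔ num (nth p k) < size
        small-entry k = mk⇔
          (λ t → subst (num (nth p k) <_) num-size (to (cmp-less (nth p k) 1)
            (to (true-eq (call cmpT (call nthT (var 1F ∷ var 0F ∷ []) ∷ lit 1F ∷ [])) (lit 1F) (k ∷ p ∷ [])) t)))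
          (λ lt → from (true-eq (call cmpT (call nthT (var 1F ∷ var 0F ∷ []) ∷ lit 1F ∷ [])) (lit 1F) (k ∷ p ∷ []))
            (from (cmp-less (nth p k) 1) (subst (num (nth p k) <_) (≡-sym num-size) lt)))
        in-row : ∀ k → True (eval in-bounds (k ∷ p ∷ [])) ⇔ k < length r
        in-row k = mk⇔ (λ t → subst (k <_) len (to (true-lt (var 0F) (call lenT (var 1F ∷ [])) (k ∷ p ∷ [])) t))
          (λ k< → from (true-lt (var 0F) (call lenT (var 1F ∷ [])) (k ∷ p ∷ [])) (subst (k <_) (≡-sym len) k<))
        there′ : True (eval row-ok (p ∷ [])) → ProperRow r
        there′ t with to (true-∧ (eval full (p ∷ []))) t
        ... | a , b = trans (≡-sym len) (trans (to (true-eq (call lenT (var 0F ∷ [])) (call lenT (domT ∷ []))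
            (p ∷ [])) a) length-dom) , small
          where
          small : ∀ i → List.lookup r i < size
          small i with to (true-∨ (eval (not′ in-bounds) (toℕ i ∷ p ∷ []))) (to (true-all entry-ok (p ∷ [])) b
              (toℕ i) (<-trans (toℕ<n i) (length<end r A)))
          ... | inj₁ n = ⊥-elim (to (true-not _) n (from (in-row (toℕ i)) (toℕ<n i)))
          ... | inj₂ l = subst (_< size) (num-entry i) (to (small-entry (toℕ i)) l)
        here′ : ProperRow r → True (eval row-ok (p ∷ []))
        here′ (a , b) = from (true-∧ (eval full (p ∷ [])))
          ( from (true-eq (call lenT (var 0F ∷ [])) (call lenT (domT ∷ [])) (p ∷ [])) (trans len (trans a (≡-sym length-dom)))
          , from (true-all entry-ok (p ∷ [])) λ k _ → checked k (k <? length r))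
          where
          checked : ∀ k → Dec (k < length r) → True (eval entry-ok (k ∷ p ∷ []))
          checked k (no k≮)  = from (true-∨ (eval (not′ in-bounds) (k ∷ p ∷ []))) (inj₁ (from (true-not _) (k≮ ∘ to (in-row k))))
          checked k (yes k<) = from (true-∨ (eval (not′ in-bounds) (k ∷ p ∷ []))) (inj₂ (from (small-entry k)
            (subst (_< size) (trans (≡-sym (num-entry (fromℕ< k<))) (cong (num ∘ nth p) (toℕ-fromℕ< k<))) (b (fromℕ< k<)))))
      forth : True (eval rowsT []) → ∀ {p r} → RowAt p r → ProperRow r
      forth t {p} i with to (true-∨ (eval (not′ rowT) (p ∷ []))) (to (true-all (not′ rowT ∨′ row-ok) []) t p (row-bound (rowAt-row i)))
      ... | inj₁ n = ⊥-elim (to (true-not _) n (rowAt-row i))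
      ... | inj₂ r = to (proper i) r
      back : (∀ {p r} → RowAt p r → ProperRow r) → True (eval rowsT [])
      back f = from (true-all (not′ rowT ∨′ row-ok) []) λ p _ → ok p (true? (eval rowT (p ∷ [])))
        where
        ok : ∀ p → Dec (Row p) → True (eval (not′ rowT ∨′ row-ok) (p ∷ []))
        ok p (no n)    = from (true-∨ (eval (not′ rowT) (p ∷ []))) (inj₁ (from (true-not _) n))
        ok p (yes row) with row-rowAt row
        ... | r , i = from (true-∨ (eval (not′ rowT) (p ∷ []))) (inj₂ (from (proper i) (f i)))

opaque
  -- Words that encode no instance are outside the language, so the graph test is preceded by tests
  -- of validity.
  algorithm : ℕ → ℕ → Tm 4 0
  algorithm x y = syntaxT ∧′ uniqueT ∧′ scopeT x ∧′ scopeT y ∧′ rowsT ∧′ Terms.graphT x y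

module _ (x y : ℕ) (w : Word) where
  open TermSemantics w

  opaque
    unfolding algorithm
    true-algorithm : True (eval (algorithm x y) []) ⇔
      (True (eval syntaxT []) × True (eval uniqueT []) × True (eval (scopeT x) []) × True (eval (scopeT y) []) ×
       True (eval rowsT []) × True (eval (Terms.graphT x y) []))
    true-algorithm = mk⇔
      (λ t → let a , t₁ = to (true-∧ (eval syntaxT [])) t ; b , t₂ = to (true-∧ (eval uniqueT [])) t₁
                 c , t₃ = to (true-∧ (eval (scopeT x) [])) t₂ ; d , t₄ = to (true-∧ (eval (scopeT y) [])) t₃
                 e , f = to (true-∧ (eval rowsT [])) t₄ in a , b , c , d , e , f)
      (λ (a , b , c , d , e , f) → from (true-∧ (eval syntaxT [])) (a , from (true-∧ (eval uniqueT [])) (b ,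
        from (true-∧ (eval (scopeT x) [])) (c , from (true-∧ (eval (scopeT y) [])) (d , from (true-∧ (eval rowsT [])) (e , f))))))

-- Teams and consistent orientations

values : ∀ {m n} → Vec (Fin n) m → List ℕ
values s = toList (Vec.map toℕ s)

values-< : ∀ {m n} (s : Vec (Fin n) m) i → List.lookup (values s) i < n
values-< (a ∷ s) 0F          = toℕ<n a
values-< (a ∷ s) (Fin.suc i) = values-< s i

values-surjective : ∀ {n} m (r : List ℕ) → length r ≡ m → (∀ i → List.lookup r i < n) → ∃[ s ] values {m} {n} s ≡ r
values-surjective zero    []      e f = [] , refl
values-surjective (suc m) (a ∷ r) e f with values-surjective m r (suc-injective e) (f ∘ Fin.suc)
... | s , eq = fromℕ< (f 0F) ∷ s , cong₂ _∷_ (toℕ-fromℕ< (f 0F)) eq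

module _ (x y : ℕ) where
  φ : Formula
  φ = dep x y ∨ dep y x

  module Correct (I : Instance φ) where
    open Instance I

    w : Word
    w = encode I

    L : Layout w
    L = layout size dom (List.map values rows)
      (cong (λ u → encodeℕ size ++ encodeList dom ++ u) (≡-sym (concatMap-map encodeList values rows)))

    open Positions L
    open Terms x y
    open Graph w

    x∈ : x ∈ dom
    x∈ = proj₁ (proj₁ scope)

    y∈ : y ∈ dom
    y∈ = proj₂ (proj₁ scope)

    -- The two disjuncts carry separate membership proofs for `x` and `y`; in a duplicate-free
    -- domain they name the same columns.
    index-unique : ∀ {v} (p q : v ∈ dom) → index p ≡ index q
    index-unique p q = unique-lookup domUnique (index p) (index q) (trans (≡-sym (lookup-index p)) (lookup-index q))

    assignmentAt : ∀ {p} → Row p → ∃[ s ] s ∈ rows × RowAt p (values s)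
    assignmentAt row with row-rowAt row
    ... | r , i with ∈-map⁻ values (rowIn-∈ i)
    ... | s , s∈ , refl = s , s∈ , i

    positionOf : ∀ {s} → s ∈ rows → ∃[ p ] RowAt p (values s)
    positionOf s∈ = ∈-rowIn (∈-map⁺ values s∈)

    nth-vec : ∀ {n} (v : Vec ℕ n) (i : Fin n) {p u} → At p (encodeℕs (toList v) ++ u) → num (nth p (toℕ i)) ≡ lookup v i
    nth-vec v i {p} {u} A = num-encodeℕ (lookup v i) {u = encodeℕs (drop (suc (toℕ i)) (toList v)) ++ u}
      (at-≡ (trans (cong (λ ns → encodeℕs ns ++ u) (drop-lookup v i)) (++-assoc (encodeℕ (lookup v i)) _ u))
        (nth-encodeℕs (toList v) (toℕ i) A (subst (toℕ i ≤_) (≡-sym (length-toList v)) (toℕ≤n i))))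
      where
      drop-lookup : ∀ {n} (v : Vec ℕ n) i → drop (toℕ i) (toList v) ≡ lookup v i ∷ drop (suc (toℕ i)) (toList v)
      drop-lookup (a ∷ v) 0F          = refl
      drop-lookup (a ∷ v) (Fin.suc i) = drop-lookup v i

    key-value : ∀ side {p} {s : Assignment dom (Fin size)} (v∈ : column side ∈ dom) → RowAt p (values s) → key side p ≡ toℕ (s ⟨ v∈ ⟩)
    key-value side {p} {s} v∈ i with rowAt-at i
    ... | u , A = trans (key-cell side p)
      (trans (cong (num ∘ nth p) (col-index domUnique (index v∈) (≡-sym (lookup-index v∈))))
        (trans (nth-vec (Vec.map toℕ s) (index v∈) (at-≡ (encodeList-++ (values s) u) A)) (lookup-map (index v∈) toℕ s)))

    edge-unique : ∀ {p q} → E p → E q → key true p ≡ key true q → key false p ≡ key false q → p ≡ q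
    edge-unique {p} {q} Ep Eq kx ky with <-cmp p q
    ... | tri< p<q _ _ = ⊥-elim (proj₂ (to (edge-spec q) Eq) p (p<q , edge-row Ep , kx , ky))
    ... | tri≈ _ e _   = e
    ... | tri> _ _ q<p = ⊥-elim (proj₂ (to (edge-spec p) Ep) q (q<p , edge-row Eq , ≡-sym kx , ≡-sym ky))

    -- Passing to an earlier row with the same two cells must stop, and it stops at an edge.
    representative : ∀ p → Row p → ∃[ q ] E q × key true q ≡ key true p × key false q ≡ key false p
    representative = <-rec _ λ p rec row → go p rec row (anyUpTo? (λ c → map′ (to (true-smaller c p)) (from
        (true-smaller c p)) (true? _)) p)
      where
      go : ∀ p → (∀ {c} → c < p → Row c → ∃[ q ] E q × key true q ≡ key true c × key false q ≡ key false c) → Row p →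
           Dec (∃[ c ] c < p × Smaller p c) → ∃[ q ] E q × key true q ≡ key true p × key false q ≡ key false p
      go p rec row (no n) = p , from (edge-spec p) (row , λ c s → n (c , proj₁ s , s)) , refl , refl
      go p rec row (yes (c , c<p , _ , row-c , kx , ky)) with rec c<p row-c
      ... | q , Eq , kx′ , ky′ = q , Eq , trans kx′ kx , trans ky′ ky

    sat⇒consistent : Sat team φ scope → ∃[ o ] Consistent E key o
    sat⇒consistent (T₁ , T₂ , (split , _) , lift dep₁ , lift dep₂) = (λ p → assign p (E? p)) , consistent
      where
      -- `T₁` and `T₂` are arbitrary predicates and may overlap; the inclusion of the team in their
      -- union makes the choice.
      assign : ∀ p → Dec (E p) → Bool
      assign p (no _) = true
      assign p (yes Ep) with split (proj₁ (proj₂ (assignmentAt (edge-row Ep))))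
      ... | inj₁ _ = true
      ... | inj₂ _ = false

      Assigned : ℕ → Bool → Set
      Assigned p true  = ∃[ s ] RowAt p (values s) × T₁ s
      Assigned p false = ∃[ s ] RowAt p (values s) × T₂ s

      assigned : ∀ {p} → E p → ∀ d → Assigned p (assign p d)
      assigned Ep (no ¬E) = ⊥-elim (¬E Ep)
      assigned _ (yes Ep) with split (proj₁ (proj₂ (assignmentAt (edge-row Ep))))
      ... | inj₁ t = _ , proj₂ (proj₂ (assignmentAt (edge-row Ep))) , t
      ... | inj₂ t = _ , proj₂ (proj₂ (assignmentAt (edge-row Ep))) , t

      agree : ∀ b {p q} → E p → E q → Assigned p b → Assigned q b → key b p ≡ key b q → p ≡ q
      agree true Ep Eq (s , i , t) (s′ , i′ , t′) k = edge-unique Ep Eq k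
        (trans (key-value false y∈ i) (trans (cong toℕ (dep₁ s s′ t t′
          (toℕ-injective (trans (≡-sym (key-value true x∈ i)) (trans k (key-value true x∈ i′)))))) (≡-sym (key-value false y∈ i′))))
      agree false Ep Eq (s , i , t) (s′ , i′ , t′) k = edge-unique Ep Eq
        (trans (key-value true x∈′ i) (trans (cong toℕ (dep₂ s s′ t t′
          (toℕ-injective (trans (≡-sym (key-value false y∈′ i)) (trans k (key-value false y∈′ i′)))))) (≡-sym
              (key-value true x∈′ i′)))) k
        where
        x∈′ : x ∈ dom
        x∈′ = proj₂ (proj₂ scope)
        y∈′ : y ∈ dom
        y∈′ = proj₁ (proj₂ scope)

      consistent : Consistent E key (λ p → assign p (E? p))
      consistent {p} {q} Ep Eq same k =
        agree _ Ep Eq (assigned Ep (E? p)) (subst (Assigned q) (≡-sym same) (assigned Eq (E? q))) k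

    consistent⇒sat : ∃[ o ] Consistent E key o → Sat team φ scope
    consistent⇒sat (o , consistent) = Part true , Part false , (split , join) , lift dep₁ , lift dep₂
      where
      -- Rows that agree on `x` and `y` but differ elsewhere follow their common edge.
      Part : Bool → Team dom (Fin size)
      Part b s = s ∈ rows × ∃[ p ] E p × o p ≡ b × key true p ≡ toℕ (s ⟨ x∈ ⟩) × key false p ≡ toℕ (s ⟨ y∈ ⟩)

      split : ∀ {s} → s ∈ rows → Part true s ⊎ Part false s
      split {s} s∈ with positionOf s∈
      ... | p , i with representative p (rowAt-row i)
      ... | q , Eq , kx , ky with o q in oq
      ... | true  = inj₁ (s∈ , q , Eq , oq , trans kx (key-value true x∈ i) , trans ky (key-value false y∈ i))
      ... | false = inj₂ (s∈ , q , Eq , oq , trans kx (key-value true x∈ i) , trans ky (key-value false y∈ i))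

      join : ∀ {s} → Part true s ⊎ Part false s → s ∈ rows
      join (inj₁ (s∈ , _)) = s∈
      join (inj₂ (s∈ , _)) = s∈

      dep₁ : ∀ s₁ s₂ → Part true s₁ → Part true s₂ → s₁ ⟨ x∈ ⟩ ≡ s₂ ⟨ x∈ ⟩ → s₁ ⟨ y∈ ⟩ ≡ s₂ ⟨ y∈ ⟩
      dep₁ s₁ s₂ (_ , p , Ep , op , kx , ky) (_ , q , Eq , oq , kx′ , ky′) e = toℕ-injective
        (trans (≡-sym ky) (trans (cong (key false) (consistent Ep Eq (trans op (≡-sym oq))
          (subst (λ b → key b p ≡ key b q) (≡-sym op) (trans kx (trans (cong toℕ e) (≡-sym kx′)))))) ky′))

      dep₂ : ∀ s₁ s₂ → Part false s₁ → Part false s₂ →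
             s₁ ⟨ proj₁ (proj₂ scope) ⟩ ≡ s₂ ⟨ proj₁ (proj₂ scope) ⟩ → s₁ ⟨ proj₂ (proj₂ scope) ⟩ ≡ s₂ ⟨ proj₂ (proj₂ scope) ⟩
      dep₂ s₁ s₂ (_ , p , Ep , op , kx , ky) (_ , q , Eq , oq , kx′ , ky′) e
        rewrite index-unique (proj₁ (proj₂ scope)) y∈ | index-unique (proj₂ (proj₂ scope)) x∈ = toℕ-injective
        (trans (≡-sym kx) (trans (cong (key true) (consistent Ep Eq (trans op (≡-sym oq))
          (subst (λ b → key b p ≡ key b q) (≡-sym op) (trans ky (trans (cong toℕ e) (≡-sym ky′)))))) kx′))

    correct : True (eval (algorithm x y) []) ⇔ Sat team φ scope
    correct = mk⇔ (λ t → consistent⇒sat (to true-graph (proj₂ (proj₂ (proj₂ (proj₂ (proj₂ (to (true-algorithm x y w) t))))))))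
      (λ sat → from (true-algorithm x y w)
        ( from (Syntax.true-syntax w) L
        , from true-unique domUnique
        , scope-true domUnique (index x∈) (≡-sym (lookup-index x∈))
        , scope-true domUnique (index y∈) (≡-sym (lookup-index y∈))
        , from true-rows proper
        , from true-graph (sat⇒consistent sat)))
      where
      proper : ∀ {p r} → RowAt p r → ProperRow r
      proper i with ∈-map⁻ values (rowIn-∈ i)
      ... | s , s∈ , refl = length-toList (Vec.map toℕ s) , values-< s

  decode : ∀ w → True (Semantics.eval w (algorithm x y) []) → Σ[ I ∈ Instance φ ] encode I ≡ w
  decode w t with to (true-algorithm x y w) t
  ... | syn , uniq , sx , sy , rs , _ with to (Syntax.true-syntax w) syn
  ... | L@(layout size dom rows w≡) = I , trans (cong (λ u → encodeℕ size ++ encodeList dom ++ u)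
      (trans (≡-sym (concatMap-map encodeList values assignments)) (cong encodeRows (proj₂ decoded)))) (≡-sym w≡)
    where
    open Positions L
    member : ∀ {v} → ∃[ i ] List.lookup dom i ≡ v → v ∈ dom
    member (i , refl) = ∈-lookup i
    decode-rows : ∀ {rs} → All ProperRow rs → ∃[ as ] List.map (values {length dom} {size}) as ≡ rs
    decode-rows [] = [] , refl
    decode-rows {r ∷ _} ((len , small) ∷ ps) with values-surjective (length dom) r len small | decode-rows ps
    ... | s , e | as , es = s ∷ as , cong₂ _∷_ e es
    decoded : ∃[ as ] List.map (values {length dom} {size}) as ≡ rows
    decoded = decode-rows (All.tabulate λ r∈ → to true-rows rs (proj₂ (∈-rowIn r∈)))
    assignments : List (Vec (Fin size) (length dom))
    assignments = proj₁ decoded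
    I : Instance φ
    I = record
      { dom = dom ; domUnique = to true-unique uniq
      ; scope = (member (true-scope x sx) , member (true-scope y sy)) , (member (true-scope y sy) , member (true-scope x sx))
      ; size = size ; rows = assignments }

  decides : ∀ w → MC φ w ⇔ True (Semantics.eval w (algorithm x y) [])
  decides w = mk⇔ (λ { (I , refl , sat) → from (Correct.correct I) sat }) accept
    where
    accept : True (Semantics.eval w (algorithm x y) []) → MC φ w
    accept t with decode w t
    ... | I , refl = I , refl , to (Correct.correct I) t

theorem15 : (x y : Var) → x ≢ y → InLogspace (MC (dep x y ∨ dep y x))
theorem15 x y _ = logspace-term (algorithm x y) (decides x y)
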